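{- The rank-nullity ring $R^*(U_{r,n})= A^*(U_{n,n})^{S_n}$ of the uniform matroid is isomorphic to the quotient of the polynomial ring $\mathbb{Z}[Z_1, \dots, Z_n]$ by the ideal $\mathcal I$ generated by the polynomials $$Z_a \cdot \left( \sum_{i = b}^n \binom{i-a-1}{b-a-1} (Z_i + Z_{i+1} + \dots + Z_n )^{b-a} \right) \qquad \text{for } 0\leq a < b \leq n$$ (with the convention $Z_0 = 1$), where the class $[Z_i]$ corresponds to $z_i \in R^*(U_{r,n})$. Furthermore, these polynomials are a Gröbner basis for $\mathcal I$ with respect to any monomial order with $Z_1 \succ Z_2 \succ \dots \succ Z_n$.
   Context: Let $A^*(U_{n,n})=\mathbb{Z}[x_S : \emptyset \neq S \subseteq [n]]/(\langle x_S x_T : S\not\subseteq T,\ T\not\subseteq S\rangle+\langle \sum_{S\ni e}x_S : e\in[n]\rangle)$, with $S_n$ acting by permuting the subsets. For a matroid $M$ on $[n]$ with rank function $\mathrm{rk}$ and nullity $\mathrm{null}(S)=|S|-\mathrm{rk}(S)$, let $y_{i,j}=\sum_{\emptyset\neq S,\ \mathrm{rk}(S)=i,\ \mathrm{null}(S)=j} x_S$ and $R^*(M)=\mathbb{Z}[y_{i,j}]\subseteq A^*(U_{n,n})$. For the uniform matroid $U_{r,n}$, $R^*(U_{r,n})=\mathbb{Z}[z_1,\dots,z_n]$ with $z_l=\sum_{|S|=l}x_S$, and it equals $A^*(U_{n,n})^{S_n}$. -}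

module Defs where

open import Level using (Level; _⊔_) renaming (suc to lsuc; zero to lzero)
open import Data.Nat as ℕ using (ℕ; zero; suc; _∸_; _<?_)
open import Data.Nat.Combinatorics using (_C_)
open import Data.Integer as ℤ using (ℤ; +_; 0ℤ; 1ℤ)
open import Data.Fin as Fin using (Fin; fromℕ<)
open import Data.Fin.Properties using (all?; _≟_)
open import Data.Fin.Subset using (Subset; _∈_; _⊆_; ∣_∣; inside; outside)
open import Data.Fin.Subset.Properties using (_∈?_; nonempty?)
open import Data.List as List using (List; []; _∷_; _++_; map; foldr; concatMap; filter; length; lookup; upTo)
open import Data.List.Relation.Unary.All using (All)
open import Data.Vec using ([]; _∷_)
open import Data.Product using (Σ; ∃; ∃₂; _×_; _,_; proj₁; proj₂)
open import Data.Sum using (_⊎_)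
open import Data.Bool using (if_then_else_)
open import Relation.Nullary using (¬_; Dec; yes; no; does)
open import Relation.Binary.PropositionalEquality using (_≡_; _≢_)
open import Induction.WellFounded using (WellFounded)
open import Function.Bundles using (_⇔_)

-- Polynomials over ℤ in variables X_0,…,X_{k-1} (indexed by Fin k).
-- A monomial is an exponent vector; a polynomial is a finite list of
-- terms (coefficient , monomial); two polynomials are equal when all
-- their coefficients agree.

Mon : ℕ → Set
Mon k = Fin k → ℕ

_≐_ : ∀ {k} → Mon k → Mon k → Set
m ≐ m' = ∀ i → m i ≡ m' i

_≐?_ : ∀ {k} (m m' : Mon k) → Dec (m ≐ m')
m ≐? m' = all? (λ i → m i ℕ.≟ m' i)

_⊕_ : ∀ {k} → Mon k → Mon k → Mon k
(m ⊕ m') i = m i ℕ.+ m' i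

oneMon : ∀ {k} → Mon k
oneMon _ = 0

unitMon : ∀ {k} → Fin k → Mon k
unitMon i j = if does (i ≟ j) then 1 else 0

Poly : ℕ → Set
Poly k = List (ℤ × Mon k)

coeff : ∀ {k} → Poly k → Mon k → ℤ
coeff [] m = 0ℤ
coeff ((c , m') ∷ f) m = if does (m' ≐? m) then c ℤ.+ coeff f m else coeff f m

_≈_ : ∀ {k} → Poly k → Poly k → Set
f ≈ g = ∀ m → coeff f m ≡ coeff g m

0ₚ : ∀ {k} → Poly k
0ₚ = []

constₚ : ∀ {k} → ℤ → Poly k
constₚ c = (c , oneMon) ∷ []

1ₚ : ∀ {k} → Poly k
1ₚ = constₚ 1ℤ

var : ∀ {k} → Fin k → Poly k
var i = (1ℤ , unitMon i) ∷ []

_+ₚ_ : ∀ {k} → Poly k → Poly k → Poly k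
f +ₚ g = f ++ g

_*ₚ_ : ∀ {k} → Poly k → Poly k → Poly k
f *ₚ g = concatMap (λ t → map (λ s → (proj₁ t ℤ.* proj₁ s , proj₂ t ⊕ proj₂ s)) g) f

_^ₚ_ : ∀ {k} → Poly k → ℕ → Poly k
f ^ₚ zero = 1ₚ
f ^ₚ suc e = f *ₚ (f ^ₚ e)

Σₚ : ∀ {k} → List (Poly k) → Poly k
Σₚ = foldr _+ₚ_ 0ₚ

Πₚ : ∀ {k} → List (Poly k) → Poly k
Πₚ = foldr _*ₚ_ 1ₚ

ΣRange : ∀ {k} → ℕ → ℕ → (ℕ → Poly k) → Poly k
ΣRange b e F = Σₚ (map (λ j → F (b ℕ.+ j)) (upTo (suc e ∸ b)))

subst : ∀ {k l} → (Fin k → Poly l) → Poly k → Poly l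
subst s f = Σₚ (map (λ t → constₚ (proj₁ t) *ₚ Πₚ (map (λ i → s i ^ₚ proj₂ t i) (List.allFin _))) f)

_∈⟨_⟩ : ∀ {k} → Poly k → (Poly k → Set) → Set
f ∈⟨ P ⟩ = Σ (List (Poly _ × Poly _)) λ hs →
  All (λ hg → P (proj₂ hg)) hs × (f ≈ Σₚ (map (λ hg → proj₁ hg *ₚ proj₂ hg) hs))

record IsMonomialOrder {k} (_≺_ : Mon k → Mon k → Set) : Set where
  field
    resp    : ∀ {m m' u u'} → m ≐ m' → u ≐ u' → m ≺ u → m' ≺ u'
    irrefl  : ∀ {m} → ¬ (m ≺ m)
    trans   : ∀ {m u w} → m ≺ u → u ≺ w → m ≺ w
    total   : ∀ m u → m ≺ u ⊎ m ≐ u ⊎ u ≺ m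
    mult    : ∀ {m u} w → m ≺ u → (m ⊕ w) ≺ (u ⊕ w)
    wellFounded : WellFounded _≺_

LeadMon : ∀ {k} → (Mon k → Mon k → Set) → Poly k → Mon k → Set
LeadMon _≺_ f m = coeff f m ≢ 0ℤ × (∀ m' → coeff f m' ≢ 0ℤ → m' ≺ m ⊎ m' ≐ m)

leadTerm : ∀ {k} → Poly k → Mon k → Poly k
leadTerm f m = (coeff f m , m) ∷ []

IsGroebnerBasis : ∀ {k} → (Mon k → Mon k → Set) → (Poly k → Set) → (Poly k → Set) → Set
IsGroebnerBasis {k} _≺_ G I =
  (∀ g → G g → I g) ×
  (∀ f m → I f → LeadMon _≺_ f m →
     leadTerm f m ∈⟨ (λ t → Σ (Poly k) λ g → Σ (Mon k) λ mg →
                         G g × LeadMon _≺_ g mg × t ≡ leadTerm g mg) ⟩)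

-- The ring A*(U_{n,n}) = ℤ[x_S : ∅ ≠ S ⊆ [n]] / J.
-- Variables are indexed by positions in an explicit list of all nonempty
-- subsets of [n] = Fin n (each occurs exactly once).

subsets : (n : ℕ) → List (Subset n)
subsets zero = [] ∷ []
subsets (suc n) = map (inside ∷_) (subsets n) ++ map (outside ∷_) (subsets n)

neSubsets : (n : ℕ) → List (Subset n)
neSubsets n = filter nonempty? (subsets n)

N : ℕ → ℕ
N n = length (neSubsets n)

setOf : ∀ n → Fin (N n) → Subset n
setOf n = lookup (neSubsets n)

x : ∀ n → Fin (N n) → Poly (N n)
x n = var

data GenJ (n : ℕ) : Poly (N n) → Set where
  incomparable : ∀ s t → ¬ (setOf n s ⊆ setOf n t) → ¬ (setOf n t ⊆ setOf n s) →
                 GenJ n (x n s *ₚ x n t)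
  linear       : ∀ (e : Fin n) →
                 GenJ n (Σₚ (map (x n) (filter (λ s → e ∈? setOf n s) (List.allFin (N n)))))

z : ∀ n → ℕ → Poly (N n)
z n l = Σₚ (map (x n) (filter (λ s → ∣ setOf n s ∣ ℕ.≟ l) (List.allFin (N n))))

-- ℤ[Z_1,…,Z_n]: Z_i is the variable with index i-1 : Fin n; Z_0 = 1.

Z : ∀ n → ℕ → Poly n
Z n zero = 1ₚ
Z n (suc i) with i <? n
... | yes p = var (fromℕ< p)
... | no _  = 0ₚ

gen : ∀ n → ℕ → ℕ → Poly n
gen n a b = Z n a *ₚ ΣRange b n (λ i →
  constₚ (+ ((i ∸ a ∸ 1) C (b ∸ a ∸ 1))) *ₚ (ΣRange i n (Z n) ^ₚ (b ∸ a)))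

data GenI (n : ℕ) : Poly n → Set where
  gen-ab : ∀ a b → a ℕ.< b → b ℕ.≤ n → GenI n (gen n a b)

φ : ∀ n → Poly n → Poly (N n)
φ n = subst (λ i → z n (suc (Fin.toℕ i)))

{-# OPTIONS --safe #-}
-- Let λ_i = Σ_{|S| ≥ i} x_S. In A^*(U_{n,n}) one has x_S (Σ_{U ⊇ T} x_U)^{|T|−|S|} = 0 for S ⊂ T. Summed over all T
-- of size b and all S of size a, and with the products of the x_U sorted by their smallest set, these relations become
-- the generators of the ideal. Modulo the generators every polynomial is a combination of standard monomials, those not
-- divisible by any Z_a Z_b^{b−a}. Their images are linearly independent: the degree functional A^{n−1} → ℤ, defined by
-- Eur's formula, kills the relations by Pascal's rule, and it pairs the standard monomials triangularly with squarefree
-- monomials supported on a complete flag. Hence the kernel is the ideal of the generators, and the leading monomial of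
-- an element of the ideal is never standard.
module Submission where

open import Defs
open import Data.Nat using (ℕ)
open import Data.Fin using (_<_)
open import Data.Product using (_×_)
open import Function.Bundles using (_⇔_)

open import Algebra.Bundles using (CommutativeRing; CommutativeSemiring)
open import Data.Bool using (Bool; true; false; _∧_; if_then_else_)
import Data.Bool.Properties as Bool
open import Data.Empty using () renaming (⊥ to Empty)
open import Data.Fin as Fin using (Fin)
import Data.Fin.Properties as Fin
open import Data.Fin.Subset using (Subset; _∈_; _∉_; _⊆_; ∣_∣; inside; outside; ⁅_⁆; Nonempty; ⊥; ⊤; _∪_) renaming (_-_ to _-ˢ_)
open import Data.Fin.Subset.Properties
  using ( _∈?_; _⊆?_; nonempty?; ⊆-trans; ⊆-antisym; ⊆-min; ⊆-max; in⊆in; drop-∷-⊆; ∈⊤; ∉⊥; Empty-unique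
        ; ∣p∣≤n; ∣⊥∣≡0; ∣⊤∣≡n; ∣p∣≡n⇒p≡⊤; p⊆q⇒∣p∣≤∣q∣; p⊂q⇒∣p∣<∣q∣; p─q⊆p; x∈p⇒∣p-x∣<∣p∣; x∈p∧x≢y⇒x∈p-y
        ; ∪-identityʳ; x∈p∪q⁺; x∈p∪q⁻; x∈⁅x⁆; x∈⁅y⁆⇒x≡y )
open import Data.Integer as ℤ using (ℤ; 0ℤ; 1ℤ)
import Data.Integer.Properties as ℤ
open import Data.Integer.Tactic.RingSolver using (solve-∀)
open import Data.List as List using (List; []; _∷_; _++_; map; foldr; concatMap; filter; length; lookup; upTo)
open import Data.List.Membership.Propositional renaming (_∈_ to _∈ˡ_) using ()
open import Data.List.Membership.Propositional.Properties
  using (∈-filter⁺; ∈-filter⁻; ∈-map⁺; ∈-map⁻; ∈-++⁺ˡ; ∈-++⁺ʳ; ∈-lookup)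
open import Data.List.Properties
  using (++-assoc; map-tabulate; tabulate-lookup; upTo-∷ʳ; length-filter; filter-accept; filter-reject)
open import Data.List.Relation.Unary.All as All using (All; []; _∷_)
import Data.List.Relation.Unary.All.Properties as All
open import Data.List.Relation.Unary.AllPairs using ([]; _∷_)
open import Data.List.Relation.Unary.Any as Any using (Any; here; there)
open import Data.List.Relation.Unary.Any.Properties using (lookup-index)
open import Data.List.Relation.Unary.Unique.Propositional using (Unique)
import Data.List.Relation.Unary.Unique.Propositional.Properties as Unique
open import Data.Nat as ℕ using (zero; suc; _∸_; z≤n; s≤s; _<?_)
open import Data.Nat.Combinatorics using (_C_; nCn≡1; nCk+nC[k+1]≡[n+1]C[k+1])
open import Data.Nat.Induction using (<-wellFounded)
import Data.Nat.Properties as ℕ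
import Data.Nat.Tactic.RingSolver as ℕ-RingSolver
open import Data.Product using (Σ; ∃; ∃₂; _,_; proj₁; proj₂)
open import Data.Product.Relation.Binary.Lex.Strict using (×-wellFounded)
open import Data.Sum using (_⊎_; inj₁; inj₂; [_,_]′)
open import Data.Unit using (tt) renaming (⊤ to Unit)
open import Data.Vec using (_∷_; []; here; there)
open import Data.Vec.Properties using (≡-dec; ∷-injectiveʳ)
open import Function using (_∘_; mk⇔)
open import Induction.WellFounded using (Acc; acc; WellFounded)
open import Level using (0ℓ)
import Relation.Binary.Construct.On as On
open import Relation.Binary.Definitions using (tri<; tri≈; tri>)
open import Relation.Binary.PropositionalEquality as ≡ using (_≡_; _≢_; refl; sym; trans; cong; cong₂)
import Relation.Binary.Reasoning.Setoid as SetoidReasoning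
open import Relation.Nullary using (¬_; Dec; yes; no; does; _because_; contradiction; ¬?)
open import Relation.Nullary.Decidable using (_×-dec_; _⊎-dec_; _→-dec_; does-⇔; dec-true; dec-false; decidable-stable)
open import Relation.Unary using (Decidable)


-- The isomorphism and the Gröbner property rest on the same two facts: the generators have leading
-- coefficient 1, so division by them works over ℤ; and a standard polynomial mapped into J is 0.
-- Hence a kernel element has normal form 0, and an element of the ideal with a standard leading
-- monomial would, after reduction of its lower terms, be a nonzero standard polynomial in the
-- kernel. The obstacle is that a product of z's and x's expands into many monomials, whose degrees
-- are hard to add up. But the degree of a monomial depends only on whether its sets form a chain
-- and on the number of factors of each size, and the latter is the same for all terms: where the
-- volume of the sizes is 0, so is the pairing. On the diagonal, z_l x_S = x_S^2 for |S| = l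
-- collapses the product to one monomial. The partner of a standard monomial is read off from Eur's
-- formula. Let Z_l^e occupy the sizes l-e, ..., l-1. Divisibility by Z_a Z_b^(b-a) says that b
-- occupies a. In a standard monomial the flag takes the free sizes below n, and each exponent fills
-- exactly the gap before it, so that all binomial coefficients are 1.

binom : ℕ → ℕ → ℕ
binom n       zero    = 1
binom zero    (suc k) = 0
binom (suc n) (suc k) = binom n k ℕ.+ binom n (suc k)

-- Pascal's rule holds for `binom` by computation, which the countings and the degree formula rely
-- on; the coefficients of the generators are translated from `_C_` once, here.
binom≡C : ∀ n k → binom n k ≡ n C k
binom≡C n       zero    = refl
binom≡C zero    (suc k) = refl
binom≡C (suc n) (suc k) = trans (cong₂ ℕ._+_ (binom≡C n k) (binom≡C n (suc k))) (nCk+nC[k+1]≡[n+1]C[k+1] n k)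

binom-> : ∀ {n k} → n ℕ.< k → binom n k ≡ 0
binom-> {zero}  {suc k} _        = refl
binom-> {suc n} {suc k} (s≤s n<k) = cong₂ ℕ._+_ (binom-> n<k) (binom-> (ℕ.m<n⇒m<1+n n<k))

binom-diag : ∀ n → binom n n ≡ 1
binom-diag zero    = refl
binom-diag (suc n) = cong₂ ℕ._+_ (binom-diag n) (binom-> (ℕ.n<1+n n))

-- Finite sums, products and powers in a commutative semiring.

module Sums (R : CommutativeSemiring 0ℓ 0ℓ) where
  open CommutativeSemiring R public using (Carrier; _+_; _*_; 0#; 1#; setoid) renaming (_≈_ to _≃_)
  private module R = CommutativeSemiring R
  open import Algebra.Properties.Semiring.Mult R.semiring public using () renaming (_×_ to _·_)
  open SetoidReasoning R.setoid

  private variable I J : Set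

  ∑ : List I → (I → Carrier) → Carrier
  ∑ []      f = 0#
  ∑ (i ∷ l) f = f i + ∑ l f

  -- Restricted sums run over the whole index list with a Boolean factor, so that any two sums can
  -- be interchanged whatever their conditions are.
  when : Bool → Carrier → Carrier
  when true  r = r
  when false r = 0#

  pow : Carrier → ℕ → Carrier
  pow r zero    = 1#
  pow r (suc k) = r * pow r k

  +-interchange : ∀ a b c d → (a + b) + (c + d) ≃ (a + c) + (b + d)
  +-interchange a b c d = begin
    (a + b) + (c + d) ≈⟨ R.+-assoc _ _ _ ⟩
    a + (b + (c + d)) ≈⟨ R.+-congˡ (R.+-assoc _ _ _) ⟨
    a + ((b + c) + d) ≈⟨ R.+-congˡ (R.+-congʳ (R.+-comm _ _)) ⟩
    a + ((c + b) + d) ≈⟨ R.+-congˡ (R.+-assoc _ _ _) ⟩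
    a + (c + (b + d)) ≈⟨ R.+-assoc _ _ _ ⟨
    (a + c) + (b + d) ∎

  *-interchange : ∀ a b c d → (a * b) * (c * d) ≃ (a * c) * (b * d)
  *-interchange a b c d = begin
    (a * b) * (c * d) ≈⟨ R.*-assoc _ _ _ ⟩
    a * (b * (c * d)) ≈⟨ R.*-congˡ (R.*-assoc _ _ _) ⟨
    a * ((b * c) * d) ≈⟨ R.*-congˡ (R.*-congʳ (R.*-comm _ _)) ⟩
    a * ((c * b) * d) ≈⟨ R.*-congˡ (R.*-assoc _ _ _) ⟩
    a * (c * (b * d)) ≈⟨ R.*-assoc _ _ _ ⟨
    (a * c) * (b * d) ∎

  *-left-comm : ∀ a b c → a * (b * c) ≃ b * (a * c)
  *-left-comm a b c = R.trans (R.sym (R.*-assoc a b c)) (R.trans (R.*-congʳ (R.*-comm a b)) (R.*-assoc b a c))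

  *-resp-≡ : ∀ {a a′ b b′ c} → a ≡ a′ → b ≡ b′ → a′ * b′ ≃ c → a * b ≃ c
  *-resp-≡ refl refl e = e

  ∑-cong : ∀ (l : List I) {f g} → (∀ i → f i ≃ g i) → ∑ l f ≃ ∑ l g
  ∑-cong []      eq = R.refl
  ∑-cong (i ∷ l) eq = R.+-cong (eq i) (∑-cong l eq)

  ∑-zero : ∀ (l : List I) {f} → (∀ i → f i ≃ 0#) → ∑ l f ≃ 0#
  ∑-zero []      eq = R.refl
  ∑-zero (i ∷ l) eq = R.trans (R.+-cong (eq i) (∑-zero l eq)) (R.+-identityˡ 0#)

  ∑-+ : ∀ (l : List I) f g → ∑ l (λ i → f i + g i) ≃ ∑ l f + ∑ l g
  ∑-+ []      f g = R.sym (R.+-identityˡ 0#)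
  ∑-+ (i ∷ l) f g = R.trans (R.+-congˡ (∑-+ l f g)) (+-interchange _ _ _ _)

  ∑-split₂ : ∀ (l : List I) {f} a b {A B} → (∀ i → f i ≃ a i + b i) → ∑ l a ≃ A → ∑ l b ≃ B → ∑ l f ≃ A + B
  ∑-split₂ l a b f≃ a≃ b≃ = R.trans (∑-cong l f≃) (R.trans (∑-+ l a b) (R.+-cong a≃ b≃))

  ∑-split₃ : ∀ (l : List I) {f} a b c {A B C} → (∀ i → f i ≃ a i + (b i + c i)) →
    ∑ l a ≃ A → ∑ l b ≃ B → ∑ l c ≃ C → ∑ l f ≃ A + (B + C)
  ∑-split₃ l a b c f≃ a≃ b≃ c≃ = ∑-split₂ l a (λ i → b i + c i) f≃ a≃ (∑-split₂ l b c (λ _ → R.refl) b≃ c≃)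

  ∑-*ˡ : ∀ r (l : List I) f → r * ∑ l f ≃ ∑ l (λ i → r * f i)
  ∑-*ˡ r []      f = R.zeroʳ r
  ∑-*ˡ r (i ∷ l) f = R.trans (R.distribˡ _ _ _) (R.+-congˡ (∑-*ˡ r l f))

  ∑-*ʳ : ∀ r (l : List I) f → ∑ l f * r ≃ ∑ l (λ i → f i * r)
  ∑-*ʳ r []      f = R.zeroˡ r
  ∑-*ʳ r (i ∷ l) f = R.trans (R.distribʳ _ _ _) (R.+-congˡ (∑-*ʳ r l f))

  ∑-swap : ∀ (k : List I) (l : List J) (f : I → J → Carrier) → ∑ k (λ i → ∑ l (f i)) ≃ ∑ l (λ j → ∑ k (λ i → f i j))
  ∑-swap []      l f = R.sym (∑-zero l (λ _ → R.refl))
  ∑-swap (i ∷ k) l f = R.trans (R.+-congˡ (∑-swap k l f)) (R.sym (∑-+ l (f i) (λ j → ∑ k (λ i′ → f i′ j))))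

  ∑-++ : ∀ (k l : List I) f → ∑ (k ++ l) f ≃ ∑ k f + ∑ l f
  ∑-++ []      l f = R.sym (R.+-identityˡ _)
  ∑-++ (i ∷ k) l f = R.trans (R.+-congˡ (∑-++ k l f)) (R.sym (R.+-assoc _ _ _))

  ∑-map : ∀ (h : I → J) l f → ∑ (map h l) f ≡ ∑ l (f ∘ h)
  ∑-map h []      f = refl
  ∑-map h (i ∷ l) f = cong (f (h i) +_) (∑-map h l f)

  ∑-concatMap : ∀ (h : I → List J) l f → ∑ (concatMap h l) f ≃ ∑ l (λ i → ∑ (h i) f)
  ∑-concatMap h []      f = R.refl
  ∑-concatMap h (i ∷ l) f = R.trans (∑-++ (h i) _ f) (R.+-congˡ (∑-concatMap h l f))

  ∑-filter : ∀ {P : I → Set} (P? : Decidable P) l f → ∑ (filter P? l) f ≃ ∑ l (λ i → when (does (P? i)) (f i))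
  ∑-filter P? []      f = R.refl
  ∑-filter P? (i ∷ l) f with P? i
  ... | true  because _ = R.+-congˡ (∑-filter P? l f)
  ... | false because _ = R.trans (∑-filter P? l f) (R.sym (R.+-identityˡ _))

  foldr-map≡∑ : ∀ (f : I → Carrier) l → foldr _+_ 0# (map f l) ≡ ∑ l f
  foldr-map≡∑ f []      = refl
  foldr-map≡∑ f (i ∷ l) = cong (f i +_) (foldr-map≡∑ f l)

  when-yes : ∀ {P : Set} (P? : Dec P) → P → ∀ {r} → when (does P?) r ≡ r
  when-yes P? p {r} = cong (λ b → when b r) (dec-true P? p)

  when-no : ∀ {P : Set} (P? : Dec P) → ¬ P → ∀ {r} → when (does P?) r ≡ 0#
  when-no P? ¬p {r} = cong (λ b → when b r) (dec-false P? ¬p)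

  when-zero? : ∀ {P : Set} (P? : Dec P) {r} → (P → r ≃ 0#) → when (does P?) r ≃ 0#
  when-zero? (yes p) r≃0 = r≃0 p
  when-zero? (no _)  r≃0 = R.refl

  when-cong? : ∀ {P : Set} (P? : Dec P) {r s} → (P → r ≃ s) → when (does P?) r ≃ when (does P?) s
  when-cong? (yes p) r≃s = r≃s p
  when-cong? (no _)  r≃s = R.refl

  ∑-∷ʳ : ∀ (l : List I) i f → ∑ (l ++ i ∷ []) f ≃ ∑ l f + f i
  ∑-∷ʳ l i f = R.trans (∑-++ l (i ∷ []) f) (R.+-congˡ (R.+-identityʳ _))

  ∑-upTo-suc : ∀ m f → ∑ (upTo (suc m)) f ≃ ∑ (upTo m) f + f m
  ∑-upTo-suc m f = R.trans (R.reflexive (cong (λ l → ∑ l f) (sym (upTo-∷ʳ m)))) (∑-∷ʳ (upTo m) m f)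

  when-cong : ∀ b {r s} → r ≃ s → when b r ≃ when b s
  when-cong true  eq = eq
  when-cong false eq = R.refl

  when-zero : ∀ b {r} → r ≃ 0# → when b r ≃ 0#
  when-zero true  eq = eq
  when-zero false eq = R.refl

  *-when : ∀ b r s → r * when b s ≃ when b (r * s)
  *-when true  r s = R.refl
  *-when false r s = R.zeroʳ r

  when-* : ∀ b r s → when b s * r ≃ when b (s * r)
  when-* true  r s = R.refl
  when-* false r s = R.zeroˡ r

  when-∧ : ∀ a b r → when a (when b r) ≡ when (a ∧ b) r
  when-∧ true  b r = refl
  when-∧ false b r = refl

  when-swap : ∀ a b r → when a (when b r) ≡ when b (when a r)
  when-swap true  b     r = refl
  when-swap false true  r = refl
  when-swap false false r = refl

  when-+ : ∀ b r s → when b (r + s) ≃ when b r + when b s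
  when-+ true  r s = R.refl
  when-+ false r s = R.sym (R.+-identityˡ 0#)

  ∑-when-*ˡ : ∀ r (l : List I) (q : I → Bool) (f : I → Carrier) → ∑ l (λ i → when (q i) (r * f i)) ≃ r * ∑ l (λ i → when (q i) (f i))
  ∑-when-*ˡ r l q f = R.sym (R.trans (∑-*ˡ r l (λ i → when (q i) (f i))) (∑-cong l (λ i → *-when (q i) r (f i))))

  when-∑ : ∀ b (l : List I) f → when b (∑ l f) ≃ ∑ l (λ i → when b (f i))
  when-∑ true  l f = R.refl
  when-∑ false l f = R.sym (∑-zero l (λ _ → R.refl))

  ∑-· : ∀ n (l : List I) f → ∑ l (λ i → n · f i) ≃ n · ∑ l f
  ∑-· zero    l f = ∑-zero l (λ _ → R.refl)
  ∑-· (suc n) l f = R.trans (∑-+ l f (λ i → n · f i)) (R.+-congˡ (∑-· n l f))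

  pow-cong : ∀ k {r s} → r ≃ s → pow r k ≃ pow s k
  pow-cong zero    eq = R.refl
  pow-cong (suc k) eq = R.*-cong eq (pow-cong k eq)

  pow-unique : ∀ {r} (p : ℕ → Carrier) → p 0 ≡ 1# → (∀ k → p (suc k) ≡ r * p k) → ∀ k → p k ≡ pow r k
  pow-unique p p-0 p-suc zero    = p-0
  pow-unique p p-0 p-suc (suc k) = trans (p-suc k) (cong (_ *_) (pow-unique p p-0 p-suc k))

  pow-+ : ∀ r k l → pow r (k ℕ.+ l) ≃ pow r k * pow r l
  pow-+ r zero    l = R.sym (R.*-identityˡ _)
  pow-+ r (suc k) l = R.trans (R.*-congˡ (pow-+ r k l)) (R.sym (R.*-assoc _ _ _))

  ∏ : List I → (I → Carrier) → Carrier
  ∏ []      f = 1#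
  ∏ (i ∷ l) f = f i * ∏ l f

  ∏-unique : ∀ {f : I → Carrier} (p : List I → Carrier) → p [] ≡ 1# → (∀ i l → p (i ∷ l) ≡ f i * p l) → ∀ l → p l ≡ ∏ l f
  ∏-unique p p-[] p-∷ []      = p-[]
  ∏-unique p p-[] p-∷ (i ∷ l) = trans (p-∷ i l) (cong (_ *_) (∏-unique p p-[] p-∷ l))

  -- Induction principles that keep sums, powers and products folded, which matters in concrete rings.
  pow-ind : ∀ {r} (Q : ℕ → Carrier → Set) → Q 0 1# → (∀ {k s} → Q k s → Q (suc k) (r * s)) → ∀ k → Q k (pow r k)
  pow-ind Q Q-0 Q-suc zero    = Q-0
  pow-ind Q Q-0 Q-suc (suc k) = Q-suc (pow-ind Q Q-0 Q-suc k)

  ∑-ind : ∀ {f : I → Carrier} (Q : List I → Carrier → Set) → Q [] 0# → (∀ i {l s} → Q l s → Q (i ∷ l) (f i + s)) →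
    ∀ l → Q l (∑ l f)
  ∑-ind Q Q-[] Q-∷ []      = Q-[]
  ∑-ind Q Q-[] Q-∷ (i ∷ l) = Q-∷ i (∑-ind Q Q-[] Q-∷ l)

  ∏-ind : ∀ {f : I → Carrier} (Q : List I → Carrier → Set) → Q [] 1# → (∀ i {l s} → Q l s → Q (i ∷ l) (f i * s)) →
    ∀ l → Q l (∏ l f)
  ∏-ind Q Q-[] Q-∷ []      = Q-[]
  ∏-ind Q Q-[] Q-∷ (i ∷ l) = Q-∷ i (∏-ind Q Q-[] Q-∷ l)

  -- Applied to r = z_l and s = x_S with |S| = l: a single factor x_S turns all the z_l next to it
  -- into x_S.
  pow-absorb : ∀ {r s} → r * s ≃ s * s → ∀ k l → pow r k * pow s (suc l) ≃ pow s (k ℕ.+ suc l)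
  pow-absorb         rs≃ss zero    l = R.*-identityˡ _
  pow-absorb {r} {s} rs≃ss (suc k) l = begin
    r * pow r k * pow s (suc l)      ≈⟨ R.*-assoc _ _ _ ⟩
    r * (pow r k * pow s (suc l))    ≈⟨ R.*-congˡ (pow-absorb rs≃ss k l) ⟩
    r * pow s (k ℕ.+ suc l)          ≡⟨ cong (λ e → r * pow s e) (ℕ.+-suc k l) ⟩
    r * (s * pow s (k ℕ.+ l))        ≈⟨ R.*-assoc _ _ _ ⟨
    r * s * pow s (k ℕ.+ l)          ≈⟨ R.*-congʳ rs≃ss ⟩
    s * s * pow s (k ℕ.+ l)          ≈⟨ R.*-assoc _ _ _ ⟩
    s * (s * pow s (k ℕ.+ l))        ≡⟨ cong (λ e → s * pow s e) (ℕ.+-suc k l) ⟨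
    s * pow s (k ℕ.+ suc l)          ∎

  ∏-cong : ∀ (l : List I) {f g} → (∀ i → f i ≃ g i) → ∏ l f ≃ ∏ l g
  ∏-cong []      eq = R.refl
  ∏-cong (i ∷ l) eq = R.*-cong (eq i) (∏-cong l eq)

  ∏-* : ∀ (l : List I) f g → ∏ l (λ i → f i * g i) ≃ ∏ l f * ∏ l g
  ∏-* []      f g = R.sym (R.*-identityˡ 1#)
  ∏-* (i ∷ l) f g = R.trans (R.*-congˡ (∏-* l f g)) (*-interchange _ _ _ _)

  foldr-map≡∏ : ∀ (f : I → Carrier) l → foldr _*_ 1# (map f l) ≡ ∏ l f
  foldr-map≡∏ f []      = refl
  foldr-map≡∏ f (i ∷ l) = cong (f i *_) (foldr-map≡∏ f l)

-- Monomials, term lists and their coefficients.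

≐-refl : ∀ {k} {m : Mon k} → m ≐ m
≐-refl i = refl

≐-sym : ∀ {k} {m u : Mon k} → m ≐ u → u ≐ m
≐-sym e i = sym (e i)

≐-trans : ∀ {k} {m u w : Mon k} → m ≐ u → u ≐ w → m ≐ w
≐-trans e e′ i = trans (e i) (e′ i)

⊕-cong : ∀ {k} {m m′ u u′ : Mon k} → m ≐ m′ → u ≐ u′ → (m ⊕ u) ≐ (m′ ⊕ u′)
⊕-cong e e′ i = cong₂ ℕ._+_ (e i) (e′ i)

⊕-comm : ∀ {k} (m u : Mon k) → (m ⊕ u) ≐ (u ⊕ m)
⊕-comm m u i = ℕ.+-comm (m i) (u i)

≐?-cong : ∀ {k} {m m′ u u′ : Mon k} → m ≐ m′ → u ≐ u′ → does (m ≐? u) ≡ does (m′ ≐? u′)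
≐?-cong {m = m} {m′} {u} {u′} e e′ = does-⇔ (mk⇔
  (λ p → ≐-trans (≐-sym e) (≐-trans p e′)) (λ q → ≐-trans e (≐-trans q (≐-sym e′)))) (m ≐? u) (m′ ≐? u′)

negₚ : ∀ {k} → Poly k → Poly k
negₚ = map (λ t → ℤ.- proj₁ t , proj₂ t)

coeff-yes : ∀ {k} c {u m : Mon k} f → u ≐ m → coeff ((c , u) ∷ f) m ≡ c ℤ.+ coeff f m
coeff-yes c {u} {m} f p rewrite dec-true (u ≐? m) p = refl

coeff-no : ∀ {k} c {u m : Mon k} f → ¬ (u ≐ m) → coeff ((c , u) ∷ f) m ≡ coeff f m
coeff-no c {u} {m} f ¬p rewrite dec-false (u ≐? m) ¬p = refl

coeff-++ : ∀ {k} (f g : Poly k) m → coeff (f ++ g) m ≡ coeff f m ℤ.+ coeff g m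
coeff-++ []            g m = sym (ℤ.+-identityˡ _)
coeff-++ ((c , u) ∷ f) g m with does (u ≐? m)
... | true  = trans (cong (ℤ._+_ c) (coeff-++ f g m)) (sym (ℤ.+-assoc c _ _))
... | false = coeff-++ f g m

coeff-neg : ∀ {k} (f : Poly k) m → coeff (negₚ f) m ≡ ℤ.- coeff f m
coeff-neg []            m = refl
coeff-neg ((c , u) ∷ f) m with does (u ≐? m)
... | true  = trans (cong (ℤ._+_ (ℤ.- c)) (coeff-neg f m)) (sym (ℤ.neg-distrib-+ c _))
... | false = coeff-neg f m

coeff-cong : ∀ {k} (f : Poly k) {m u} → m ≐ u → coeff f m ≡ coeff f u
coeff-cong []            e = refl
coeff-cong ((c , w) ∷ f) {m} {u} e with w ≐? m
... | yes p = trans (coeff-yes c f p) (trans (cong (ℤ._+_ c) (coeff-cong f e)) (sym (coeff-yes c f (≐-trans p e))))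
... | no ¬p = trans (coeff-no c f ¬p) (trans (coeff-cong f e) (sym (coeff-no c f (λ q → ¬p (≐-trans q (≐-sym e))))))

_≉?_ : ∀ {k} (t : ℤ × Mon k) m → Dec (¬ (proj₂ t ≐ m))
t ≉? m = ¬? (proj₂ t ≐? m)

remove : ∀ {k} → Mon k → Poly k → Poly k
remove m = filter (_≉? m)

remove-yes : ∀ {k} {c} {u m : Mon k} f → u ≐ m → remove m ((c , u) ∷ f) ≡ remove m f
remove-yes f p = filter-reject (_≉? _) (λ ¬p → ¬p p)

remove-no : ∀ {k} {c} {u m : Mon k} f → ¬ (u ≐ m) → remove m ((c , u) ∷ f) ≡ (c , u) ∷ remove m f
remove-no f ¬p = filter-accept (_≉? _) ¬p

module _ {k} {Q : Mon k → Set} (Q? : ∀ m → Dec (Q m)) (Q-resp : ∀ {m u} → m ≐ u → Q m → Q u) where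
  coeff-filter-no : ∀ f {u} → ¬ Q u → coeff (filter (Q? ∘ proj₂) f) u ≡ 0ℤ
  coeff-filter-no []            ¬q = refl
  coeff-filter-no ((c , w) ∷ f) {u} ¬q with Q? w
  ... | yes q  = trans (coeff-no c (filter (Q? ∘ proj₂) f) (λ w≐u → ¬q (Q-resp w≐u q))) (coeff-filter-no f ¬q)
  ... | no  _  = coeff-filter-no f ¬q

  coeff-filter-yes : ∀ f {u} → Q u → coeff (filter (Q? ∘ proj₂) f) u ≡ coeff f u
  coeff-filter-yes []            q = refl
  coeff-filter-yes ((c , w) ∷ f) {u} q with Q? w
  ... | no ¬q = trans (coeff-filter-yes f q) (sym (coeff-no c f (λ w≐u → ¬q (Q-resp (≐-sym w≐u) q))))
  ... | yes _ with w ≐? u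
  ...   | yes w≐u = trans (coeff-yes c (filter (Q? ∘ proj₂) f) w≐u) (trans (cong (ℤ._+_ c) (coeff-filter-yes f q)) (sym (coeff-yes c f w≐u)))
  ...   | no  w≭u = trans (coeff-no c (filter (Q? ∘ proj₂) f) w≭u) (trans (coeff-filter-yes f q) (sym (coeff-no c f w≭u)))

≭-resp : ∀ {k} {m u v : Mon k} → u ≐ v → ¬ (u ≐ m) → ¬ (v ≐ m)
≭-resp u≐v u≭m v≐m = u≭m (≐-trans u≐v v≐m)

coeff-remove-≐ : ∀ {k} {m u : Mon k} f → u ≐ m → coeff (remove m f) u ≡ 0ℤ
coeff-remove-≐ {m = m} f p = coeff-filter-no (λ u → ¬? (u ≐? m)) ≭-resp f (λ ¬p → ¬p p)

coeff-remove-≭ : ∀ {k} {m u : Mon k} f → ¬ (u ≐ m) → coeff (remove m f) u ≡ coeff f u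
coeff-remove-≭ {m = m} f = coeff-filter-yes (λ u → ¬? (u ≐? m)) ≭-resp f

-- Linear extension of functions on monomials.

record IsScalar (R : CommutativeRing 0ℓ 0ℓ) (ι : ℤ → CommutativeRing.Carrier R) : Set where
  private module R = CommutativeRing R
  field
    ι-+ : ∀ a b → ι (a ℤ.+ b) R.≈ (ι a R.+ ι b)
    ι-* : ∀ a b → ι (a ℤ.* b) R.≈ (ι a R.* ι b)
    ι-0 : ι 0ℤ R.≈ R.0#
    ι-1 : ι 1ℤ R.≈ R.1#

module Lin (R : CommutativeRing 0ℓ 0ℓ) {ι : ℤ → CommutativeRing.Carrier R} (isScalar : IsScalar R ι) where
  open IsScalar isScalar public
  open Sums (CommutativeRing.commutativeSemiring R)
  private module R = CommutativeRing R
  open SetoidReasoning R.setoid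

  -- The linear extension of w from monomials to term lists. Coefficients, evaluation at ring
  -- elements and the degree are all of this form, so its laws are proved once for all of them.
  lin : ∀ {k} → (Mon k → Carrier) → Poly k → Carrier
  lin w f = ∑ f (λ t → ι (proj₁ t) * w (proj₂ t))

  Resp : ∀ {k} → (Mon k → Carrier) → Set
  Resp w = ∀ {m u} → m ≐ u → w m ≃ w u

  lin-++ : ∀ {k} (w : Mon k → Carrier) f g → lin w (f ++ g) ≃ lin w f + lin w g
  lin-++ w f g = ∑-++ f g _

  lin-congʷ : ∀ {k} {w v : Mon k → Carrier} f → (∀ m → w m ≃ v m) → lin w f ≃ lin v f
  lin-congʷ f e = ∑-cong f (λ t → R.*-congˡ (e (proj₂ t)))

  lin-Σ : ∀ {k} {I : Set} (w : Mon k → Carrier) (l : List I) G → lin w (Σₚ (map G l)) ≃ ∑ l (λ i → lin w (G i))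
  lin-Σ w []      G = R.refl
  lin-Σ w (i ∷ l) G = R.trans (lin-++ w (G i) _) (R.+-congˡ (lin-Σ w l G))

  lin-neg : ∀ {k} (w : Mon k → Carrier) f → lin w f + lin w (negₚ f) ≃ 0#
  lin-neg w f = begin
    lin w f + lin w (negₚ f)  ≡⟨ cong (lin w f +_) (∑-map _ f _) ⟩
    lin w f + ∑ f _           ≈⟨ ∑-+ f _ _ ⟨
    ∑ f (λ t → ι (proj₁ t) * w (proj₂ t) + ι (ℤ.- proj₁ t) * w (proj₂ t)) ≈⟨ ∑-zero f (λ (c , m) → begin
      ι c * w m + ι (ℤ.- c) * w m ≈⟨ R.distribʳ _ _ _ ⟨
      (ι c + ι (ℤ.- c)) * w m     ≈⟨ R.*-congʳ (ι-+ c _) ⟨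
      ι (c ℤ.- c) * w m           ≡⟨ cong (λ b → ι b * w m) (ℤ.+-inverseʳ c) ⟩
      ι 0ℤ * w m                  ≈⟨ R.*-congʳ ι-0 ⟩
      0# * w m                    ≈⟨ R.zeroˡ _ ⟩
      0# ∎) ⟩
    0# ∎

  lin-linear : ∀ {k} (w : Mon k → Carrier) r f → r * lin w f ≃ lin (λ m → r * w m) f
  lin-linear w r f = R.trans (∑-*ˡ r f _) (∑-cong f (λ t → *-left-comm _ _ _))

  lin-* : ∀ {k} (w : Mon k → Carrier) f g → lin w (f *ₚ g) ≃ lin (λ m → lin (λ u → w (m ⊕ u)) g) f
  lin-* w f g = R.trans (∑-concatMap _ f _) (∑-cong f (λ (c , m) → begin
    ∑ (map _ g) _                                             ≡⟨ ∑-map _ g _ ⟩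
    ∑ g (λ (d , u) → ι (c ℤ.* d) * w (m ⊕ u))                 ≈⟨ ∑-cong g (λ (d , u) →
                                                                   R.trans (R.*-congʳ (ι-* c d)) (R.*-assoc _ _ _)) ⟩
    ∑ g (λ (d , u) → ι c * (ι d * w (m ⊕ u)))                 ≈⟨ ∑-*ˡ (ι c) g _ ⟨
    ι c * lin (λ u → w (m ⊕ u)) g                             ∎))

  lin-swap : ∀ {k l} (w : Mon k → Mon l → Carrier) f g →
    lin (λ m → lin (w m) g) f ≃ lin (λ u → lin (λ m → w m u) f) g
  lin-swap w f g = begin
    ∑ f (λ (c , m) → ι c * ∑ g (λ (d , u) → ι d * w m u))   ≈⟨ ∑-cong f (λ t → ∑-*ˡ _ g _) ⟩
    ∑ f (λ (c , m) → ∑ g (λ (d , u) → ι c * (ι d * w m u))) ≈⟨ ∑-swap f g _ ⟩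
    ∑ g (λ (d , u) → ∑ f (λ (c , m) → ι c * (ι d * w m u))) ≈⟨ ∑-cong g (λ s → ∑-cong f (λ t → *-left-comm _ _ _)) ⟩
    ∑ g (λ (d , u) → ∑ f (λ (c , m) → ι d * (ι c * w m u))) ≈⟨ ∑-cong g (λ t → ∑-*ˡ _ f _) ⟨
    ∑ g (λ (d , u) → ι d * ∑ f (λ (c , m) → ι c * w m u))   ∎

  lin-const : ∀ {k} (w : Mon k → Carrier) c → lin w (constₚ c) ≃ ι c * w oneMon
  lin-const w c = R.+-identityʳ _

  lin-remove : ∀ {k} (w : Mon k → Carrier) → Resp w → ∀ m f →
    lin w f ≃ ι (coeff f m) * w m + lin w (remove m f)
  lin-remove w resp m [] = R.sym (R.trans (R.+-identityʳ _) (R.trans (R.*-congʳ ι-0) (R.zeroˡ _)))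
  lin-remove w resp m ((c , u) ∷ f) with u ≐? m
  ... | yes p = begin
    ι c * w u + lin w f                                        ≈⟨ R.+-cong (R.*-congˡ (resp p)) (lin-remove w resp m f) ⟩
    ι c * w m + (ι (coeff f m) * w m + lin w (remove m f))     ≈⟨ R.+-assoc _ _ _ ⟨
    ι c * w m + ι (coeff f m) * w m + lin w (remove m f)       ≈⟨ R.+-congʳ (R.distribʳ _ _ _) ⟨
    (ι c + ι (coeff f m)) * w m + lin w (remove m f)           ≈⟨ R.+-congʳ (R.*-congʳ (ι-+ _ _)) ⟨
    ι (c ℤ.+ coeff f m) * w m + lin w (remove m f)             ≡⟨ cong₂ (λ a l → ι a * w m + lin w l)
                                                                    (coeff-yes c f p) (remove-yes f p) ⟨
    ι (coeff ((c , u) ∷ f) m) * w m + lin w (remove m ((c , u) ∷ f)) ∎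
  ... | no ¬p = begin
    ι c * w u + lin w f                                        ≈⟨ R.+-congˡ (lin-remove w resp m f) ⟩
    ι c * w u + (ι (coeff f m) * w m + lin w (remove m f))     ≈⟨ R.+-assoc _ _ _ ⟨
    ι c * w u + ι (coeff f m) * w m + lin w (remove m f)       ≈⟨ R.+-congʳ (R.+-comm _ _) ⟩
    ι (coeff f m) * w m + ι c * w u + lin w (remove m f)       ≈⟨ R.+-assoc _ _ _ ⟩
    ι (coeff f m) * w m + (ι c * w u + lin w (remove m f))     ≡⟨ cong₂ (λ a l → ι a * w m + lin w l)
                                                                    (coeff-no c f ¬p) (remove-no f ¬p) ⟨
    ι (coeff ((c , u) ∷ f) m) * w m + lin w (remove m ((c , u) ∷ f)) ∎

  -- Terms of the list may cancel each other, so all terms with the monomial of the head are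
  -- collected into one coefficient and removed together; the remaining list is shorter.
  lin-vanish : ∀ {k} (w : Mon k → Carrier) → Resp w → ∀ f →
    (∀ m → coeff f m ≡ 0ℤ ⊎ w m ≃ 0#) → lin w f ≃ 0#
  lin-vanish {k} w resp f van = go (length f) f ℕ.≤-refl van
    where
    go : ∀ ℓ (f : Poly k) → length f ℕ.≤ ℓ → (∀ m → coeff f m ≡ 0ℤ ⊎ w m ≃ 0#) → lin w f ≃ 0#
    go ℓ       []            _          van = R.refl
    go (suc ℓ) ((c , m) ∷ f) (s≤s len≤) van = begin
      lin w ((c , m) ∷ f)                                          ≈⟨ lin-remove w resp m ((c , m) ∷ f) ⟩
      ι (coeff ((c , m) ∷ f) m) * w m + lin w (remove m ((c , m) ∷ f)) ≈⟨ R.+-cong head≃0 tail≃0 ⟩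
      0# + 0#                                                      ≈⟨ R.+-identityˡ _ ⟩
      0#                                                           ∎
      where
      head≃0 : ι (coeff ((c , m) ∷ f) m) * w m ≃ 0#
      head≃0 with van m
      ... | inj₁ e = R.trans (R.*-congʳ (R.trans (R.reflexive (cong ι e)) ι-0)) (R.zeroˡ _)
      ... | inj₂ e = R.trans (R.*-congˡ e) (R.zeroʳ _)

      shorter : length (remove m ((c , m) ∷ f)) ℕ.≤ ℓ
      shorter = ℕ.≤-trans (ℕ.≤-reflexive (cong length (remove-yes f ≐-refl))) (ℕ.≤-trans (length-filter (_≉? m) f) len≤)

      van′ : ∀ u → coeff (remove m ((c , m) ∷ f)) u ≡ 0ℤ ⊎ w u ≃ 0#
      van′ u with u ≐? m | van u
      ... | yes p | _       = inj₁ (coeff-remove-≐ ((c , m) ∷ f) p)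
      ... | no ¬p | inj₁ e  = inj₁ (trans (coeff-remove-≭ ((c , m) ∷ f) ¬p) e)
      ... | no ¬p | inj₂ e  = inj₂ e

      tail≃0 : lin w (remove m ((c , m) ∷ f)) ≃ 0#
      tail≃0 = go ℓ (remove m ((c , m) ∷ f)) shorter van′

  -- Equal polynomials can be different lists; their difference has only zero coefficients, which is
  -- the case handled by `lin-vanish`.
  lin-cong : ∀ {k} (w : Mon k → Carrier) → Resp w → ∀ {f g} → f ≈ g → lin w f ≃ lin w g
  lin-cong w resp {f} {g} f≈g = begin
    lin w f                                ≈⟨ R.+-identityʳ _ ⟨
    lin w f + 0#                           ≈⟨ R.+-congˡ (lin-neg w g) ⟨
    lin w f + (lin w g + lin w (negₚ g))   ≈⟨ R.+-congˡ (R.+-comm _ _) ⟩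
    lin w f + (lin w (negₚ g) + lin w g)   ≈⟨ R.+-assoc _ _ _ ⟨
    lin w f + lin w (negₚ g) + lin w g     ≈⟨ R.+-congʳ (lin-++ w f (negₚ g)) ⟨
    lin w (f ++ negₚ g) + lin w g          ≈⟨ R.+-congʳ (lin-vanish w resp (f ++ negₚ g) (λ m → inj₁ (difference m))) ⟩
    0# + lin w g                           ≈⟨ R.+-identityˡ _ ⟩
    lin w g                                ∎
    where
    difference : ∀ m → coeff (f ++ negₚ g) m ≡ 0ℤ
    difference m = trans (coeff-++ f (negₚ g) m)
      (trans (cong₂ ℤ._+_ (f≈g m) (coeff-neg g m)) (ℤ.+-inverseʳ (coeff g m)))

ℤ-isScalar : IsScalar ℤ.+-*-commutativeRing (λ c → c)
ℤ-isScalar = record { ι-+ = λ _ _ → refl ; ι-* = λ _ _ → refl ; ι-0 = refl ; ι-1 = refl }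

module ℤLin = Lin ℤ.+-*-commutativeRing ℤ-isScalar

δ : ∀ {k} → Mon k → Mon k → ℤ
δ m u = if does (u ≐? m) then 1ℤ else 0ℤ

δ-resp : ∀ {k} (m : Mon k) → ℤLin.Resp (δ m)
δ-resp m e = cong (if_then 1ℤ else 0ℤ) (≐?-cong {u = m} {m} e ≐-refl)

coeff≡lin : ∀ {k} (f : Poly k) m → coeff f m ≡ ℤLin.lin (δ m) f
coeff≡lin []            m = refl
coeff≡lin ((c , u) ∷ f) m with does (u ≐? m)
... | true  = cong₂ ℤ._+_ (sym (ℤ.*-identityʳ c)) (coeff≡lin f m)
... | false = trans (coeff≡lin f m) (sym (trans (cong (ℤ._+ _) (ℤ.*-zeroʳ c)) (ℤ.+-identityˡ _)))

-- The ring axioms are checked through arbitrary linear functionals: `lin-*` turns a product into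
-- two nested sums, where commutativity and associativity are interchanges of sums and laws of
-- exponents.
lin-ext : ∀ {k} {f g : Poly k} → (∀ (w : Mon k → ℤ) → ℤLin.Resp w → ℤLin.lin w f ≡ ℤLin.lin w g) → f ≈ g
lin-ext {f = f} {g} eq m = trans (coeff≡lin f m) (trans (eq (δ m) (δ-resp m)) (sym (coeff≡lin g m)))

-- The commutative ring of polynomials over ℤ.

module _ {k : ℕ} where
  open ℤLin
  open ≡.≡-Reasoning

  shift-resp : ∀ {w : Mon k → ℤ} → Resp w → ∀ m → Resp (λ u → w (m ⊕ u))
  shift-resp resp m e = resp (⊕-cong ≐-refl e)

  lin-shift-resp : ∀ {w : Mon k → ℤ} → Resp w → ∀ g → Resp (λ m → lin (λ u → w (m ⊕ u)) g)
  lin-shift-resp resp g e = lin-congʷ g (λ u → resp (⊕-cong e ≐-refl))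

  +ₚ-cong : ∀ {f f′ g g′ : Poly k} → f ≈ f′ → g ≈ g′ → (f +ₚ g) ≈ (f′ +ₚ g′)
  +ₚ-cong {f} {f′} {g} {g′} e e′ m =
    trans (coeff-++ f g m) (trans (cong₂ ℤ._+_ (e m) (e′ m)) (sym (coeff-++ f′ g′ m)))

  +ₚ-comm : ∀ (f g : Poly k) → (f +ₚ g) ≈ (g +ₚ f)
  +ₚ-comm f g m = trans (coeff-++ f g m) (trans (ℤ.+-comm (coeff f m) _) (sym (coeff-++ g f m)))

  +ₚ-assoc : ∀ (f g h : Poly k) → ((f +ₚ g) +ₚ h) ≈ (f +ₚ (g +ₚ h))
  +ₚ-assoc f g h m = cong (λ l → coeff l m) (++-assoc f g h)

  +ₚ-identityʳ : ∀ (f : Poly k) → (f +ₚ 0ₚ) ≈ f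
  +ₚ-identityʳ f m = trans (coeff-++ f [] m) (ℤ.+-identityʳ _)

  negₚ-cong : ∀ {f g : Poly k} → f ≈ g → negₚ f ≈ negₚ g
  negₚ-cong {f} {g} e m = trans (coeff-neg f m) (trans (cong ℤ.-_ (e m)) (sym (coeff-neg g m)))

  negₚ-inverseʳ : ∀ (f : Poly k) → (f +ₚ negₚ f) ≈ 0ₚ
  negₚ-inverseʳ f m = trans (coeff-++ f (negₚ f) m)
    (trans (cong (ℤ._+_ (coeff f m)) (coeff-neg f m)) (ℤ.+-inverseʳ (coeff f m)))

  negₚ-inverseˡ : ∀ (f : Poly k) → (negₚ f +ₚ f) ≈ 0ₚ
  negₚ-inverseˡ f m = trans (+ₚ-comm (negₚ f) f m) (negₚ-inverseʳ f m)

  *ₚ-cong : ∀ {f f′ g g′ : Poly k} → f ≈ f′ → g ≈ g′ → (f *ₚ g) ≈ (f′ *ₚ g′)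
  *ₚ-cong {f} {f′} {g} {g′} e e′ = lin-ext {f = f *ₚ g} {f′ *ₚ g′} λ w resp → begin
    lin w (f *ₚ g)                           ≡⟨ lin-* w f g ⟩
    lin (λ m → lin (λ u → w (m ⊕ u)) g) f    ≡⟨ lin-cong _ (lin-shift-resp resp g) {f} {f′} e ⟩
    lin (λ m → lin (λ u → w (m ⊕ u)) g) f′   ≡⟨ lin-congʷ f′ (λ m → lin-cong _ (shift-resp resp m) {g} {g′} e′) ⟩
    lin (λ m → lin (λ u → w (m ⊕ u)) g′) f′  ≡⟨ lin-* w f′ g′ ⟨
    lin w (f′ *ₚ g′)                         ∎

  *ₚ-comm : ∀ (f g : Poly k) → (f *ₚ g) ≈ (g *ₚ f)
  *ₚ-comm f g = lin-ext {f = f *ₚ g} {g *ₚ f} λ w resp → begin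
    lin w (f *ₚ g)                           ≡⟨ lin-* w f g ⟩
    lin (λ m → lin (λ u → w (m ⊕ u)) g) f    ≡⟨ lin-swap (λ m u → w (m ⊕ u)) f g ⟩
    lin (λ u → lin (λ m → w (m ⊕ u)) f) g    ≡⟨ lin-congʷ g (λ u → lin-congʷ f (λ m → resp (⊕-comm m u))) ⟩
    lin (λ u → lin (λ m → w (u ⊕ m)) f) g    ≡⟨ lin-* w g f ⟨
    lin w (g *ₚ f)                           ∎

  *ₚ-assoc : ∀ (f g h : Poly k) → ((f *ₚ g) *ₚ h) ≈ (f *ₚ (g *ₚ h))
  *ₚ-assoc f g h = lin-ext {f = (f *ₚ g) *ₚ h} {f *ₚ (g *ₚ h)} λ w resp → begin
    lin w ((f *ₚ g) *ₚ h)                                              ≡⟨ lin-* w (f *ₚ g) h ⟩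
    lin (λ m → lin (λ v → w (m ⊕ v)) h) (f *ₚ g)                       ≡⟨ lin-* _ f g ⟩
    lin (λ m → lin (λ u → lin (λ v → w ((m ⊕ u) ⊕ v)) h) g) f          ≡⟨ lin-congʷ f (λ m → lin-congʷ g (λ u → lin-congʷ h (λ v →
                                                                            resp (λ i → ℕ.+-assoc (m i) (u i) (v i))))) ⟩
    lin (λ m → lin (λ u → lin (λ v → w (m ⊕ (u ⊕ v))) h) g) f          ≡⟨ lin-congʷ f (λ m → lin-* (λ u → w (m ⊕ u)) g h) ⟨
    lin (λ m → lin (λ u → w (m ⊕ u)) (g *ₚ h)) f                       ≡⟨ lin-* w f (g *ₚ h) ⟨
    lin w (f *ₚ (g *ₚ h))                                              ∎

  *ₚ-identityˡ : ∀ (f : Poly k) → (1ₚ *ₚ f) ≈ f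
  *ₚ-identityˡ f = lin-ext {f = 1ₚ *ₚ f} {f} λ w resp → begin
    lin w (1ₚ *ₚ f)                             ≡⟨ lin-* w 1ₚ f ⟩
    1ℤ ℤ.* lin (λ u → w (oneMon ⊕ u)) f ℤ.+ 0ℤ  ≡⟨ ℤ.+-identityʳ _ ⟩
    1ℤ ℤ.* lin (λ u → w (oneMon ⊕ u)) f         ≡⟨ ℤ.*-identityˡ _ ⟩
    lin (λ u → w (oneMon ⊕ u)) f                ≡⟨ lin-congʷ f (λ u → resp ≐-refl) ⟩
    lin w f                                     ∎

  *ₚ-distribʳ : ∀ (f g h : Poly k) → ((g +ₚ h) *ₚ f) ≈ ((g *ₚ f) +ₚ (h *ₚ f))
  *ₚ-distribʳ f g h = lin-ext {f = (g +ₚ h) *ₚ f} {(g *ₚ f) +ₚ (h *ₚ f)} λ w resp → begin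
    lin w ((g +ₚ h) *ₚ f)                  ≡⟨ lin-* w (g +ₚ h) f ⟩
    lin _ (g +ₚ h)                         ≡⟨ lin-++ _ g h ⟩
    lin _ g ℤ.+ lin _ h                    ≡⟨ cong₂ ℤ._+_ (lin-* w g f) (lin-* w h f) ⟨
    lin w (g *ₚ f) ℤ.+ lin w (h *ₚ f)      ≡⟨ lin-++ w (g *ₚ f) (h *ₚ f) ⟨
    lin w ((g *ₚ f) +ₚ (h *ₚ f))           ∎

-- Wrapping _≈_ in a record keeps the polynomials on both sides inferable.
infix 4 _≋_
record _≋_ {k} (f g : Poly k) : Set where
  constructor mk≋
  field un≋ : f ≈ g
open _≋_ public

polyRing : ℕ → CommutativeRing 0ℓ 0ℓ
polyRing k = record
  { Carrier = Poly k ; _≈_ = _≋_ ; _+_ = _+ₚ_ ; _*_ = _*ₚ_ ; -_ = negₚ ; 0# = 0ₚ ; 1# = 1ₚ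
  ; isCommutativeRing = record
    { isRing = record
      { +-isAbelianGroup = record
        { isGroup = record
          { isMonoid = record
            { isSemigroup = record
              { isMagma = record
                { isEquivalence = record
                  { refl  = mk≋ λ _ → refl
                  ; sym   = λ (mk≋ e) → mk≋ λ m → sym (e m)
                  ; trans = λ (mk≋ e) (mk≋ e′) → mk≋ λ m → trans (e m) (e′ m) }
                ; ∙-cong = λ {f} {f′} {g} {g′} (mk≋ e) (mk≋ e′) → mk≋ (+ₚ-cong {k} {f} {f′} {g} {g′} e e′) }
              ; assoc = λ f g h → mk≋ (+ₚ-assoc f g h) }
            ; identity = (λ _ → mk≋ λ _ → refl) , λ f → mk≋ (+ₚ-identityʳ f) }
          ; inverse = (λ f → mk≋ (negₚ-inverseˡ f)) , λ f → mk≋ (negₚ-inverseʳ f)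
          ; ⁻¹-cong = λ {f} {g} (mk≋ e) → mk≋ (negₚ-cong {k} {f} {g} e) }
        ; comm = λ f g → mk≋ (+ₚ-comm f g) }
      ; *-cong = λ {f} {f′} {g} {g′} (mk≋ e) (mk≋ e′) → mk≋ (*ₚ-cong {k} {f} {f′} {g} {g′} e e′)
      ; *-assoc = λ f g h → mk≋ (*ₚ-assoc f g h)
      ; *-identity = (λ f → mk≋ (*ₚ-identityˡ f)) , λ f → mk≋ λ m → trans (*ₚ-comm f 1ₚ m) (*ₚ-identityˡ f m)
      ; distrib = (λ f g h → mk≋ λ m → trans (*ₚ-comm f (g +ₚ h) m) (trans (*ₚ-distribʳ f g h m)
          (+ₚ-cong {k} {g *ₚ f} {f *ₚ g} {h *ₚ f} {f *ₚ h} (*ₚ-comm g f) (*ₚ-comm h f) m)))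
          , λ f g h → mk≋ (*ₚ-distribʳ f g h) }
    ; *-comm = λ f g → mk≋ (*ₚ-comm f g) } }

constₚ-isScalar : ∀ k → IsScalar (polyRing k) constₚ
constₚ-isScalar k = record
  { ι-+ = λ a b → mk≋ (ι-+ a b)
  ; ι-* = λ a b → mk≋ λ m → ≡.refl
  ; ι-0 = mk≋ ι-0
  ; ι-1 = mk≋ λ m → refl }
  where
  ι-+ : ∀ a b (m : Mon k) → coeff (constₚ (a ℤ.+ b)) m ≡ coeff (constₚ a +ₚ constₚ b) m
  ι-+ a b m with does (oneMon ≐? m)
  ... | true  = ℤ.+-assoc a b 0ℤ
  ... | false = refl
  ι-0 : ∀ (m : Mon k) → coeff (constₚ 0ℤ) m ≡ 0ℤ
  ι-0 m with does (oneMon ≐? m)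
  ... | true  = refl
  ... | false = refl

-- Ideals and quotient rings.

record IsIdeal (R : CommutativeRing 0ℓ 0ℓ) (I : CommutativeRing.Carrier R → Set) : Set where
  open CommutativeRing R using (_+_; _*_; 0#) renaming (_≈_ to _≃_)
  field
    I-0    : I 0#
    I-+    : ∀ {a b} → I a → I b → I (a + b)
    I-*    : ∀ r {a} → I a → I (r * a)
    I-resp : ∀ {a b} → a ≃ b → I a → I b

module Quotient (R : CommutativeRing 0ℓ 0ℓ) (I : CommutativeRing.Carrier R → Set) (isIdeal : IsIdeal R I) where
  open CommutativeRing R using (_+_; _*_; -_; _-_; 0#) renaming (_≈_ to _≃_)
  open IsIdeal isIdeal
  private
    module R = CommutativeRing R
  open import Algebra.Properties.Ring R.ring using (-‿+-comm; -‿involutive; -0#≈0#; x[y-z]≈xy-xz; -1*x≈-x)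
  open Sums R.commutativeSemiring using (+-interchange)
  open SetoidReasoning R.setoid

  infix 4 _~_
  record _~_ (a b : R.Carrier) : Set where
    constructor mk~
    field un~ : I (a - b)
  open _~_ public

  ≈⇒~ : ∀ {a b} → a ≃ b → a ~ b
  ≈⇒~ {a} {b} a≈b = mk~ (I-resp (R.sym (R.trans (R.+-congʳ a≈b) (R.-‿inverseʳ b))) I-0)

  private
    neg-sub : ∀ a b → - (a - b) ≃ b - a
    neg-sub a b = R.trans (R.sym (-‿+-comm a (- b))) (R.trans (R.+-congˡ (-‿involutive b)) (R.+-comm (- a) b))

    sub-sub : ∀ a b c → (a - b) + (b - c) ≃ a - c
    sub-sub a b c = begin
      (a - b) + (b - c)    ≈⟨ R.+-assoc _ _ _ ⟩
      a + (- b + (b - c))  ≈⟨ R.+-congˡ (R.+-assoc _ _ _) ⟨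
      a + (- b + b - c)    ≈⟨ R.+-congˡ (R.+-congʳ (R.-‿inverseˡ b)) ⟩
      a + (0# - c)         ≈⟨ R.+-congˡ (R.+-identityˡ _) ⟩
      a - c                ∎

    sub-+ : ∀ a b c d → (a - b) + (c - d) ≃ (a + c) - (b + d)
    sub-+ a b c d = R.trans (+-interchange a (- b) c (- d)) (R.+-congˡ (-‿+-comm b d))

    sub-* : ∀ a b c d → c * (a - b) + b * (c - d) ≃ (a * c) - (b * d)
    sub-* a b c d = begin
      c * (a - b) + b * (c - d)            ≈⟨ R.+-cong (x[y-z]≈xy-xz c a b) (x[y-z]≈xy-xz b c d) ⟩
      (c * a - c * b) + (b * c - b * d)    ≈⟨ R.+-congʳ (R.+-cong (R.*-comm c a) (R.-‿cong (R.*-comm c b))) ⟩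
      (a * c - b * c) + (b * c - b * d)    ≈⟨ sub-sub _ _ _ ⟩
      a * c - b * d                        ∎

    sub-neg : ∀ a b → - (a - b) ≃ (- a) - (- b)
    sub-neg a b = R.sym (-‿+-comm a (- b))

    sub-0 : ∀ a → a - 0# ≃ a
    sub-0 a = R.trans (R.+-congˡ -0#≈0#) (R.+-identityʳ a)

    I-neg : ∀ {a} → I a → I (- a)
    I-neg p = I-resp (-1*x≈-x _) (I-* (- R.1#) p)

  quotient : CommutativeRing 0ℓ 0ℓ
  quotient = record
    { Carrier = R.Carrier ; _≈_ = _~_ ; _+_ = _+_ ; _*_ = _*_ ; -_ = -_ ; 0# = 0# ; 1# = R.1#
    ; isCommutativeRing = record
      { isRing = record
        { +-isAbelianGroup = record
          { isGroup = record
            { isMonoid = record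
              { isSemigroup = record
                { isMagma = record
                  { isEquivalence = record
                    { refl  = ≈⇒~ R.refl
                    ; sym   = λ (mk~ p) → mk~ (I-resp (neg-sub _ _) (I-neg p))
                    ; trans = λ (mk~ p) (mk~ q) → mk~ (I-resp (sub-sub _ _ _) (I-+ p q)) }
                  ; ∙-cong = λ (mk~ p) (mk~ q) → mk~ (I-resp (sub-+ _ _ _ _) (I-+ p q)) }
                ; assoc = λ a b c → ≈⇒~ (R.+-assoc a b c) }
              ; identity = (λ a → ≈⇒~ (R.+-identityˡ a)) , (λ a → ≈⇒~ (R.+-identityʳ a)) }
            ; inverse = (λ a → ≈⇒~ (R.-‿inverseˡ a)) , (λ a → ≈⇒~ (R.-‿inverseʳ a))
            ; ⁻¹-cong = λ (mk~ p) → mk~ (I-resp (sub-neg _ _) (I-neg p)) }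
          ; comm = λ a b → ≈⇒~ (R.+-comm a b) }
        ; *-cong = λ (mk~ p) (mk~ q) → mk~ (I-resp (sub-* _ _ _ _) (I-+ (I-* _ p) (I-* _ q)))
        ; *-assoc = λ a b c → ≈⇒~ (R.*-assoc a b c)
        ; *-identity = (λ a → ≈⇒~ (R.*-identityˡ a)) , (λ a → ≈⇒~ (R.*-identityʳ a))
        ; distrib = (λ a b c → ≈⇒~ (R.distribˡ a b c)) , (λ a b c → ≈⇒~ (R.distribʳ a b c)) }
      ; *-comm = λ a b → ≈⇒~ (R.*-comm a b) } }

  ~0⇒∈ : ∀ {a} → a ~ 0# → I a
  ~0⇒∈ (mk~ p) = I-resp (sub-0 _) p

  -- The shape of a division step: a is the leading term of a multiple a + b of a generator, and c
  -- is a normal form of the rest b.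
  ~-neg : ∀ {a b c} → I (a + b) → b ~ c → a ~ - c
  ~-neg {a} {b} {c} a+b∈I (mk~ b-c∈I) = mk~ (I-resp (begin
    (a + b) + - (b - c)   ≈⟨ R.+-congˡ (neg-sub b c) ⟩
    (a + b) + (c - b)     ≈⟨ R.+-congˡ (R.+-comm c (- b)) ⟩
    (a + b) + (- b + c)   ≈⟨ R.+-assoc _ _ _ ⟩
    a + (b + (- b + c))   ≈⟨ R.+-congˡ (R.+-assoc _ _ _) ⟨
    a + ((b - b) + c)     ≈⟨ R.+-congˡ (R.+-congʳ (R.-‿inverseʳ b)) ⟩
    a + (0# + c)          ≈⟨ R.+-congˡ (R.+-identityˡ c) ⟩
    a + c                 ≈⟨ R.+-congˡ (-‿involutive c) ⟨
    a - (- c)             ∎) (I-+ a+b∈I (I-neg b-c∈I)))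

  ∈⇒~0 : ∀ {a} → I a → a ~ 0#
  ∈⇒~0 p = mk~ (I-resp (R.sym (sub-0 _)) p)

module _ {k} (P : Poly k → Set) where
  private
    module R = CommutativeRing (polyRing k)
    comb : List (Poly k × Poly k) → Poly k
    comb hs = Σₚ (map (λ hg → proj₁ hg *ₚ proj₂ hg) hs)

  ∈-0 : 0ₚ ∈⟨ P ⟩
  ∈-0 = [] , [] , λ _ → refl

  ∈-resp : ∀ {f g} → f ≋ g → f ∈⟨ P ⟩ → g ∈⟨ P ⟩
  ∈-resp {f} f≋g (hs , all , e) = hs , all , un≋ (R.trans (R.sym f≋g) (mk≋ {f = f} {comb hs} e))

  ∈-+ : ∀ {f g} → f ∈⟨ P ⟩ → g ∈⟨ P ⟩ → (f +ₚ g) ∈⟨ P ⟩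
  ∈-+ {f} {g} (hs , all , e) (hs′ , all′ , e′) =
    hs ++ hs′ , All.++⁺ all all′ , un≋ (R.trans (R.+-cong (mk≋ {f = f} {comb hs} e) (mk≋ {f = g} {comb hs′} e′)) (R.sym (comb-++ hs)))
    where
    comb-++ : ∀ hs → comb (hs ++ hs′) ≋ comb hs +ₚ comb hs′
    comb-++ []             = R.refl
    comb-++ ((h , g) ∷ hs) = R.trans (R.+-congˡ {h *ₚ g} (comb-++ hs)) (R.sym (R.+-assoc (h *ₚ g) (comb hs) (comb hs′)))

  ∈-* : ∀ r {f} → f ∈⟨ P ⟩ → (r *ₚ f) ∈⟨ P ⟩
  ∈-* r {f} (hs , all , e) = map (λ hg → r *ₚ proj₁ hg , proj₂ hg) hs , All.map⁺ all ,
    un≋ (R.trans (R.*-congˡ {r} (mk≋ {f = f} {comb hs} e)) (comb-* hs))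
    where
    comb-* : ∀ hs → r *ₚ comb hs ≋ comb (map (λ hg → r *ₚ proj₁ hg , proj₂ hg) hs)
    comb-* []             = R.zeroʳ r
    comb-* ((h , g) ∷ hs) = R.trans (R.distribˡ r (h *ₚ g) (comb hs))
      (R.+-cong (R.sym (R.*-assoc r h g)) (comb-* hs))

  ∈-gen : ∀ {g} → P g → g ∈⟨ P ⟩
  ∈-gen {g} p = (1ₚ , g) ∷ [] , p ∷ [] , un≋ (R.sym (R.trans (R.+-identityʳ (1ₚ *ₚ g)) (R.*-identityˡ g)))

  ∈-ind : (Q : Poly k → Set) → Q 0ₚ → (∀ {f g} → Q f → Q g → Q (f +ₚ g)) → (∀ {f g} → f ≋ g → Q f → Q g) →
          (∀ h {g} → P g → Q (h *ₚ g)) → ∀ {f} → f ∈⟨ P ⟩ → Q f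
  ∈-ind Q Q-0 Q-+ Q-resp Q-* {f} (hs , all , e) = Q-resp (R.sym (mk≋ {f = f} {comb hs} e)) (go hs all)
    where
    go : ∀ hs → All (λ hg → P (proj₂ hg)) hs → Q (comb hs)
    go []             []        = Q-0
    go ((h , g) ∷ hs) (p ∷ all) = Q-+ (Q-* h p) (go hs all)

  isIdeal : IsIdeal (polyRing k) (_∈⟨ P ⟩)
  isIdeal = record
    { I-0 = ∈-0 ; I-+ = λ {f} {g} → ∈-+ {f} {g} ; I-* = λ r {f} → ∈-* r {f} ; I-resp = λ {f} {g} → ∈-resp {f} {g} }

  module Mod = Quotient (polyRing k) (_∈⟨ P ⟩) isIdeal

  quotientRing : CommutativeRing 0ℓ 0ℓ
  quotientRing = Mod.quotient

  gen~0 : ∀ {g} → P g → g Mod.~ 0ₚ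
  gen~0 p = Mod.∈⇒~0 (∈-gen p)

  quotient-isScalar : IsScalar quotientRing constₚ
  quotient-isScalar = record
    { ι-+ = λ a b → Mod.≈⇒~ (S.ι-+ a b)
    ; ι-* = λ a b → Mod.≈⇒~ (S.ι-* a b)
    ; ι-0 = Mod.≈⇒~ S.ι-0
    ; ι-1 = Mod.≈⇒~ S.ι-1 }
    where module S = IsScalar (constₚ-isScalar k)

-- Evaluation of polynomials in a ring.

module Eval (R : CommutativeRing 0ℓ 0ℓ) {ι : ℤ → CommutativeRing.Carrier R} (isScalar : IsScalar R ι)
  {k} (s : Fin k → CommutativeRing.Carrier R) where
  open Sums (CommutativeRing.commutativeSemiring R)
  open Lin R isScalar
  private module R = CommutativeRing R
  open SetoidReasoning R.setoid

  monomial : Mon k → Carrier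
  monomial m = ∏ (List.allFin k) (λ i → pow (s i) (m i))

  eval : Poly k → Carrier
  eval = lin monomial

  monomial-resp : Resp monomial
  monomial-resp e = ∏-cong (List.allFin k) (λ i → R.reflexive (cong (pow (s i)) (e i)))

  monomial-⊕ : ∀ m u → monomial (m ⊕ u) ≃ monomial m * monomial u
  monomial-⊕ m u = R.trans (∏-cong (List.allFin k) (λ i → pow-+ (s i) (m i) (u i))) (∏-* (List.allFin k) _ _)

  ∏-tabulate-one : ∀ {l} (h : Fin l → Fin k) {f : Fin k → Carrier} → (∀ j → f (h j) ≃ 1#) → ∏ (List.tabulate h) f ≃ 1#
  ∏-tabulate-one {zero}  h e = R.refl
  ∏-tabulate-one {suc l} h e =
    R.trans (R.*-cong (e Fin.zero) (∏-tabulate-one (h ∘ Fin.suc) (e ∘ Fin.suc))) (R.*-identityˡ _)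

  monomial-one : monomial oneMon ≃ 1#
  monomial-one = ∏-tabulate-one (λ j → j) (λ _ → R.refl)

  ∏-tabulate-unit : ∀ {l} (h : Fin l → Fin k) {f : Fin k → Carrier} i →
    (∀ j → f (h j) ≃ pow (s (h j)) (unitMon i j)) → ∏ (List.tabulate h) f ≃ s (h i)
  ∏-tabulate-unit h Fin.zero    e = R.trans (R.*-cong (R.trans (e Fin.zero) (R.*-identityʳ _))
    (∏-tabulate-one (h ∘ Fin.suc) (e ∘ Fin.suc))) (R.*-identityʳ _)
  ∏-tabulate-unit h (Fin.suc i) e =
    R.trans (R.*-cong (e Fin.zero) (∏-tabulate-unit (h ∘ Fin.suc) i (e ∘ Fin.suc))) (R.*-identityˡ _)

  monomial-unit : ∀ i → monomial (unitMon i) ≃ s i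
  monomial-unit i = ∏-tabulate-unit (λ j → j) i (λ _ → R.refl)

  eval-cong : ∀ {f g} → f ≋ g → eval f ≃ eval g
  eval-cong {f} {g} (mk≋ e) = lin-cong monomial monomial-resp {f} {g} e

  eval-+ : ∀ f g → eval (f +ₚ g) ≃ eval f + eval g
  eval-+ = lin-++ monomial

  eval-* : ∀ f g → eval (f *ₚ g) ≃ eval f * eval g
  eval-* f g = begin
    eval (f *ₚ g)                                       ≈⟨ lin-* monomial f g ⟩
    lin (λ m → lin (λ u → monomial (m ⊕ u)) g) f        ≈⟨ lin-congʷ f (λ m → R.trans (lin-congʷ g (monomial-⊕ m)) (R.sym (lin-linear monomial (monomial m) g))) ⟩
    lin (λ m → monomial m * eval g) f                   ≈⟨ lin-congʷ f (λ m → R.*-comm _ _) ⟩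
    lin (λ m → eval g * monomial m) f                   ≈⟨ lin-linear monomial (eval g) f ⟨
    eval g * eval f                                     ≈⟨ R.*-comm _ _ ⟩
    eval f * eval g                                     ∎

  eval-const : ∀ c → eval (constₚ c) ≃ ι c
  eval-const c = R.trans (lin-const monomial c) (R.trans (R.*-congˡ monomial-one) (R.*-identityʳ _))

  eval-1 : eval 1ₚ ≃ 1#
  eval-1 = R.trans (eval-const 1ℤ) ι-1

  eval-var : ∀ i → eval (var i) ≃ s i
  eval-var i = R.trans (R.+-identityʳ _) (R.trans (R.*-cong ι-1 (monomial-unit i)) (R.*-identityˡ _))

  eval-^ : ∀ f e → eval (f ^ₚ e) ≃ pow (eval f) e
  eval-^ f zero    = eval-1
  eval-^ f (suc e) = R.trans (eval-* f (f ^ₚ e)) (R.*-congˡ (eval-^ f e))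

  eval-Σ : ∀ {I : Set} (l : List I) F → eval (Σₚ (map F l)) ≃ ∑ l (λ i → eval (F i))
  eval-Σ = lin-Σ monomial

module _ {k l} (P : Poly l → Set) (s : Fin k → Poly l) where
  open Eval (quotientRing P) (quotient-isScalar P) s
  open Sums (CommutativeRing.commutativeSemiring (quotientRing P))
  private module A = CommutativeRing (quotientRing P)
  open SetoidReasoning A.setoid

  -- Membership of `subst s f` in an ideal becomes the vanishing of an evaluation in the quotient
  -- ring, where the homomorphism laws are available.
  subst≃eval : ∀ f → subst s f ≃ eval f
  subst≃eval f = begin
    subst s f                                   ≡⟨ foldr-map≡∑ _ f ⟩
    ∑ f (λ t → constₚ (proj₁ t) *ₚ Πₚ (map (λ i → s i ^ₚ proj₂ t i) (List.allFin k)))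
                                                ≈⟨ ∑-cong f (λ (c , m) → A.*-congˡ {constₚ c} (A.trans
                                                     (A.reflexive (foldr-map≡∏ (λ i → s i ^ₚ m i) (List.allFin k)))
                                                     (∏-cong (List.allFin k) (λ i → A.reflexive (pow-unique (s i ^ₚ_) refl (λ _ → refl) (m i)))))) ⟩
    eval f                                      ∎

-- Counting subsets, and two binomial sums.

⊈⇒∃ : ∀ {n} {S T : Subset n} → ¬ (S ⊆ T) → ∃ λ e → e ∈ S × e ∉ T
⊈⇒∃ {n} {S} {T} S⊈T with Fin.¬∀⟶∃¬ n (λ e → e ∈ S → e ∈ T) (λ e → (e ∈? S) →-dec (e ∈? T)) (λ h → S⊈T (λ {e} → h e))
... | e , ¬h with e ∈? S
...   | yes e∈S = e , e∈S , λ e∈T → ¬h (λ _ → e∈T)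
...   | no  e∉S = contradiction (λ e∈S → contradiction e∈S e∉S) ¬h

⊆∧⊉⇒∣∣< : ∀ {n} {S T : Subset n} → S ⊆ T → ¬ (T ⊆ S) → ∣ S ∣ ℕ.< ∣ T ∣
⊆∧⊉⇒∣∣< S⊆T T⊈S = p⊂q⇒∣p∣<∣q∣ (S⊆T , ⊈⇒∃ T⊈S)

⊆∧∣∣≥⇒⊇ : ∀ {n} {S T : Subset n} → S ⊆ T → ∣ T ∣ ℕ.≤ ∣ S ∣ → T ⊆ S
⊆∧∣∣≥⇒⊇ {S = S} {T} S⊆T T≤S with T ⊆? S
... | yes T⊆S = T⊆S
... | no  T⊈S = contradiction T≤S (ℕ.<⇒≱ (⊆∧⊉⇒∣∣< S⊆T T⊈S))

_≟ˢ_ : ∀ {n} (S T : Subset n) → Dec (S ≡ T)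
_≟ˢ_ = ≡-dec Bool._≟_

module SubsetSums (R : CommutativeSemiring 0ℓ 0ℓ) where
  open Sums R
  private module R = CommutativeSemiring R
  open import Algebra.Properties.Semiring.Mult R.semiring using (×-homo-+; ×-congˡ)
  open SetoidReasoning R.setoid

  ∑-subsets-suc : ∀ n F → ∑ (subsets (suc n)) F ≃ ∑ (subsets n) (λ S → F (inside ∷ S)) + ∑ (subsets n) (λ S → F (outside ∷ S))
  ∑-subsets-suc n F = R.trans (∑-++ (map (inside ∷_) (subsets n)) _ F)
    (R.reflexive (cong₂ _+_ (∑-map (inside ∷_) (subsets n) F) (∑-map (outside ∷_) (subsets n) F)))

  ∑-pick : ∀ {n} (S : Subset n) (f : Subset n → Carrier) → ∑ (subsets n) (λ T → when (does (T ≟ˢ S)) (f T)) ≃ f S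
  ∑-pick {zero}  []            f = R.+-identityʳ _
  ∑-pick {suc n} (inside ∷ S)  f = R.trans (∑-subsets-suc n _)
    (R.trans (R.+-cong (∑-pick S (λ T → f (inside ∷ T))) (∑-zero (subsets n) (λ _ → R.refl))) (R.+-identityʳ _))
  ∑-pick {suc n} (outside ∷ S) f = R.trans (∑-subsets-suc n _)
    (R.trans (R.+-cong (∑-zero (subsets n) (λ _ → R.refl)) (∑-pick S (λ T → f (outside ∷ T)))) (R.+-identityˡ _))

  between : ∀ {n} → Subset n → Subset n → ℕ → Carrier → Carrier
  between {n} S U s r = ∑ (subsets n) λ T → when (does (S ⊆? T)) (when (does (T ⊆? U)) (when (does (∣ T ∣ ℕ.≟ s)) r))

  between-⊈ : ∀ {n} {S U : Subset n} {s r} → ¬ (S ⊆ U) → between S U s r ≃ 0#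
  between-⊈ {n} {S} {U} S⊈U = ∑-zero (subsets n) λ T →
    when-zero? (S ⊆? T) λ S⊆T → when-zero? (T ⊆? U) λ T⊆U → contradiction (λ {e} → ⊆-trans S⊆T T⊆U {e}) S⊈U

  -- Induction over the elements of [n]: an element of U outside S may or may not belong to the
  -- counted set, and these two cases are the summands of Pascal's rule. All other elements leave no
  -- choice.
  between-card : ∀ {n} (S U : Subset n) g c r → S ⊆ U → ∣ U ∣ ≡ ∣ S ∣ ℕ.+ g →
    between S U (∣ S ∣ ℕ.+ c) r ≃ binom g c · r
  between-card {zero} [] [] zero zero    r _ _ = R.refl
  between-card {zero} [] [] zero (suc c) r _ _ = R.+-identityʳ _
  between-card {suc n} (inside ∷ S) (outside ∷ U) g c r S⊆U _ with S⊆U here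
  ... | ()
  between-card {suc n} (inside ∷ S) (inside ∷ U) g c r S⊆U eq = begin
    between (inside ∷ S) (inside ∷ U) _ r             ≈⟨ ∑-subsets-suc n _ ⟩
    between S U _ r + ∑ (subsets n) (λ _ → 0#)        ≈⟨ R.+-cong (between-card S U g c r (drop-∷-⊆ S⊆U) (ℕ.suc-injective eq))
                                                           (∑-zero (subsets n) (λ _ → R.refl)) ⟩
    binom g c · r + 0#                                ≈⟨ R.+-identityʳ _ ⟩
    binom g c · r                                     ∎
  between-card {suc n} (outside ∷ S) (outside ∷ U) g c r S⊆U eq = begin
    between (outside ∷ S) (outside ∷ U) _ r           ≈⟨ ∑-subsets-suc n _ ⟩
    _ + between S U _ r                               ≈⟨ R.+-cong (∑-zero (subsets n) (λ T → when-zero (does (S ⊆? T)) R.refl))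
                                                           (between-card S U g c r (drop-∷-⊆ S⊆U) eq) ⟩
    0# + binom g c · r                                ≈⟨ R.+-identityˡ _ ⟩
    binom g c · r                                     ∎
  between-card {suc n} (outside ∷ S) (inside ∷ U) zero c r S⊆U eq =
    contradiction (p⊆q⇒∣p∣≤∣q∣ (drop-∷-⊆ S⊆U)) (ℕ.<⇒≱ (ℕ.≤-reflexive (trans eq (ℕ.+-identityʳ _))))
  between-card {suc n} (outside ∷ S) (inside ∷ U) (suc g) c r S⊆U eq = begin
    between (outside ∷ S) (inside ∷ U) _ r            ≈⟨ ∑-subsets-suc n _ ⟩
    with-e c + between S U _ r                        ≈⟨ R.+-congˡ (between-card S U g c r S⊆U′ eq′) ⟩
    with-e c + binom g c · r                          ≈⟨ pascal c ⟩
    binom (suc g) c · r                               ∎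
    where
    S⊆U′ = drop-∷-⊆ S⊆U
    eq′ = ℕ.suc-injective (trans eq (ℕ.+-suc _ g))
    with-e : ℕ → Carrier
    with-e c = ∑ (subsets n) (λ T → when (does (S ⊆? T)) (when (does (T ⊆? U)) (when (does (suc ∣ T ∣ ℕ.≟ ∣ S ∣ ℕ.+ c)) r)))
    too-big : ∀ T → when (does (S ⊆? T)) (when (does (T ⊆? U)) (when (does (suc ∣ T ∣ ℕ.≟ ∣ S ∣ ℕ.+ 0)) r)) ≃ 0#
    too-big T = when-zero? (S ⊆? T) λ S⊆T → when-zero? (T ⊆? U) λ _ → when-zero? (suc ∣ T ∣ ℕ.≟ _) λ e →
      contradiction (p⊆q⇒∣p∣≤∣q∣ S⊆T) (ℕ.<⇒≱ (ℕ.≤-reflexive (trans e (ℕ.+-identityʳ _))))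
    pascal : ∀ c → with-e c + binom g c · r ≃ binom (suc g) c · r
    pascal zero    = R.trans (R.+-congʳ (∑-zero (subsets n) too-big)) (R.+-identityˡ _)
    pascal (suc c) = begin
      with-e (suc c) + binom g (suc c) · r      ≡⟨ cong (λ s → ∑ (subsets n) (λ T → when (does (S ⊆? T)) (when (does (T ⊆? U))
                                                      (when (does (suc ∣ T ∣ ℕ.≟ s)) r))) + binom g (suc c) · r) (ℕ.+-suc ∣ S ∣ c) ⟩
      between S U (∣ S ∣ ℕ.+ c) r + binom g (suc c) · r ≈⟨ R.+-congʳ (between-card S U g c r S⊆U′ eq′) ⟩
      binom g c · r + binom g (suc c) · r       ≈⟨ ×-homo-+ r (binom g c) _ ⟨
      binom (suc g) (suc c) · r                 ∎

  ∑-range-≟ : ∀ u i m {r} → u ℕ.< i ℕ.+ m → ∑ (upTo m) (λ j → when (does (u ℕ.≟ i ℕ.+ j)) r) ≃ when (does (i ℕ.≤? u)) r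
  ∑-range-≟ u i m {r} u< with i ℕ.≤? u
  ... | no i≰u = R.trans (∑-zero (upTo m) (λ j → R.reflexive (when-no (u ℕ.≟ i ℕ.+ j)
      (λ e → i≰u (ℕ.≤-trans (ℕ.m≤m+n i j) (ℕ.≤-reflexive (sym e)))))))
    (R.reflexive (sym (when-no (i ℕ.≤? u) i≰u)))
  ... | yes i≤u = R.trans (hit m u<) (R.reflexive (sym (when-yes (i ℕ.≤? u) i≤u)))
    where
    F : ℕ → Carrier
    F j = when (does (u ℕ.≟ i ℕ.+ j)) r
    miss : ∀ m → i ℕ.+ m ℕ.≤ u → ∑ (upTo m) F ≃ 0#
    miss zero    _   = R.refl
    miss (suc m) le  = begin
      ∑ (upTo (suc m)) F      ≈⟨ ∑-upTo-suc m F ⟩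
      ∑ (upTo m) F + F m      ≈⟨ R.+-cong (miss m (ℕ.<⇒≤ lt)) (R.reflexive (when-no (u ℕ.≟ i ℕ.+ m) (ℕ.>⇒≢ lt))) ⟩
      0# + 0#                 ≈⟨ R.+-identityˡ _ ⟩
      0#                      ∎
      where lt = ℕ.≤-trans (ℕ.≤-reflexive (sym (ℕ.+-suc i m))) le
    hit : ∀ m → u ℕ.< i ℕ.+ m → ∑ (upTo m) F ≃ r
    hit zero    u<i = contradiction i≤u (ℕ.<⇒≱ (ℕ.≤-trans u<i (ℕ.≤-reflexive (ℕ.+-identityʳ i))))
    hit (suc m) u<  with u ℕ.≟ i ℕ.+ m
    ... | yes u≡ = begin
      ∑ (upTo (suc m)) F      ≈⟨ ∑-upTo-suc m F ⟩
      ∑ (upTo m) F + F m      ≈⟨ R.+-cong (miss m (ℕ.≤-reflexive (sym u≡))) (R.reflexive (when-yes (u ℕ.≟ i ℕ.+ m) u≡)) ⟩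
      0# + r                  ≈⟨ R.+-identityˡ _ ⟩
      r                       ∎
    ... | no u≢ = begin
      ∑ (upTo (suc m)) F      ≈⟨ ∑-upTo-suc m F ⟩
      ∑ (upTo m) F + F m      ≈⟨ R.+-cong (hit m (ℕ.≤∧≢⇒< (ℕ.≤-pred (ℕ.≤-trans u< (ℕ.≤-reflexive (ℕ.+-suc i m)))) u≢))
                                   (R.reflexive (when-no (u ℕ.≟ i ℕ.+ m) u≢)) ⟩
      r + 0#                  ≈⟨ R.+-identityʳ _ ⟩
      r                       ∎

  -- The hockey-stick identity. The partial sums are `binom (min w (k+m)) (k+1)`: every further j
  -- below w adds one Pascal step, and from w on the condition cuts the sum off.
  hockey-stick : ∀ w k m r → w ℕ.≤ k ℕ.+ m →
    ∑ (upTo m) (λ j → when (does (suc (k ℕ.+ j) ℕ.≤? w)) (binom (k ℕ.+ j) k · r)) ≃ binom w (suc k) · r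
  hockey-stick w k m r w≤ = R.trans (partial m) (×-congˡ {r} (cong (λ v → binom v (suc k)) (ℕ.m≤n⇒m⊓n≡m w≤)))
    where
    F : ℕ → Carrier
    F j = when (does (suc (k ℕ.+ j) ℕ.≤? w)) (binom (k ℕ.+ j) k · r)
    partial : ∀ m → ∑ (upTo m) F ≃ binom (w ℕ.⊓ (k ℕ.+ m)) (suc k) · r
    partial zero    = R.sym (×-congˡ {r} (binom-> (s≤s (ℕ.≤-trans (ℕ.m⊓n≤n w _) (ℕ.≤-reflexive (ℕ.+-identityʳ k))))))
    partial (suc m) with suc (k ℕ.+ m) ℕ.≤? w
    ... | yes k+m<w = begin
      ∑ (upTo (suc m)) F                                                  ≈⟨ ∑-upTo-suc m F ⟩
      ∑ (upTo m) F + F m                                                  ≈⟨ R.+-cong (partial m) (R.reflexive (when-yes (suc (k ℕ.+ m) ℕ.≤? w) k+m<w)) ⟩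
      binom (w ℕ.⊓ (k ℕ.+ m)) (suc k) · r + binom (k ℕ.+ m) k · r         ≈⟨ R.+-comm _ _ ⟩
      binom (k ℕ.+ m) k · r + binom (w ℕ.⊓ (k ℕ.+ m)) (suc k) · r         ≡⟨ cong (λ v → binom (k ℕ.+ m) k · r + binom v (suc k) · r) (ℕ.m≥n⇒m⊓n≡n (ℕ.<⇒≤ k+m<w)) ⟩
      binom (k ℕ.+ m) k · r + binom (k ℕ.+ m) (suc k) · r                 ≈⟨ ×-homo-+ r (binom (k ℕ.+ m) k) _ ⟨
      binom (suc (k ℕ.+ m)) (suc k) · r                                   ≡⟨ cong (λ v → binom v (suc k) · r) (trans (ℕ.m≥n⇒m⊓n≡n
                                                                               (ℕ.≤-trans (ℕ.≤-reflexive (ℕ.+-suc k m)) k+m<w)) (ℕ.+-suc k m)) ⟨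
      binom (w ℕ.⊓ (k ℕ.+ suc m)) (suc k) · r                             ∎
    ... | no k+m≮w = begin
      ∑ (upTo (suc m)) F                                                  ≈⟨ ∑-upTo-suc m F ⟩
      ∑ (upTo m) F + F m                                                  ≈⟨ R.+-cong (partial m) (R.reflexive (when-no (suc (k ℕ.+ m) ℕ.≤? w) k+m≮w)) ⟩
      binom (w ℕ.⊓ (k ℕ.+ m)) (suc k) · r + 0#                            ≈⟨ R.+-identityʳ _ ⟩
      binom (w ℕ.⊓ (k ℕ.+ m)) (suc k) · r                                 ≡⟨ cong (λ v → binom v (suc k) · r) (trans (ℕ.m≤n⇒m⊓n≡m w≤k+m)
                                                                               (sym (ℕ.m≤n⇒m⊓n≡m (ℕ.≤-trans w≤k+m (ℕ.+-monoʳ-≤ k (ℕ.n≤1+n m)))))) ⟩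
      binom (w ℕ.⊓ (k ℕ.+ suc m)) (suc k) · r                             ∎
      where w≤k+m = ℕ.≮⇒≥ k+m≮w

-- The relations among the level sums in a ring with the relations of A^*.

module ChainRing (R : CommutativeRing 0ℓ 0ℓ) (n : ℕ) (X : Subset n → CommutativeRing.Carrier R) where
  open Sums (CommutativeRing.commutativeSemiring R)

  module Relations
    (incomparable-zero : ∀ {S T} → ¬ (S ⊆ T) → ¬ (T ⊆ S) → X S * X T ≃ 0#)
    (linear-zero : ∀ e → ∑ (subsets n) (λ S → when (does (e ∈? S)) (X S)) ≃ 0#) where

    open SubsetSums (CommutativeRing.commutativeSemiring R)
    private module R = CommutativeRing R
    open import Algebra.Properties.Semiring.Mult R.semiring using (×-congʳ; ×-congˡ; ×-comm-*)
    open SetoidReasoning R.setoid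

    family : ∀ {P : Subset n → Set} → (∀ S → Dec (P S)) → Carrier
    family P? = ∑ (subsets n) (λ S → when (does (P? S)) (X S))

    above : Subset n → Carrier
    above T = family (T ⊆?_)

    atLeast : ℕ → Carrier
    atLeast i = family (λ S → i ℕ.≤? ∣ S ∣)

    level : ℕ → Carrier
    level l = family (λ S → ∣ S ∣ ℕ.≟ l)

    -- Only the V comparable with U matter. Those with e ∈ V cannot lie inside U, hence contain U
    -- and by `fill` also T. Next to X U the sum over V ⊇ T is therefore the same as the linear
    -- relation of e.
    *-above-zero : ∀ {U T e} → e ∈ T → e ∉ U → (∀ {V} → U ⊆ V → e ∈ V → T ⊆ V) → X U * above T ≃ 0#
    *-above-zero {U} {T} {e} e∈T e∉U fill = begin
      X U * above T                                                     ≈⟨ ∑-*ˡ (X U) (subsets n) _ ⟩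
      ∑ (subsets n) (λ V → X U * when (does (T ⊆? V)) (X V))            ≈⟨ ∑-cong (subsets n) pointwise ⟩
      ∑ (subsets n) (λ V → X U * when (does (e ∈? V)) (X V))            ≈⟨ ∑-*ˡ (X U) (subsets n) _ ⟨
      X U * ∑ (subsets n) (λ V → when (does (e ∈? V)) (X V))            ≈⟨ R.*-congˡ (linear-zero e) ⟩
      X U * 0#                                                          ≈⟨ R.zeroʳ _ ⟩
      0#                                                                ∎
      where
      pointwise : ∀ V → X U * when (does (T ⊆? V)) (X V) ≃ X U * when (does (e ∈? V)) (X V)
      pointwise V with e ∈? V | U ⊆? V
      ... | yes e∈V | yes U⊆V = R.*-congˡ (R.reflexive (when-yes (T ⊆? V) (fill U⊆V e∈V)))
      ... | no  e∉V | _       = R.*-congˡ (R.reflexive (when-no (T ⊆? V) (λ T⊆V → e∉V (T⊆V e∈T))))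
      ... | yes e∈V | no  U⊈V = R.trans (R.trans (*-when (does (T ⊆? V)) _ _) (when-zero (does (T ⊆? V)) XUXV≃0)) (R.sym XUXV≃0)
        where
        XUXV≃0 : X U * X V ≃ 0#
        XUXV≃0 = incomparable-zero U⊈V (λ V⊆U → e∉U (V⊆U e∈V))

    above-split : ∀ T e → e ∈ T →
      above (T -ˢ e) ≃ above T + ∑ (subsets n) (λ V → when (does (T -ˢ e ⊆? V)) (when (does (¬? (e ∈? V))) (X V)))
    above-split T e e∈T = R.trans (∑-cong (subsets n) pointwise) (∑-+ (subsets n) _ _)
      where
      T-e⊆T : T -ˢ e ⊆ T
      T-e⊆T = p─q⊆p T ⁅ e ⁆
      pointwise : ∀ V → when (does (T -ˢ e ⊆? V)) (X V) ≃
                  when (does (T ⊆? V)) (X V) + when (does (T -ˢ e ⊆? V)) (when (does (¬? (e ∈? V))) (X V))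
      pointwise V = go (T -ˢ e ⊆? V) (e ∈? V)
        where
        go : (d : Dec (T -ˢ e ⊆ V)) (c : Dec (e ∈ V)) →
          when (does d) (X V) ≃ when (does (T ⊆? V)) (X V) + when (does d) (when (does (¬? c)) (X V))
        go (no T-e⊈V) c = R.sym (R.trans (R.+-identityʳ _) (R.reflexive (when-no (T ⊆? V) (λ T⊆V → T-e⊈V (λ {f} → ⊆-trans T-e⊆T T⊆V {f})))))
        go (yes T-e⊆V) (yes e∈V) = R.sym (R.trans (R.+-identityʳ _) (R.reflexive (when-yes (T ⊆? V) T⊆V)))
          where
          T⊆V : T ⊆ V
          T⊆V {f} f∈T with f Fin.≟ e
          ... | yes refl = e∈V
          ... | no f≢e   = T-e⊆V (x∈p∧x≢y⇒x∈p-y f∈T f≢e)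
        go (yes T-e⊆V) (no e∉V) = R.sym (R.trans (R.+-congʳ (R.reflexive (when-no (T ⊆? V) (λ T⊆V → e∉V (T⊆V e∈T))))) (R.+-identityˡ _))

    -- The relation x_S (Σ_{U ⊇ T} x_U)^{|T|−|S|} of Feichtner and Yuzvinsky, by induction on |T| − |S|: removing e
    -- from T changes the sum by x_U's with e ∉ U, and these are annihilated by the sum over the U ⊇ T.
    *-pow-above-zero : ∀ {S} k T → S ⊆ T → ¬ (T ⊆ S) → ∣ T ∣ ℕ.≤ ∣ S ∣ ℕ.+ suc k → X S * pow (above T) (suc k) ≃ 0#
    *-pow-above-zero {S} k T S⊆T T⊈S T≤ with ⊈⇒∃ T⊈S
    ... | e , e∈T , e∉S = go k T≤ (T -ˢ e ⊆? S)
      where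
      S⊆T-e : S ⊆ T -ˢ e
      S⊆T-e {f} f∈S = x∈p∧x≢y⇒x∈p-y (S⊆T f∈S) (λ { refl → e∉S f∈S })

      fill : ∀ {U V} → T -ˢ e ⊆ U → U ⊆ V → e ∈ V → T ⊆ V
      fill T-e⊆U U⊆V e∈V {f} f∈T with f Fin.≟ e
      ... | yes refl = e∈V
      ... | no f≢e   = U⊆V (T-e⊆U (x∈p∧x≢y⇒x∈p-y f∈T f≢e))

      direct : T -ˢ e ⊆ S → ∀ k → X S * pow (above T) (suc k) ≃ 0#
      direct T-e⊆S k = begin
        X S * (above T * pow (above T) k)   ≈⟨ R.*-assoc _ _ _ ⟨
        X S * above T * pow (above T) k     ≈⟨ R.*-congʳ (*-above-zero e∈T e∉S (fill T-e⊆S)) ⟩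
        0# * pow (above T) k                ≈⟨ R.zeroˡ _ ⟩
        0#                                  ∎

      rest : Carrier
      rest = ∑ (subsets n) (λ V → when (does (T -ˢ e ⊆? V)) (when (does (¬? (e ∈? V))) (X V)))

      rest-zero : rest * above T ≃ 0#
      rest-zero = begin
        rest * above T ≈⟨ ∑-*ʳ (above T) (subsets n) _ ⟩
        ∑ (subsets n) (λ V → when (does (T -ˢ e ⊆? V)) (when (does (¬? (e ∈? V))) (X V)) * above T) ≈⟨ ∑-zero (subsets n) (λ V →
          R.trans (when-* (does (T -ˢ e ⊆? V)) _ _) (when-zero? (T -ˢ e ⊆? V) λ T-e⊆V →
          R.trans (when-* (does (¬? (e ∈? V))) _ _) (when-zero? (¬? (e ∈? V)) λ e∉V →
            *-above-zero e∈T e∉V (fill T-e⊆V)))) ⟩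
        0# ∎

      absorb : ∀ j → above T * pow (above (T -ˢ e)) j ≃ above T * pow (above T) j
      absorb zero    = R.refl
      absorb (suc j) = begin
        above T * (above (T -ˢ e) * pow (above (T -ˢ e)) j)         ≈⟨ *-left-comm _ _ _ ⟩
        above (T -ˢ e) * (above T * pow (above (T -ˢ e)) j)         ≈⟨ R.*-congˡ (absorb j) ⟩
        above (T -ˢ e) * (above T * pow (above T) j)               ≈⟨ R.*-assoc _ _ _ ⟨
        above (T -ˢ e) * above T * pow (above T) j                 ≈⟨ R.*-congʳ (R.*-congʳ (above-split T e e∈T)) ⟩
        (above T + rest) * above T * pow (above T) j              ≈⟨ R.*-congʳ (R.distribʳ _ _ _) ⟩
        (above T * above T + rest * above T) * pow (above T) j    ≈⟨ R.*-congʳ (R.trans (R.+-congˡ rest-zero) (R.+-identityʳ _)) ⟩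
        above T * above T * pow (above T) j                       ≈⟨ R.*-assoc _ _ _ ⟩
        above T * (above T * pow (above T) j)                     ∎

      T-e< : ∀ {m} → ∣ T ∣ ℕ.≤ ∣ S ∣ ℕ.+ suc m → ∣ T -ˢ e ∣ ℕ.≤ ∣ S ∣ ℕ.+ m
      T-e< le = ℕ.≤-pred (ℕ.≤-trans (x∈p⇒∣p-x∣<∣p∣ e∈T) (ℕ.≤-trans le (ℕ.≤-reflexive (ℕ.+-suc ∣ S ∣ _))))

      go : ∀ k → ∣ T ∣ ℕ.≤ ∣ S ∣ ℕ.+ suc k → Dec (T -ˢ e ⊆ S) → X S * pow (above T) (suc k) ≃ 0#
      go k       le (yes T-e⊆S) = direct T-e⊆S k
      -- For k = 0 the set T - e contains S and is no larger, so it would have to be S itself.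
      go zero    le (no T-e⊈S)  = contradiction
        (λ {f} → ⊆∧∣∣≥⇒⊇ S⊆T-e (ℕ.≤-trans (T-e< le) (ℕ.≤-reflexive (ℕ.+-identityʳ _))) {f}) T-e⊈S
      go (suc k) le (no T-e⊈S)  = begin
        X S * (above T * pow (above T) (suc k))         ≈⟨ R.*-congˡ (absorb (suc k)) ⟨
        X S * (above T * pow (above (T -ˢ e)) (suc k))   ≈⟨ *-left-comm _ _ _ ⟩
        above T * (X S * pow (above (T -ˢ e)) (suc k))   ≈⟨ R.*-congˡ (*-pow-above-zero k (T -ˢ e) S⊆T-e T-e⊈S (T-e< le)) ⟩
        above T * 0#                                    ≈⟨ R.zeroʳ _ ⟩
        0#                                              ∎

    -- The cofactor of X U in a (k+1)-st power, for U the smallest set of the product. It depends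
    -- only on |U|: next to X U, a set at least as large as U contributes only if it contains U. In
    -- the recursion a new factor is either at least as large as the smallest set so far, or it
    -- becomes the new smallest set.
    weight : ℕ → ℕ → Carrier
    weight zero    i = 1#
    weight (suc k) i = weight k i * atLeast i + pow (atLeast (suc i)) (suc k)

    -- Powers of a sum over an up-closed family, sorted by the smallest set occurring in each product of x's.
    pow-family : ∀ k {P : Subset n → Set} (P? : ∀ S → Dec (P S)) → (∀ {S T} → S ⊆ T → P S → P T) →
      pow (family P?) (suc k) ≃ ∑ (subsets n) (λ U → when (does (P? U)) (X U * weight k ∣ U ∣))
    pow-family zero    P? up = R.trans (R.*-identityʳ _)
      (∑-cong (subsets n) (λ U → when-cong (does (P? U)) (R.sym (R.*-identityʳ _))))
    pow-family (suc k) {P} P? up = begin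
      family P? * pow (family P?) (suc k)
        ≈⟨ R.*-congˡ (pow-family k P? up) ⟩
      family P? * ∑ (subsets n) (λ U → when (does (P? U)) (X U * weight k ∣ U ∣))
        ≈⟨ R.trans (∑-*ˡ _ (subsets n) _) (∑-cong (subsets n) (λ U → ∑-*ʳ _ (subsets n) _)) ⟩
      ∑ (subsets n) (λ U → ∑ (subsets n) (λ V → when (does (P? V)) (X V) * when (does (P? U)) (Y U)))
        ≈⟨ ∑-cong (subsets n) (λ U → R.trans (∑-cong (subsets n) (pointwise U)) (∑-+ (subsets n) _ _)) ⟩
      ∑ (subsets n) (λ U → ∑ (subsets n) (λ V → when (does (P? U)) (when (does (∣ U ∣ ℕ.≤? ∣ V ∣)) (X V * Y U)))
                         + ∑ (subsets n) (λ V → when (does (P? V)) (when (does (suc ∣ V ∣ ℕ.≤? ∣ U ∣)) (X V * Y U))))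
        ≈⟨ ∑-+ (subsets n) _ _ ⟩
      ∑ (subsets n) (λ U → ∑ (subsets n) (λ V → when (does (P? U)) (when (does (∣ U ∣ ℕ.≤? ∣ V ∣)) (X V * Y U))))
      + ∑ (subsets n) (λ U → ∑ (subsets n) (λ V → when (does (P? V)) (when (does (suc ∣ V ∣ ℕ.≤? ∣ U ∣)) (X V * Y U))))
        ≈⟨ R.+-cong (∑-cong (subsets n) larger) (R.trans (∑-swap (subsets n) (subsets n) _) (∑-cong (subsets n) smaller)) ⟩
      ∑ (subsets n) (λ U → when (does (P? U)) (X U * (weight k ∣ U ∣ * atLeast ∣ U ∣)))
      + ∑ (subsets n) (λ U → when (does (P? U)) (X U * pow (atLeast (suc ∣ U ∣)) (suc k)))
        ≈⟨ ∑-+ (subsets n) _ _ ⟨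
      ∑ (subsets n) (λ U → when (does (P? U)) (X U * (weight k ∣ U ∣ * atLeast ∣ U ∣))
                         + when (does (P? U)) (X U * pow (atLeast (suc ∣ U ∣)) (suc k)))
        ≈⟨ ∑-cong (subsets n) combine ⟩
      ∑ (subsets n) (λ U → when (does (P? U)) (X U * weight (suc k) ∣ U ∣)) ∎
      where
      Y : Subset n → Carrier
      Y U = X U * weight k ∣ U ∣

      combine : ∀ U → when (does (P? U)) (X U * (weight k ∣ U ∣ * atLeast ∣ U ∣))
                    + when (does (P? U)) (X U * pow (atLeast (suc ∣ U ∣)) (suc k)) ≃ when (does (P? U)) (X U * weight (suc k) ∣ U ∣)
      combine U with does (P? U)
      ... | true  = R.sym (R.distribˡ _ _ _)
      ... | false = R.+-identityˡ _

      larger : ∀ U → ∑ (subsets n) (λ V → when (does (P? U)) (when (does (∣ U ∣ ℕ.≤? ∣ V ∣)) (X V * Y U)))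
                   ≃ when (does (P? U)) (X U * (weight k ∣ U ∣ * atLeast ∣ U ∣))
      larger U = begin
        ∑ (subsets n) (λ V → when (does (P? U)) (when (does (∣ U ∣ ℕ.≤? ∣ V ∣)) (X V * Y U)))
          ≈⟨ when-∑ (does (P? U)) (subsets n) _ ⟨
        when (does (P? U)) (∑ (subsets n) (λ V → when (does (∣ U ∣ ℕ.≤? ∣ V ∣)) (X V * Y U)))
          ≈⟨ when-cong (does (P? U)) (R.trans (∑-cong (subsets n) (λ V → R.sym (when-* (does (∣ U ∣ ℕ.≤? ∣ V ∣)) _ _)))
               (R.trans (R.sym (∑-*ʳ _ (subsets n) _)) (R.trans (R.*-comm _ _) (R.*-assoc _ _ _)))) ⟩
        when (does (P? U)) (X U * (weight k ∣ U ∣ * atLeast ∣ U ∣)) ∎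

      smaller : ∀ V → ∑ (subsets n) (λ U → when (does (P? V)) (when (does (suc ∣ V ∣ ℕ.≤? ∣ U ∣)) (X V * Y U)))
                    ≃ when (does (P? V)) (X V * pow (atLeast (suc ∣ V ∣)) (suc k))
      smaller V = begin
        ∑ (subsets n) (λ U → when (does (P? V)) (when (does (suc ∣ V ∣ ℕ.≤? ∣ U ∣)) (X V * Y U)))
          ≈⟨ when-∑ (does (P? V)) (subsets n) _ ⟨
        when (does (P? V)) (∑ (subsets n) (λ U → when (does (suc ∣ V ∣ ℕ.≤? ∣ U ∣)) (X V * Y U)))
          ≈⟨ when-cong (does (P? V)) (R.trans (∑-cong (subsets n) (λ U → R.sym (*-when (does (suc ∣ V ∣ ℕ.≤? ∣ U ∣)) _ _)))
               -- Once V is the smallest set, the old factors range over all sets larger than V.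
               -- This is again an up-closed family, to which the induction hypothesis applies.
               (R.trans (R.sym (∑-*ˡ _ (subsets n) _)) (R.*-congˡ (R.sym
                 (pow-family k (λ S → suc ∣ V ∣ ℕ.≤? ∣ S ∣) (λ S⊆T le → ℕ.≤-trans le (p⊆q⇒∣p∣≤∣q∣ S⊆T))))))) ⟩
        when (does (P? V)) (X V * pow (atLeast (suc ∣ V ∣)) (suc k)) ∎

      pointwise : ∀ U V → when (does (P? V)) (X V) * when (does (P? U)) (Y U) ≃
        when (does (P? U)) (when (does (∣ U ∣ ℕ.≤? ∣ V ∣)) (X V * Y U)) + when (does (P? V)) (when (does (suc ∣ V ∣ ℕ.≤? ∣ U ∣)) (X V * Y U))
      pointwise U V = R.trans (R.trans (when-* (does (P? V)) _ _) (when-cong (does (P? V)) (*-when (does (P? U)) _ _)))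
                              (go (U ⊆? V) (V ⊆? U) (P? U) (P? V))
        where
        go : Dec (U ⊆ V) → Dec (V ⊆ U) → (p : Dec (P U)) (q : Dec (P V)) → when (does q) (when (does p) (X V * Y U)) ≃
          when (does p) (when (does (∣ U ∣ ℕ.≤? ∣ V ∣)) (X V * Y U)) + when (does q) (when (does (suc ∣ V ∣ ℕ.≤? ∣ U ∣)) (X V * Y U))
        go (no U⊈V) (no V⊈U) p q = R.trans (when-zero (does q) (when-zero (does p) zero-term))
          (R.sym (R.trans (R.+-cong (when-zero (does p) (when-zero (does (∣ U ∣ ℕ.≤? ∣ V ∣)) zero-term))
                                    (when-zero (does q) (when-zero (does (suc ∣ V ∣ ℕ.≤? ∣ U ∣)) zero-term))) (R.+-identityˡ _)))
          where
          zero-term : X V * Y U ≃ 0#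
          zero-term = R.trans (R.sym (R.*-assoc _ _ _)) (R.trans (R.*-congʳ (incomparable-zero V⊈U U⊈V)) (R.zeroˡ _))
        go (yes U⊆V) _ p q = R.sym (R.trans (R.+-cong (when-cong (does p) (R.reflexive (when-yes (∣ U ∣ ℕ.≤? ∣ V ∣) U≤V)))
                                       (when-zero (does q) (R.reflexive (when-no (suc ∣ V ∣ ℕ.≤? ∣ U ∣) (ℕ.≤⇒≯ U≤V)))))
                                     (R.trans (R.+-identityʳ _) (R.sym (PV p q))))
          where
          U≤V = p⊆q⇒∣p∣≤∣q∣ U⊆V
          PV : (p : Dec (P U)) (q : Dec (P V)) → when (does q) (when (does p) (X V * Y U)) ≃ when (does p) (X V * Y U)
          PV (no _)  q       = when-zero (does q) R.refl
          PV (yes a) (yes _) = R.refl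
          PV (yes a) (no ¬b) = contradiction (up U⊆V a) ¬b
        go (no U⊈V) (yes V⊆U) p q = R.sym (R.trans (R.+-cong (when-zero (does p) (R.reflexive (when-no (∣ U ∣ ℕ.≤? ∣ V ∣) (ℕ.<⇒≱ V<U))))
                                       (when-cong (does q) (R.reflexive (when-yes (suc ∣ V ∣ ℕ.≤? ∣ U ∣) V<U))))
                                     (R.trans (R.+-identityˡ _) (R.sym (PU p q))))
          where
          V<U = ⊆∧⊉⇒∣∣< V⊆U U⊈V
          PU : (p : Dec (P U)) (q : Dec (P V)) → when (does q) (when (does p) (X V * Y U)) ≃ when (does q) (X V * Y U)
          PU p       (no _)  = R.refl
          PU (yes _) (yes _) = R.refl
          PU (no ¬a) (yes b) = contradiction (up V⊆U b) ¬a

    -- With b = a + k + 1, sorting each power by its smallest set U gives U the coefficient Σ_j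
    -- binom(k+j, k) over b + j ≤ |U|, which is binom(|U|-a, b-a) by the hockey-stick identity. For
    -- S ⊆ U with |S| = a this is the number of T of size b between S and U. Interchanging the sums
    -- over U and T leaves the relations x_S (Σ_{U ⊇ T} x_U)^(b-a) = 0. This is the origin of the
    -- coefficients of the generators; m counts the sizes from b to n.
    level-relation : ∀ a k m → a ℕ.+ k ℕ.+ m ≡ n →
      level a * ∑ (upTo m) (λ j → binom (k ℕ.+ j) k · pow (atLeast (a ℕ.+ suc k ℕ.+ j)) (suc k)) ≃ 0#
    level-relation a k m a+k+m≡n = begin
      level a * ∑ (upTo m) (λ j → binom (k ℕ.+ j) k · pow (atLeast (b ℕ.+ j)) (suc k))
        ≈⟨ R.*-congˡ sum-over-sets ⟩
      level a * ∑ (subsets n) (λ U → binom (∣ U ∣ ∸ a) (suc k) · Y U)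
        ≈⟨ ∑-*ʳ _ (subsets n) _ ⟩
      ∑ (subsets n) (λ S → when (does (∣ S ∣ ℕ.≟ a)) (X S) * ∑ (subsets n) (λ U → binom (∣ U ∣ ∸ a) (suc k) · Y U))
        ≈⟨ ∑-zero (subsets n) (λ S → R.trans (when-* (does (∣ S ∣ ℕ.≟ a)) _ _) (when-zero? (∣ S ∣ ℕ.≟ a) (fixed S))) ⟩
      0# ∎
      where
      b = a ℕ.+ suc k

      Y : Subset n → Carrier
      Y U = X U * weight k ∣ U ∣

      when-· : ∀ c l r → when c (l · r) ≃ l · when c r
      when-· true  l r = R.refl
      when-· false l r = R.sym (·-zero l)
        where
        ·-zero : ∀ l → l · 0# ≃ 0#
        ·-zero zero    = R.refl
        ·-zero (suc l) = R.trans (R.+-identityˡ _) (·-zero l)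

      bound : ∀ U → ∣ U ∣ ∸ a ℕ.≤ k ℕ.+ m
      bound U = ℕ.≤-trans (ℕ.∸-monoˡ-≤ a (ℕ.≤-trans (∣p∣≤n U) (ℕ.≤-reflexive (trans (sym a+k+m≡n) (ℕ.+-assoc a k m)))))
                          (ℕ.≤-reflexive (ℕ.m+n∸m≡n a _))

      shift : ∀ u j → does (b ℕ.+ j ℕ.≤? u) ≡ does (suc (k ℕ.+ j) ℕ.≤? u ∸ a)
      shift u j = does-⇔ (mk⇔ to from) (b ℕ.+ j ℕ.≤? u) (suc (k ℕ.+ j) ℕ.≤? u ∸ a)
        where
        to : b ℕ.+ j ℕ.≤ u → suc (k ℕ.+ j) ℕ.≤ u ∸ a
        to le = ℕ.≤-trans (ℕ.≤-reflexive (sym (trans (cong (_∸ a) (ℕ.+-assoc a (suc k) j)) (ℕ.m+n∸m≡n a _)))) (ℕ.∸-monoˡ-≤ a le)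
        from : suc (k ℕ.+ j) ℕ.≤ u ∸ a → b ℕ.+ j ℕ.≤ u
        from le = ℕ.≤-trans (ℕ.≤-reflexive (ℕ.+-assoc a (suc k) j)) (ℕ.≤-trans (ℕ.+-monoʳ-≤ a le)
          (ℕ.≤-reflexive (ℕ.m+[n∸m]≡n (ℕ.<⇒≤ (ℕ.m∸n≢0⇒n<m {u} {a} (λ e → ℕ.<⇒≱ le (ℕ.≤-trans (ℕ.≤-reflexive e) z≤n)))))))

      sum-over-sets : ∑ (upTo m) (λ j → binom (k ℕ.+ j) k · pow (atLeast (b ℕ.+ j)) (suc k))
                    ≃ ∑ (subsets n) (λ U → binom (∣ U ∣ ∸ a) (suc k) · Y U)
      sum-over-sets = begin
        ∑ (upTo m) (λ j → binom (k ℕ.+ j) k · pow (atLeast (b ℕ.+ j)) (suc k))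
          ≈⟨ ∑-cong (upTo m) (λ j → ×-congʳ (binom (k ℕ.+ j) k)
               (pow-family k (λ S → b ℕ.+ j ℕ.≤? ∣ S ∣) (λ S⊆T le → ℕ.≤-trans le (p⊆q⇒∣p∣≤∣q∣ S⊆T)))) ⟩
        ∑ (upTo m) (λ j → binom (k ℕ.+ j) k · ∑ (subsets n) (λ U → when (does (b ℕ.+ j ℕ.≤? ∣ U ∣)) (Y U)))
          ≈⟨ ∑-cong (upTo m) (λ j → R.trans (R.sym (∑-· (binom (k ℕ.+ j) k) (subsets n) _)) (∑-cong (subsets n) (λ U →
               R.trans (R.sym (when-· (does (b ℕ.+ j ℕ.≤? ∣ U ∣)) (binom (k ℕ.+ j) k) (Y U)))
                       (R.reflexive (cong (λ c → when c (binom (k ℕ.+ j) k · Y U)) (shift ∣ U ∣ j)))))) ⟩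
        ∑ (upTo m) (λ j → ∑ (subsets n) (λ U → when (does (suc (k ℕ.+ j) ℕ.≤? ∣ U ∣ ∸ a)) (binom (k ℕ.+ j) k · Y U)))
          ≈⟨ ∑-swap (upTo m) (subsets n) _ ⟩
        ∑ (subsets n) (λ U → ∑ (upTo m) (λ j → when (does (suc (k ℕ.+ j) ℕ.≤? ∣ U ∣ ∸ a)) (binom (k ℕ.+ j) k · Y U)))
          ≈⟨ ∑-cong (subsets n) (λ U → hockey-stick (∣ U ∣ ∸ a) k m (Y U) (bound U)) ⟩
        ∑ (subsets n) (λ U → binom (∣ U ∣ ∸ a) (suc k) · Y U) ∎

      count : ∀ S → ∣ S ∣ ≡ a → ∀ U → X S * (binom (∣ U ∣ ∸ a) (suc k) · Y U) ≃ between S U b (X S * Y U)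
      count S refl U with S ⊆? U
      ... | yes S⊆U = R.trans (×-comm-* (binom (∣ U ∣ ∸ a) (suc k)) _ _)
                        (R.sym (between-card S U (∣ U ∣ ∸ a) (suc k) _ S⊆U (sym (ℕ.m+[n∸m]≡n (p⊆q⇒∣p∣≤∣q∣ S⊆U)))))
      ... | no S⊈U with U ⊆? S
      ...   | yes U⊆S = R.trans (R.trans (R.*-congˡ (×-congˡ {Y U} (cong (λ v → binom v (suc k)) (ℕ.m≤n⇒m∸n≡0 (p⊆q⇒∣p∣≤∣q∣ U⊆S))))) (R.zeroʳ _))
                                (R.sym (between-⊈ S⊈U))
      ...   | no U⊈S = R.trans (×-comm-* (binom (∣ U ∣ ∸ a) (suc k)) _ _) (R.trans (R.trans (×-congʳ (binom (∣ U ∣ ∸ a) (suc k)) zero-term)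
                                (R.sym (when-· false (binom (∣ U ∣ ∸ a) (suc k)) 0#))) (R.sym (between-⊈ S⊈U)))
        where
        zero-term : X S * Y U ≃ 0#
        zero-term = R.trans (R.sym (R.*-assoc _ _ _)) (R.trans (R.*-congʳ (incomparable-zero S⊈U U⊈S)) (R.zeroˡ _))

      fixed : ∀ S → ∣ S ∣ ≡ a → X S * ∑ (subsets n) (λ U → binom (∣ U ∣ ∸ a) (suc k) · Y U) ≃ 0#
      fixed S ∣S∣≡a = begin
        X S * ∑ (subsets n) (λ U → binom (∣ U ∣ ∸ a) (suc k) · Y U)       ≈⟨ ∑-*ˡ _ (subsets n) _ ⟩
        ∑ (subsets n) (λ U → X S * (binom (∣ U ∣ ∸ a) (suc k) · Y U))     ≈⟨ ∑-cong (subsets n) (count S ∣S∣≡a) ⟩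
        ∑ (subsets n) (λ U → between S U b (X S * Y U))                   ≈⟨ ∑-swap (subsets n) (subsets n) _ ⟩
        ∑ (subsets n) (λ T → ∑ (subsets n) (λ U → when (does (S ⊆? T)) (when (does (T ⊆? U)) (when (does (∣ T ∣ ℕ.≟ b)) (X S * Y U)))))
          ≈⟨ ∑-zero (subsets n) (λ T → R.trans (R.sym (when-∑ (does (S ⊆? T)) (subsets n) _)) (when-zero? (S ⊆? T) (λ S⊆T →
               R.trans (∑-cong (subsets n) (λ U → commute (does (T ⊆? U)) (does (∣ T ∣ ℕ.≟ b))))
               (R.trans (R.sym (when-∑ (does (∣ T ∣ ℕ.≟ b)) (subsets n) _)) (when-zero? (∣ T ∣ ℕ.≟ b) (vanish T S⊆T)))))) ⟩
        0# ∎
        where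
        commute : ∀ c d {r} → when c (when d r) ≃ when d (when c r)
        commute true  d = R.refl
        commute false d = R.sym (when-zero d R.refl)

        vanish : ∀ T → S ⊆ T → ∣ T ∣ ≡ b → ∑ (subsets n) (λ U → when (does (T ⊆? U)) (X S * Y U)) ≃ 0#
        vanish T S⊆T ∣T∣≡b = begin
          ∑ (subsets n) (λ U → when (does (T ⊆? U)) (X S * Y U))   ≈⟨ ∑-cong (subsets n) (λ U → R.sym (*-when (does (T ⊆? U)) _ _)) ⟩
          ∑ (subsets n) (λ U → X S * when (does (T ⊆? U)) (Y U))   ≈⟨ ∑-*ˡ _ (subsets n) _ ⟨
          X S * ∑ (subsets n) (λ U → when (does (T ⊆? U)) (Y U))   ≈⟨ R.*-congˡ (pow-family k (T ⊆?_) (λ S⊆U T⊆S {f} → ⊆-trans T⊆S S⊆U {f})) ⟨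
          X S * pow (above T) (suc k)                              ≈⟨ *-pow-above-zero k T S⊆T T⊈S
                                                                        (ℕ.≤-reflexive (trans ∣T∣≡b (cong (ℕ._+ suc k) (sym ∣S∣≡a)))) ⟩
          0# ∎
          where
          T⊈S : ¬ (T ⊆ S)
          T⊈S T⊆S = ℕ.m+1+n≰m a (ℕ.≤-trans (ℕ.≤-reflexive (sym ∣T∣≡b)) (ℕ.≤-trans (p⊆q⇒∣p∣≤∣q∣ T⊆S) (ℕ.≤-reflexive ∣S∣≡a)))

    atLeast-∑ : ∀ i → i ℕ.≤ suc n → atLeast i ≃ ∑ (upTo (suc n ∸ i)) (λ j → level (i ℕ.+ j))
    atLeast-∑ i i≤ = R.sym (begin
      ∑ (upTo (suc n ∸ i)) (λ j → level (i ℕ.+ j))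
        ≈⟨ ∑-swap (upTo (suc n ∸ i)) (subsets n) _ ⟩
      ∑ (subsets n) (λ S → ∑ (upTo (suc n ∸ i)) (λ j → when (does (∣ S ∣ ℕ.≟ i ℕ.+ j)) (X S)))
        ≈⟨ ∑-cong (subsets n) (λ S → ∑-range-≟ ∣ S ∣ i (suc n ∸ i)
             (ℕ.≤-trans (s≤s (∣p∣≤n S)) (ℕ.≤-reflexive (sym (ℕ.m+[n∸m]≡n i≤))))) ⟩
      atLeast i ∎)

    -- Distinct sets of the same size are incomparable, so X I annihilates every other summand of
    -- its level.
    level-absorb : ∀ {l} I → ∣ I ∣ ≡ l → level l * X I ≃ X I * X I
    level-absorb {l} I ∣I∣≡l = begin
      level l * X I                                                     ≈⟨ ∑-*ʳ (X I) (subsets n) _ ⟩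
      ∑ (subsets n) (λ S → when (does (∣ S ∣ ℕ.≟ l)) (X S) * X I)       ≈⟨ ∑-cong (subsets n) (λ S → R.trans (when-* (does (∣ S ∣ ℕ.≟ l)) _ _) (only S (S ≟ˢ I))) ⟩
      ∑ (subsets n) (λ S → when (does (S ≟ˢ I)) (X S * X I))            ≈⟨ ∑-pick I (λ S → X S * X I) ⟩
      X I * X I                                                         ∎
      where
      only : ∀ S (d : Dec (S ≡ I)) → when (does (∣ S ∣ ℕ.≟ l)) (X S * X I) ≃ when (does d) (X S * X I)
      only S (yes refl) = R.reflexive (when-yes (∣ S ∣ ℕ.≟ l) ∣I∣≡l)
      only S (no S≢I)   = when-zero? (∣ S ∣ ℕ.≟ l) (λ ∣S∣≡l → incomparable-zero
        (λ S⊆I → S≢I (⊆-antisym S⊆I (⊆∧∣∣≥⇒⊇ S⊆I (ℕ.≤-reflexive (trans ∣I∣≡l (sym ∣S∣≡l))))))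
        (λ I⊆S → S≢I (⊆-antisym (⊆∧∣∣≥⇒⊇ I⊆S (ℕ.≤-reflexive (trans ∣S∣≡l (sym ∣I∣≡l)))) I⊆S)))

    level-top : ∀ {l} I → l ≡ n → ∣ I ∣ ≡ l → level l ≃ X I
    level-top {l} I l≡n ∣I∣≡l = R.trans (∑-cong (subsets n) (λ S → R.reflexive (cong (λ b → when b (X S)) (does-⇔ (mk⇔
        (λ ∣S∣≡l → trans (∣p∣≡n⇒p≡⊤ (trans ∣S∣≡l l≡n)) (sym (∣p∣≡n⇒p≡⊤ (trans ∣I∣≡l l≡n))))
        (λ { refl → ∣I∣≡l })) (∣ S ∣ ℕ.≟ l) (S ≟ˢ I)))))
      (∑-pick I X)

    level-generator : ∀ a b → a ℕ.< b → b ℕ.≤ n →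
      level a * ∑ (upTo (suc n ∸ b)) (λ j → ((b ℕ.+ j ∸ a ∸ 1) C (b ∸ a ∸ 1)) · pow (atLeast (b ℕ.+ j)) (b ∸ a)) ≃ 0#
    level-generator a b a<b b≤n = R.trans
      (R.*-congˡ (∑-cong (upTo (suc n ∸ b)) (λ j → R.reflexive (cong₂ (λ c r → c · r)
        (trans (sym (binom≡C (b ℕ.+ j ∸ a ∸ 1) k)) (cong (λ t → binom t k) (top j)))
        (cong₂ (λ v e → pow (atLeast (v ℕ.+ j)) e) b≡ b∸a≡)))))
      (level-relation a k (suc n ∸ b) a+k+m≡n)
      where
      k = b ∸ a ∸ 1

      b∸a≡ : b ∸ a ≡ suc k
      b∸a≡ = sym (ℕ.m+[n∸m]≡n {1} (ℕ.m<n⇒0<n∸m a<b))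

      b≡ : b ≡ a ℕ.+ suc k
      b≡ = trans (sym (ℕ.m+[n∸m]≡n (ℕ.<⇒≤ a<b))) (cong (a ℕ.+_) b∸a≡)

      a+k+m≡n : a ℕ.+ k ℕ.+ (suc n ∸ b) ≡ n
      a+k+m≡n = ℕ.suc-injective (trans (cong (ℕ._+ (suc n ∸ b)) (trans (sym (ℕ.+-suc a k)) (sym b≡))) (ℕ.m+[n∸m]≡n (ℕ.m≤n⇒m≤1+n b≤n)))

      top : ∀ j → b ℕ.+ j ∸ a ∸ 1 ≡ k ℕ.+ j
      top j = trans (cong (λ v → v ℕ.+ j ∸ a ∸ 1) b≡) (cong (_∸ 1) (trans (cong (_∸ a) (ℕ.+-assoc a (suc k) j)) (ℕ.m+n∸m≡n a _)))

-- Passing between the indices of the variables and nonempty subsets.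

lookup-injective : ∀ {A : Set} {l : List A} → Unique l → ∀ {i j} → lookup l i ≡ lookup l j → i ≡ j
lookup-injective (p ∷ u) {Fin.zero}  {Fin.zero}  e = refl
lookup-injective (p ∷ u) {Fin.zero}  {Fin.suc j} e = contradiction e (All.lookup p (∈-lookup j))
lookup-injective (p ∷ u) {Fin.suc i} {Fin.zero}  e = contradiction (sym e) (All.lookup p (∈-lookup i))
lookup-injective (p ∷ u) {Fin.suc i} {Fin.suc j} e = cong Fin.suc (lookup-injective u e)

subsets-unique : ∀ n → Unique (subsets n)
subsets-unique zero    = [] ∷ []
subsets-unique (suc n) = Unique.++⁺ (Unique.map⁺ ∷-injectiveʳ (subsets-unique n)) (Unique.map⁺ ∷-injectiveʳ (subsets-unique n))
  λ (p , q) → disjoint (∈-map⁻ (inside ∷_) p) (∈-map⁻ (outside ∷_) q)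
  where
  disjoint : ∀ {S} → ∃ (λ T → T ∈ˡ subsets n × S ≡ inside ∷ T) → ¬ ∃ (λ T → T ∈ˡ subsets n × S ≡ outside ∷ T)
  disjoint (_ , _ , refl) (_ , _ , ())

∈-subsets : ∀ {n} (S : Subset n) → S ∈ˡ subsets n
∈-subsets []            = here refl
∈-subsets (inside ∷ S)  = ∈-++⁺ˡ (∈-map⁺ (inside ∷_) (∈-subsets S))
∈-subsets (outside ∷ S) = ∈-++⁺ʳ (map (inside ∷_) (subsets _)) (∈-map⁺ (outside ∷_) (∈-subsets S))

setOf-injective : ∀ {n s t} → setOf n s ≡ setOf n t → s ≡ t
setOf-injective {n} = lookup-injective (Unique.filter⁺ nonempty? (subsets-unique n))

setOf-nonempty : ∀ n s → Nonempty (setOf n s)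
setOf-nonempty n s = proj₂ (∈-filter⁻ nonempty? {xs = subsets n} (∈-lookup s))

index : ∀ {n} (S : Subset n) → Nonempty S → Fin (N n)
index S ne = Any.index (∈-filter⁺ nonempty? (∈-subsets S) ne)

setOf-index : ∀ {n} (S : Subset n) ne → setOf n (index S ne) ≡ S
setOf-index S ne = sym (lookup-index (∈-filter⁺ nonempty? (∈-subsets S) ne))

index-setOf : ∀ {n} s (ne : Nonempty (setOf n s)) → index (setOf n s) ne ≡ s
index-setOf {n} s ne = setOf-injective (setOf-index (setOf n s) ne)

module SetSums (R : CommutativeSemiring 0ℓ 0ℓ) where
  open Sums R
  open SubsetSums R
  private module R = CommutativeSemiring R
  open SetoidReasoning R.setoid

  ∑-setOf : ∀ n (F : Subset n → Carrier) → ∑ (List.allFin (N n)) (λ s → F (setOf n s)) ≃ ∑ (subsets n) (λ S → when (does (nonempty? S)) (F S))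
  ∑-setOf n F = begin
    ∑ (List.allFin (N n)) (λ s → F (setOf n s))       ≡⟨ ∑-map (setOf n) (List.allFin (N n)) F ⟨
    ∑ (map (setOf n) (List.allFin (N n))) F           ≡⟨ cong (λ l → ∑ l F) (trans (map-tabulate (λ s → s) (setOf n)) (tabulate-lookup (neSubsets n))) ⟩
    ∑ (neSubsets n) F                                 ≈⟨ ∑-filter nonempty? (subsets n) F ⟩
    ∑ (subsets n) (λ S → when (does (nonempty? S)) (F S)) ∎

  ∑-setOf-when : ∀ n {P : Subset n → Set} (P? : ∀ S → Dec (P S)) → (∀ {S} → P S → Nonempty S) → ∀ (F : Subset n → Carrier) →
    ∑ (List.allFin (N n)) (λ s → when (does (P? (setOf n s))) (F (setOf n s))) ≃ ∑ (subsets n) (λ S → when (does (P? S)) (F S))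
  ∑-setOf-when n {P} P? ne F = R.trans (∑-setOf n (λ S → when (does (P? S)) (F S))) (∑-cong (subsets n) (λ S → go S (P? S)))
    where
    go : ∀ S (p : Dec (P S)) → when (does (nonempty? S)) (when (does p) (F S)) ≃ when (does p) (F S)
    go S (yes p) = R.reflexive (when-yes (nonempty? S) (ne p))
    go S (no _)  = when-zero (does (nonempty? S)) R.refl

  ∑-empty : ∀ n (F : Subset n → Carrier) → ∑ (subsets n) (λ S → when (does (∣ S ∣ ℕ.≟ 0)) (F S)) ≃ F ⊥
  ∑-empty zero    F = R.+-identityʳ _
  ∑-empty (suc n) F = R.trans (∑-subsets-suc n _)
    (R.trans (R.+-cong (∑-zero (subsets n) (λ _ → R.refl)) (∑-empty n (λ S → F (outside ∷ S)))) (R.+-identityˡ _))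

∣∣>0⇒nonempty : ∀ {n} {S : Subset n} {l} → ∣ S ∣ ≡ suc l → Nonempty S
∣∣>0⇒nonempty {n} {S} e with nonempty? S
... | yes ne = ne
... | no ¬ne = contradiction (trans (sym e) (trans (cong ∣_∣ (Empty-unique ¬ne)) (∣⊥∣≡0 n))) λ ()

-- The ring A^*, and why the generators are mapped to 0.

module ChowRing (n : ℕ) where
  private module A = CommutativeRing (quotientRing (GenJ n))
  open Sums A.commutativeSemiring
  open SetSums A.commutativeSemiring
  open SetoidReasoning A.setoid

  -- The value 1 at the empty set makes level 0 agree with the convention Z_0 = 1, so a = 0 is no
  -- special case. The relations survive: the empty set is comparable with every set and contains no
  -- e.
  X : Subset n → Poly (N n)
  X S with nonempty? S
  ... | yes ne = var (index S ne)
  ... | no  _  = 1ₚ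

  X-index : ∀ S → Nonempty S → ∃ λ s → setOf n s ≡ S × X S ≡ var s
  X-index S ne with nonempty? S
  ... | yes ne′ = index S ne′ , setOf-index S ne′ , refl
  ... | no ¬ne  = contradiction ne ¬ne

  X-⊥ : X ⊥ ≡ 1ₚ
  X-⊥ with nonempty? (⊥ {n})
  ... | yes (_ , e∈⊥) = contradiction e∈⊥ ∉⊥
  ... | no  _         = refl

  X-setOf : ∀ s → X (setOf n s) ≡ var s
  X-setOf s with nonempty? (setOf n s)
  ... | yes ne = cong var (index-setOf s ne)
  ... | no ¬ne = contradiction (setOf-nonempty n s) ¬ne

  ⊈⇒nonempty : ∀ {S T : Subset n} → ¬ (S ⊆ T) → Nonempty S
  ⊈⇒nonempty S⊈T with ⊈⇒∃ S⊈T
  ... | e , e∈S , _ = e , e∈S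

  X-incomparable : ∀ {S T} → ¬ (S ⊆ T) → ¬ (T ⊆ S) → X S * X T ≃ 0#
  X-incomparable {S} {T} S⊈T T⊈S = go (X-index S (⊈⇒nonempty S⊈T)) (X-index T (⊈⇒nonempty T⊈S))
    where
    go : (∃ λ s → setOf n s ≡ S × X S ≡ var s) → (∃ λ t → setOf n t ≡ T × X T ≡ var t) → X S * X T ≃ 0#
    go (s , refl , eq) (t , refl , eq′) = *-resp-≡ eq eq′ (gen~0 (GenJ n) (incomparable s t S⊈T T⊈S))

  ∑-X : ∀ {P : Subset n → Set} (P? : ∀ S → Dec (P S)) → (∀ {S} → P S → Nonempty S) →
    ∑ (subsets n) (λ S → when (does (P? S)) (X S)) ≃ Σₚ (map (x n) (filter (P? ∘ setOf n) (List.allFin (N n))))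
  ∑-X P? ne = A.sym (begin
    Σₚ (map (x n) (filter (P? ∘ setOf n) (List.allFin (N n))))            ≡⟨ foldr-map≡∑ (x n) (filter (P? ∘ setOf n) (List.allFin (N n))) ⟩
    ∑ (filter (P? ∘ setOf n) (List.allFin (N n))) var                     ≈⟨ ∑-filter (P? ∘ setOf n) (List.allFin (N n)) var ⟩
    ∑ (List.allFin (N n)) (λ s → when (does (P? (setOf n s))) (var s))    ≈⟨ ∑-cong (List.allFin (N n)) (λ s → when-cong (does (P? (setOf n s))) (A.reflexive (sym (X-setOf s)))) ⟩
    ∑ (List.allFin (N n)) (λ s → when (does (P? (setOf n s))) (X (setOf n s))) ≈⟨ ∑-setOf-when n P? ne X ⟩
    ∑ (subsets n) (λ S → when (does (P? S)) (X S)) ∎)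

  X-linear : ∀ e → ∑ (subsets n) (λ S → when (does (e ∈? S)) (X S)) ≃ 0#
  X-linear e = A.trans (∑-X (e ∈?_) (λ e∈S → e , e∈S)) (gen~0 (GenJ n) (linear e))

  open ChainRing.Relations (quotientRing (GenJ n)) n X X-incomparable X-linear public
  zAt : Fin n → Poly (N n)
  zAt i = z n (suc (Fin.toℕ i))

  open Eval (quotientRing (GenJ n)) (quotient-isScalar (GenJ n)) zAt public

  open IsScalar (quotient-isScalar (GenJ n)) using (ι-0; ι-+)
  open Lin (quotientRing (GenJ n)) (quotient-isScalar (GenJ n)) using (lin-neg)
  open import Algebra.Properties.Group A.+-group using (∙-cancelʳ)

  level≃z : ∀ l → level (suc l) ≃ z n (suc l)
  level≃z l = ∑-X (λ S → ∣ S ∣ ℕ.≟ suc l) ∣∣>0⇒nonempty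

  level-0 : level 0 ≃ 1#
  level-0 = A.trans (∑-empty n X) (A.reflexive X-⊥)

  Z-cases : ∀ i → (∃ λ j → Fin.toℕ j ≡ i × Z n (suc i) ≡ var j) ⊎ (n ℕ.≤ i × Z n (suc i) ≡ 0ₚ)
  Z-cases i with i <? n
  ... | yes i<n = inj₁ (Fin.fromℕ< i<n , Fin.toℕ-fromℕ< i<n , refl)
  ... | no  i≮n = inj₂ (ℕ.≮⇒≥ i≮n , refl)

  eval-Z : ∀ l → eval (Z n l) ≃ level l
  eval-Z zero    = A.trans eval-1 (A.sym level-0)
  eval-Z (suc i) = go (Z-cases i)
    where
    go : ((∃ λ j → Fin.toℕ j ≡ i × Z n (suc i) ≡ var j) ⊎ (n ℕ.≤ i × Z n (suc i) ≡ 0ₚ)) → eval (Z n (suc i)) ≃ level (suc i)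
    go (inj₁ (j , refl , eq)) = A.trans (A.reflexive (cong eval eq)) (A.trans (eval-var j) (A.sym (level≃z i)))
    -- Beyond n both sides vanish: `Z n` is 0 there by definition, and no subset is that large.
    go (inj₂ (n≤i , eq)) = A.trans (A.reflexive (cong eval eq)) (A.sym (∑-zero (subsets n) (λ S →
      A.reflexive (when-no (∣ S ∣ ℕ.≟ suc i) (λ e → ℕ.<⇒≱ (ℕ.≤-trans (ℕ.≤-reflexive (sym e)) (∣p∣≤n S)) n≤i)))))

  constₚ-· : ∀ c r → constₚ (ℤ.+ c) * r ≃ c · r
  constₚ-· zero    r = A.trans (A.*-congʳ {r} ι-0) (A.zeroˡ r)
  constₚ-· (suc c) r = begin
    constₚ (1ℤ ℤ.+ ℤ.+ c) * r                 ≈⟨ A.*-congʳ {r} (ι-+ 1ℤ (ℤ.+ c)) ⟩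
    (constₚ 1ℤ + constₚ (ℤ.+ c)) * r          ≈⟨ A.distribʳ r (constₚ 1ℤ) (constₚ (ℤ.+ c)) ⟩
    1# * r + constₚ (ℤ.+ c) * r               ≈⟨ A.+-cong (A.*-identityˡ r) (constₚ-· c r) ⟩
    r + c · r                                 ∎

  eval-range : ∀ i → eval (ΣRange i n (Z n)) ≃ atLeast i
  eval-range i = begin
    eval (ΣRange i n (Z n))                            ≈⟨ eval-Σ (upTo (suc n ∸ i)) (λ j → Z n (i ℕ.+ j)) ⟩
    ∑ (upTo (suc n ∸ i)) (λ j → eval (Z n (i ℕ.+ j)))  ≈⟨ ∑-cong (upTo (suc n ∸ i)) (λ j → eval-Z (i ℕ.+ j)) ⟩
    ∑ (upTo (suc n ∸ i)) (λ j → level (i ℕ.+ j))       ≈⟨ sum-levels (i ℕ.≤? suc n) ⟩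
    atLeast i                                          ∎
    where
    sum-levels : Dec (i ℕ.≤ suc n) → ∑ (upTo (suc n ∸ i)) (λ j → level (i ℕ.+ j)) ≃ atLeast i
    sum-levels (yes i≤) = A.sym (atLeast-∑ i i≤)
    sum-levels (no i≰)  = A.trans (A.reflexive (cong (λ m → ∑ (upTo m) (λ j → level (i ℕ.+ j))) (ℕ.m≤n⇒m∸n≡0 (ℕ.<⇒≤ (ℕ.≰⇒> i≰)))))
      (A.sym (∑-zero (subsets n) (λ S → A.reflexive (when-no (i ℕ.≤? ∣ S ∣) (λ i≤ → i≰ (ℕ.≤-trans i≤ (ℕ.m≤n⇒m≤1+n (∣p∣≤n S))))))))

  eval-gen : ∀ a b → a ℕ.< b → b ℕ.≤ n → eval (gen n a b) ≃ 0#
  eval-gen a b a<b b≤n = A.trans (eval-* (Z n a) (ΣRange b n F))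
    (A.trans (A.*-cong (eval-Z a) (A.trans (eval-Σ (upTo (suc n ∸ b)) (λ j → F (b ℕ.+ j))) (∑-cong (upTo (suc n ∸ b)) (λ j → summand (b ℕ.+ j)))))
             (level-generator a b a<b b≤n))
    where
    F : ℕ → Poly n
    F i = constₚ (ℤ.+ ((i ∸ a ∸ 1) C (b ∸ a ∸ 1))) *ₚ (ΣRange i n (Z n) ^ₚ (b ∸ a))

    summand : ∀ i → eval (F i) ≃ ((i ∸ a ∸ 1) C (b ∸ a ∸ 1)) · pow (atLeast i) (b ∸ a)
    summand i = A.trans (eval-* (constₚ (ℤ.+ c)) (ΣRange i n (Z n) ^ₚ (b ∸ a)))
      (A.trans (A.*-cong (eval-const (ℤ.+ c)) (A.trans (eval-^ (ΣRange i n (Z n)) (b ∸ a)) (pow-cong (b ∸ a) (eval-range i))))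
               (constₚ-· c (pow (atLeast i) (b ∸ a))))
      where c = (i ∸ a ∸ 1) C (b ∸ a ∸ 1)

  φ≃eval : ∀ f → φ n f ≃ eval f
  φ≃eval f = subst≃eval (GenJ n) zAt f

  φ-ideal : ∀ {f} → f ∈⟨ GenI n ⟩ → φ n f ∈⟨ GenJ n ⟩
  φ-ideal {f} f∈I = Mod.~0⇒∈ (GenJ n) (A.trans (φ≃eval f) (∈-ind (GenI n) (λ f → eval f ≃ 0#)
    A.refl
    (λ {f} {g} e e′ → A.trans (eval-+ f g) (A.trans (A.+-cong e e′) (A.+-identityʳ _)))
    (λ f≋g e → A.trans (A.sym (eval-cong f≋g)) e)
    (λ { h (gen-ab a b a<b b≤n) → A.trans (eval-* h (gen n a b)) (A.trans (A.*-congˡ {eval h} (eval-gen a b a<b b≤n)) (A.zeroʳ (eval h))) })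
    {f} f∈I))


  eval-mod : ∀ {f g} → (f +ₚ negₚ g) ∈⟨ GenI n ⟩ → eval f ≃ eval g
  eval-mod {f} {g} f-g∈I = ∙-cancelʳ (eval (negₚ g)) (eval f) (eval g)
    (A.trans (A.sym (eval-+ f (negₚ g))) (A.trans (A.trans (A.sym (φ≃eval (f +ₚ negₚ g))) (Mod.∈⇒~0 (GenJ n) (φ-ideal {f +ₚ negₚ g} f-g∈I)))
      (A.sym (lin-neg monomial g))))

-- Eur's volume formula and its four gap identities.

module ℤSums = Sums (CommutativeRing.commutativeSemiring ℤ.+-*-commutativeRing)

sgn : ℕ → ℤ
sgn zero    = 1ℤ
sgn (suc m) = ℤ.- sgn m

-- In Eur's formula `B j p` is the p-th unsigned coefficient of (q - 1)^j, the reduced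
-- characteristic polynomial of the Boolean matroid on j + 1 elements. It is 0 for p > j and so
-- kills every case in which a truncated subtraction in `F` would give a wrong excess.
B : ℕ → ℕ → ℤ
B j p = ℤ.+ binom j p

B-> : ∀ {j p} → j ℕ.< p → B j p ≡ 0ℤ
B-> j<p = cong ℤ.+_ (binom-> j<p)

B-diag : ∀ j → B j j ≡ 1ℤ
B-diag j = cong ℤ.+_ (binom-diag j)

-- Only the sizes of the sets enter the degree formula. Gaps and exponents of proper sets are
-- positive and are stored minus one, the form in which they occur in the binomial coefficients.
data Gaps : Set where
  end  : (j r : ℕ) → Gaps
  cons : (j m : ℕ) → Gaps → Gaps

-- Eur's volume formula for the degree of x_{S₁}^{d₁}⋯x_{S_k}^{d_k} with |Sᵢ₊₁| − |Sᵢ| = j + 1 and dᵢ = m + 1, where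
-- p is the excess d₁ + ⋯ + dᵢ − |Sᵢ|; the final exponent r is that of x_[n], which may be 0.
F : ℕ → Gaps → ℤ
F p (end j r)    = B j p ℤ.* (sgn r ℤ.* ℤSums.when (does (r ℕ.≟ j ∸ p)) 1ℤ)
F p (cons j m c) = B j p ℤ.* (sgn m ℤ.* (B m (j ∸ p) ℤ.* F (m ∸ (j ∸ p)) c))

module _ where
  open ℤSums using (when; when-no; when-yes)

  zero-* : ∀ {a} b → a ≡ 0ℤ → a ℤ.* b ≡ 0ℤ
  zero-* b refl = refl

  F-single : ∀ p c → F p (cons p 0 c) ≡ F 0 c
  F-single p c = begin
    B p p ℤ.* (1ℤ ℤ.* (B 0 (p ∸ p) ℤ.* F (0 ∸ (p ∸ p)) c)) ≡⟨ cong₂ (λ a b → a ℤ.* (1ℤ ℤ.* (B 0 b ℤ.* F (0 ∸ b) c))) (B-diag p) (ℕ.n∸n≡0 p) ⟩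
    1ℤ ℤ.* (1ℤ ℤ.* (1ℤ ℤ.* F 0 c))                         ≡⟨ ones (F 0 c) ⟩
    F 0 c                                                  ∎
    where
    open ≡.≡-Reasoning
    ones : ∀ a → 1ℤ ℤ.* (1ℤ ℤ.* (1ℤ ℤ.* a)) ≡ a
    ones = solve-∀

  -- `B i p` requires p ≤ i and `B 0 (i ∸ p)` requires i ≤ p. So a new set of exponent 1 has nonzero
  -- degree at a single size, where it brings the excess p back to 0.
  F-single-zero : ∀ {p i} c → i ≢ p → F p (cons i 0 c) ≡ 0ℤ
  F-single-zero {p} {i} c i≢p with ℕ.<-cmp i p
  ... | tri< i<p _ _ = zero-* _ (B-> i<p)
  ... | tri≈ _ i≡p _ = contradiction i≡p i≢p
  ... | tri> _ _ p<i = trans (cong (λ a → B i p ℤ.* (1ℤ ℤ.* (a ℤ.* F (0 ∸ (i ∸ p)) c))) (B-> (ℕ.m<n⇒0<n∸m p<i))) (zeros (B i p) (F (0 ∸ (i ∸ p)) c))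
    where
    zeros : ∀ a b → a ℤ.* (1ℤ ℤ.* (0ℤ ℤ.* b)) ≡ 0ℤ
    zeros = solve-∀

  private
    -- With j written as 1 + p + i the truncated subtractions compute, and the gap identities become
    -- polynomial identities for the ring solver.
    split : ∀ {p j} → p ℕ.< j → ∃ λ i → j ≡ suc (p ℕ.+ i)
    split {p} {j} p<j = j ∸ suc p , sym (ℕ.m+[n∸m]≡n p<j)

    cancel : ∀ p i → suc (p ℕ.+ i) ∸ p ≡ suc i
    cancel p i = trans (cong (_∸ p) (sym (ℕ.+-suc p i))) (ℕ.m+n∸m≡n p (suc i))

    -- The two arguments of `F` differ only where truncation acts, for m ≤ i, and there the binomial
    -- factor is 0.
    B-suc-∸ : ∀ m i c → B m (suc i) ℤ.* F (suc (m ∸ suc i)) c ≡ B m (suc i) ℤ.* F (m ∸ i) c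
    B-suc-∸ m i c with i <? m
    ... | yes i<m = cong (λ v → B m (suc i) ℤ.* F v c) (sym (ℕ.+-∸-assoc 1 i<m))
    ... | no  i≮m = trans (zero-* _ eq) (sym (zero-* _ eq))
      where eq = B-> {m} (s≤s (ℕ.≮⇒≥ i≮m))

    module _ (p j i : ℕ) (j≡ : j ≡ suc (p ℕ.+ i)) where
      j∸p : j ∸ p ≡ suc i
      j∸p = trans (cong (_∸ p) j≡) (cancel p i)

      j∸1+p : j ∸ suc p ≡ i
      j∸1+p = trans (cong (_∸ suc p) j≡) (ℕ.m+n∸m≡n p i)

      F-end-suc : ∀ r → F p (end j (suc r)) ≡ B j p ℤ.* (ℤ.- sgn r ℤ.* when (does (r ℕ.≟ i)) 1ℤ)
      F-end-suc r = cong (λ v → B j p ℤ.* (ℤ.- sgn r ℤ.* when (does (suc r ℕ.≟ v)) 1ℤ)) j∸p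

      F-cons-suc : ∀ m c → F p (cons j (suc m) c) ≡ B j p ℤ.* (ℤ.- sgn m ℤ.* ((B m i ℤ.+ B m (suc i)) ℤ.* F (m ∸ i) c))
      F-cons-suc m c = cong (λ v → B j p ℤ.* (ℤ.- sgn m ℤ.* (B (suc m) v ℤ.* F (suc m ∸ v) c))) j∸p

      F-cons-tail : ∀ m c → B j p ℤ.* (sgn m ℤ.* (B m (j ∸ p) ℤ.* F (suc (m ∸ (j ∸ p))) c)) ≡
                            B j p ℤ.* (sgn m ℤ.* (B m (suc i) ℤ.* F (m ∸ i) c))
      F-cons-tail m c = trans (cong (λ v → B j p ℤ.* (sgn m ℤ.* (B m v ℤ.* F (suc (m ∸ v)) c))) j∸p)
                              (cong (λ v → B j p ℤ.* (sgn m ℤ.* v)) (B-suc-∸ m i c))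

    boundary : ∀ {p j} → ¬ (p ℕ.< j) → ∀ m c →
      F p (cons j (suc m) c) ℤ.+ B j p ℤ.* (sgn m ℤ.* (B m (j ∸ p) ℤ.* F (suc (m ∸ (j ∸ p))) c)) ≡ 0ℤ
    boundary {p} {j} p≮j m c = trans (cong (λ v → B j p ℤ.* (ℤ.- sgn m ℤ.* (B (suc m) v ℤ.* F (suc m ∸ v) c)) ℤ.+
      B j p ℤ.* (sgn m ℤ.* (B m v ℤ.* F (suc (m ∸ v)) c))) (ℕ.m≤n⇒m∸n≡0 (ℕ.≮⇒≥ p≮j))) (lemma (B j p) (sgn m) (F (suc m) c))
      where
      lemma : ∀ a s f → a ℤ.* (ℤ.- s ℤ.* (1ℤ ℤ.* f)) ℤ.+ a ℤ.* (s ℤ.* (1ℤ ℤ.* f)) ≡ 0ℤ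
      lemma = solve-∀

    boundary-end : ∀ {p j} → ¬ (p ℕ.< j) → ∀ r → F p (end j (suc r)) ≡ 0ℤ
    boundary-end {p} {j} p≮j r = trans (cong (λ v → B j p ℤ.* (ℤ.- sgn r ℤ.* when (does (suc r ℕ.≟ v)) 1ℤ)) (ℕ.m≤n⇒m∸n≡0 (ℕ.≮⇒≥ p≮j)))
      (lemma (B j p) (sgn r))
      where
      lemma : ∀ a s → a ℤ.* (ℤ.- s ℤ.* 0ℤ) ≡ 0ℤ
      lemma = solve-∀

    B-∸ : ∀ {p j} → ¬ (p ℕ.< j) → B j (suc p) ≡ 0ℤ
    B-∸ p≮j = B-> (s≤s (ℕ.≮⇒≥ p≮j))

  tail : ℕ → ℕ → ℕ → Gaps → ℤ
  tail p j m c = B j p ℤ.* (sgn m ℤ.* (B m (j ∸ p) ℤ.* F (suc (m ∸ (j ∸ p))) c))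

  -- The four identities behind Σ_{S ∋ e} L(x_S x^d) = 0. Their summands: a new set in the first gap, an increment of the
  -- first exponent, and a change further up (tail). In the primed versions the new set has to contain a given element e.
  gap-end : ∀ p j r →
    B (suc j) (suc p) ℤ.* when (does (p <? j)) (F 0 (end (j ∸ suc p) r)) ℤ.+ F p (end j (suc r)) ≡ F (suc p) (end j r)
  gap-end p j r = go (p <? j)
    where
    open ≡.≡-Reasoning
    go : (d : Dec (p ℕ.< j)) → B (suc j) (suc p) ℤ.* when (does d) (F 0 (end (j ∸ suc p) r)) ℤ.+ F p (end j (suc r)) ≡ F (suc p) (end j r)
    go (yes p<j) = let i , j≡ = split p<j in begin
      B (suc j) (suc p) ℤ.* F 0 (end (j ∸ suc p) r) ℤ.+ F p (end j (suc r))
        ≡⟨ cong₂ (λ v u → B (suc j) (suc p) ℤ.* F 0 (end v r) ℤ.+ u) (j∸1+p p j i j≡) (F-end-suc p j i j≡ r) ⟩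
      -- Pascal's rule for `B (suc j) (suc p)` holds by computation; the half with `B j p` cancels
      -- against the increment of the exponent, whose sign is opposite.
      (B j p ℤ.+ B j (suc p)) ℤ.* (1ℤ ℤ.* (sgn r ℤ.* when (does (r ℕ.≟ i)) 1ℤ)) ℤ.+ B j p ℤ.* (ℤ.- sgn r ℤ.* when (does (r ℕ.≟ i)) 1ℤ)
        ≡⟨ lemma (B j p) (B j (suc p)) (sgn r) _ ⟩
      B j (suc p) ℤ.* (sgn r ℤ.* when (does (r ℕ.≟ i)) 1ℤ)
        ≡⟨ cong (λ v → B j (suc p) ℤ.* (sgn r ℤ.* when (does (r ℕ.≟ v)) 1ℤ)) (j∸1+p p j i j≡) ⟨
      F (suc p) (end j r) ∎
      where
      lemma : ∀ a b s w → (a ℤ.+ b) ℤ.* (1ℤ ℤ.* (s ℤ.* w)) ℤ.+ a ℤ.* (ℤ.- s ℤ.* w) ≡ b ℤ.* (s ℤ.* w)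
      lemma = solve-∀
    go (no p≮j) = trans (cong₂ (λ u v → B (suc j) (suc p) ℤ.* u ℤ.+ v) refl (boundary-end p≮j r))
      (trans (lemma (B (suc j) (suc p))) (sym (zero-* _ (B-∸ p≮j))))
      where
      lemma : ∀ a → a ℤ.* 0ℤ ℤ.+ 0ℤ ≡ 0ℤ
      lemma = solve-∀

  gap-end′ : ∀ p j r →
    B j p ℤ.* when (does (p <? j)) (F 0 (end (j ∸ suc p) r)) ℤ.+ F p (end j (suc r)) ≡ 0ℤ
  gap-end′ p j r = go (p <? j)
    where
    open ≡.≡-Reasoning
    go : (d : Dec (p ℕ.< j)) → B j p ℤ.* when (does d) (F 0 (end (j ∸ suc p) r)) ℤ.+ F p (end j (suc r)) ≡ 0ℤ
    go (yes p<j) = let i , j≡ = split p<j in trans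
      (cong₂ (λ v u → B j p ℤ.* F 0 (end v r) ℤ.+ u) (j∸1+p p j i j≡) (F-end-suc p j i j≡ r))
      (lemma (B j p) (sgn r) (when (does (r ℕ.≟ i)) 1ℤ))
      where
      lemma : ∀ a s w → a ℤ.* (1ℤ ℤ.* (s ℤ.* w)) ℤ.+ a ℤ.* (ℤ.- s ℤ.* w) ≡ 0ℤ
      lemma = solve-∀
    go (no p≮j) = trans (cong (λ v → B j p ℤ.* 0ℤ ℤ.+ v) (boundary-end p≮j r)) (lemma (B j p))
      where
      lemma : ∀ a → a ℤ.* 0ℤ ℤ.+ 0ℤ ≡ 0ℤ
      lemma = solve-∀

  gap-cons : ∀ p j m c →
    B (suc j) (suc p) ℤ.* when (does (p <? j)) (F 0 (cons (j ∸ suc p) m c)) ℤ.+ (F p (cons j (suc m) c) ℤ.+ tail p j m c) ≡ F (suc p) (cons j m c)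
  gap-cons p j m c = go (p <? j)
    where
    open ≡.≡-Reasoning
    go : (d : Dec (p ℕ.< j)) → B (suc j) (suc p) ℤ.* when (does d) (F 0 (cons (j ∸ suc p) m c)) ℤ.+ (F p (cons j (suc m) c) ℤ.+ tail p j m c) ≡ F (suc p) (cons j m c)
    go (yes p<j) = let i , j≡ = split p<j in begin
      B (suc j) (suc p) ℤ.* F 0 (cons (j ∸ suc p) m c) ℤ.+ (F p (cons j (suc m) c) ℤ.+ tail p j m c)
        ≡⟨ cong₂ (λ v u → B (suc j) (suc p) ℤ.* F 0 (cons v m c) ℤ.+ u) (j∸1+p p j i j≡) (cong₂ ℤ._+_ (F-cons-suc p j i j≡ m c) (F-cons-tail p j i j≡ m c)) ⟩
      (B j p ℤ.+ B j (suc p)) ℤ.* (1ℤ ℤ.* (sgn m ℤ.* (B m i ℤ.* F (m ∸ i) c))) ℤ.+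
        (B j p ℤ.* (ℤ.- sgn m ℤ.* ((B m i ℤ.+ B m (suc i)) ℤ.* F (m ∸ i) c)) ℤ.+ B j p ℤ.* (sgn m ℤ.* (B m (suc i) ℤ.* F (m ∸ i) c)))
        ≡⟨ lemma (B j p) (B j (suc p)) (sgn m) (B m i) (B m (suc i)) (F (m ∸ i) c) ⟩
      B j (suc p) ℤ.* (sgn m ℤ.* (B m i ℤ.* F (m ∸ i) c))
        ≡⟨ cong (λ v → B j (suc p) ℤ.* (sgn m ℤ.* (B m v ℤ.* F (m ∸ v) c))) (j∸1+p p j i j≡) ⟨
      F (suc p) (cons j m c) ∎
      where
      lemma : ∀ a b s u v f → (a ℤ.+ b) ℤ.* (1ℤ ℤ.* (s ℤ.* (u ℤ.* f))) ℤ.+ (a ℤ.* (ℤ.- s ℤ.* ((u ℤ.+ v) ℤ.* f)) ℤ.+ a ℤ.* (s ℤ.* (v ℤ.* f)))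
              ≡ b ℤ.* (s ℤ.* (u ℤ.* f))
      lemma = solve-∀
    go (no p≮j) = trans (cong (λ v → B (suc j) (suc p) ℤ.* 0ℤ ℤ.+ v) (boundary p≮j m c))
      (trans (lemma (B (suc j) (suc p))) (sym (zero-* _ (B-∸ p≮j))))
      where
      lemma : ∀ a → a ℤ.* 0ℤ ℤ.+ 0ℤ ≡ 0ℤ
      lemma = solve-∀

  gap-cons′ : ∀ p j m c →
    B j p ℤ.* when (does (p <? j)) (F 0 (cons (j ∸ suc p) m c)) ℤ.+ (F p (cons j (suc m) c) ℤ.+ tail p j m c) ≡ 0ℤ
  gap-cons′ p j m c = go (p <? j)
    where
    open ≡.≡-Reasoning
    go : (d : Dec (p ℕ.< j)) → B j p ℤ.* when (does d) (F 0 (cons (j ∸ suc p) m c)) ℤ.+ (F p (cons j (suc m) c) ℤ.+ tail p j m c) ≡ 0ℤ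
    go (yes p<j) = let i , j≡ = split p<j in trans
      (cong₂ (λ v u → B j p ℤ.* F 0 (cons v m c) ℤ.+ u) (j∸1+p p j i j≡) (cong₂ ℤ._+_ (F-cons-suc p j i j≡ m c) (F-cons-tail p j i j≡ m c)))
      (lemma (B j p) (sgn m) (B m i) (B m (suc i)) (F (m ∸ i) c))
      where
      lemma : ∀ a s u v f → a ℤ.* (1ℤ ℤ.* (s ℤ.* (u ℤ.* f))) ℤ.+ (a ℤ.* (ℤ.- s ℤ.* ((u ℤ.+ v) ℤ.* f)) ℤ.+ a ℤ.* (s ℤ.* (v ℤ.* f))) ≡ 0ℤ
      lemma = solve-∀
    go (no p≮j) = trans (cong (λ v → B j p ℤ.* 0ℤ ℤ.+ v) (boundary p≮j m c)) (lemma (B j p))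
      where
      lemma : ∀ a → a ℤ.* 0ℤ ℤ.+ 0ℤ ≡ 0ℤ
      lemma = solve-∀

-- Chains of subsets, and the degree after multiplication by one more variable.

_⊏_ : ∀ {n} → Subset n → Subset n → Set
S ⊏ T = S ⊆ T × ¬ (T ⊆ S)

_⊏?_ : ∀ {n} (S T : Subset n) → Dec (S ⊏ T)
S ⊏? T = (S ⊆? T) ×-dec ¬? (T ⊆? S)

Comparable : ∀ {n} → Subset n → Subset n → Set
Comparable S T = S ⊆ T ⊎ T ⊆ S

comparable? : ∀ {n} (S T : Subset n) → Dec (Comparable S T)
comparable? S T = (S ⊆? T) ⊎-dec (T ⊆? S)

-- A chain of proper subsets Sᵢ with exponents mᵢ + 1, ending with the exponent of [n].
data Chain (n : ℕ) : Set where
  end  : ℕ → Chain n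
  cons : Subset n → ℕ → Chain n → Chain n

gaps : ∀ {n} → ℕ → Chain n → Gaps
gaps {n} a (end r)      = end (n ∸ suc a) r
gaps     a (cons S m c) = cons (∣ S ∣ ∸ suc a) m (gaps ∣ S ∣ c)

-- The chain is anchored at a set A strictly below it, so that an induction can discard the first
-- set and continue with that set as the new anchor.
Valid : ∀ {n} → Subset n → Chain n → Set
Valid {n} A (end r)      = A ⊏ ⊤
Valid     A (cons S m c) = A ⊏ S × Valid S c

Compatible : ∀ {n} → Subset n → Chain n → Set
Compatible T (end r)      = Unit
Compatible T (cons S m c) = Comparable T S × Compatible T c

compatible? : ∀ {n} (T : Subset n) c → Dec (Compatible T c)
compatible? T (end r)      = yes tt
compatible? T (cons S m c) = comparable? T S ×-dec compatible? T c

-- Multiplication by x_T^(k+1). The comparisons are arguments, so that proofs can split on them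
-- together with their other cases. The extra successor when T = S comes from two exponents stored
-- minus one; for [n] it is there because only k + 1 is stored minus one.
insertCons : ∀ {n} {S T : Subset n} → Dec (T ≡ S) → Dec (T ⊆ S) → ℕ → ℕ → Chain n → Chain n → Chain n
insertCons {S = S}     (yes _) _       k m c c′ = cons S (suc (k ℕ.+ m)) c
insertCons {S = S} {T} (no _)  (yes _) k m c c′ = cons T k (cons S m c)
insertCons {S = S}     (no _)  (no _)  k m c c′ = cons S m c′

insertEnd : ∀ {n} {T : Subset n} → Dec (T ≡ ⊤) → ℕ → ℕ → Chain n
insertEnd         (yes _) k r = end (suc (k ℕ.+ r))
insertEnd {T = T} (no _)  k r = cons T k (end r)

insert : ∀ {n} → Subset n → ℕ → Chain n → Chain n
insert T k (end r)      = insertEnd (T ≟ˢ ⊤) k r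
insert T k (cons S m c) = insertCons (T ≟ˢ S) (T ⊆? S) k m c (insert T k c)

⊆⇒compatible : ∀ {n} {S T : Subset n} c → Valid S c → T ⊆ S → Compatible T c
⊆⇒compatible (end r)      _                   T⊆S = tt
⊆⇒compatible (cons U m c) ((S⊆U , _) , valid) T⊆S =
  inj₁ (λ {e} → ⊆-trans T⊆S S⊆U {e}) , ⊆⇒compatible c valid (λ {e} → ⊆-trans T⊆S S⊆U {e})

⊏⇒∣∣ : ∀ {n} {S T : Subset n} → S ⊏ T → ∣ T ∣ ≡ ∣ S ∣ ℕ.+ suc (∣ T ∣ ∸ suc ∣ S ∣)
⊏⇒∣∣ {S = S} (S⊆T , T⊈S) = sym (trans (ℕ.+-suc ∣ S ∣ _) (ℕ.m+[n∸m]≡n (⊆∧⊉⇒∣∣< S⊆T T⊈S)))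

∣∪⁅⁆∣ : ∀ {n} (S : Subset n) e → e ∉ S → ∣ S ∪ ⁅ e ⁆ ∣ ≡ suc ∣ S ∣
∣∪⁅⁆∣ (inside  ∷ S) Fin.zero    e∉S = contradiction here e∉S
∣∪⁅⁆∣ (outside ∷ S) Fin.zero    e∉S = cong (suc ∘ ∣_∣) (∪-identityʳ S)
∣∪⁅⁆∣ (inside  ∷ S) (Fin.suc e) e∉S = cong suc (∣∪⁅⁆∣ S e (e∉S ∘ there))
∣∪⁅⁆∣ (outside ∷ S) (Fin.suc e) e∉S = ∣∪⁅⁆∣ S e (e∉S ∘ there)

module _ where
  open ℤSums
  open SubsetSums (CommutativeRing.commutativeSemiring ℤ.+-*-commutativeRing)
  open ≡.≡-Reasoning

  ·-* : ∀ m v → m · v ≡ ℤ.+ m ℤ.* v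
  ·-* zero    v = refl
  ·-* (suc m) v = trans (cong (ℤ._+_ v) (·-* m v)) (sym (trans (ℤ.*-distribʳ-+ v 1ℤ (ℤ.+ m)) (cong (ℤ._+ (ℤ.+ m ℤ.* v)) (ℤ.*-identityˡ v))))

  -- The contribution of a new set in the gap between A and S. The conditions are not strict, so
  -- that the count is a binomial coefficient; the value T = S can occur only when p exhausts the
  -- gap, and the v used later is 0 in that case.
  step : ∀ {n} → Subset n → Subset n → ℕ → ℤ → Subset n → ℤ
  step A S p v T = when (does (A ⊆? T)) (when (does (T ⊆? S)) (when (does (∣ T ∣ ℕ.≟ ∣ A ∣ ℕ.+ suc p)) v))

  module _ {n} {A S : Subset n} (A⊏S : A ⊏ S) where
    private
      j = ∣ S ∣ ∸ suc ∣ A ∣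

    ∑-step : ∀ p v → ∑ (subsets n) (step A S p v) ≡ B (suc j) (suc p) ℤ.* v
    ∑-step p v = trans (between-card A S (suc j) (suc p) v (proj₁ A⊏S) (⊏⇒∣∣ A⊏S)) (·-* (binom (suc j) (suc p)) v)

    -- The sets T that contain A and e are those that contain A ∪ {e}: the lower end of the interval
    -- moves up by one, and the binomial coefficient loses one in both arguments.
    ∑-step-∈ : ∀ {e} → e ∈ S → e ∉ A → ∀ p v → ∑ (subsets n) (λ T → when (does (e ∈? T)) (step A S p v T)) ≡ B j p ℤ.* v
    ∑-step-∈ {e} e∈S e∉A p v = begin
      ∑ (subsets n) (λ T → when (does (e ∈? T)) (step A S p v T))
        ≡⟨ ∑-cong (subsets n) pointwise ⟩
      between (A ∪ ⁅ e ⁆) S (∣ A ∪ ⁅ e ⁆ ∣ ℕ.+ p) v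
        ≡⟨ between-card (A ∪ ⁅ e ⁆) S j p v A∪e⊆S (trans (⊏⇒∣∣ A⊏S) (trans (ℕ.+-suc ∣ A ∣ j) (cong (ℕ._+ j) (sym size)))) ⟩
      binom j p · v
        ≡⟨ ·-* (binom j p) v ⟩
      B j p ℤ.* v ∎
      where
      size = ∣∪⁅⁆∣ A e e∉A
      A∪e⊆ : ∀ {T} → A ⊆ T → e ∈ T → A ∪ ⁅ e ⁆ ⊆ T
      A∪e⊆ A⊆T e∈T f∈ with x∈p∪q⁻ A ⁅ e ⁆ f∈
      ... | inj₁ f∈A = A⊆T f∈A
      ... | inj₂ f∈e with x∈⁅y⁆⇒x≡y e f∈e
      ...   | refl = e∈T
      A∪e⊆S : A ∪ ⁅ e ⁆ ⊆ S
      A∪e⊆S = A∪e⊆ (proj₁ A⊏S) e∈S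
      pointwise : ∀ T → when (does (e ∈? T)) (step A S p v T) ≡
        when (does (A ∪ ⁅ e ⁆ ⊆? T)) (when (does (T ⊆? S)) (when (does (∣ T ∣ ℕ.≟ ∣ A ∪ ⁅ e ⁆ ∣ ℕ.+ p)) v))
      pointwise T = trans (when-∧ (does (e ∈? T)) (does (A ⊆? T)) _)
        (cong₂ (λ b s → when b (when (does (T ⊆? S)) (when (does (∣ T ∣ ℕ.≟ s)) v)))
          (does-⇔ (mk⇔ to from)
            ((e ∈? T) ×-dec (A ⊆? T)) (A ∪ ⁅ e ⁆ ⊆? T))
          (trans (ℕ.+-suc ∣ A ∣ p) (cong (ℕ._+ p) (sym size))))
        where
        to : e ∈ T × A ⊆ T → A ∪ ⁅ e ⁆ ⊆ T
        to (e∈T , A⊆T) = A∪e⊆ A⊆T e∈T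
        from : A ∪ ⁅ e ⁆ ⊆ T → e ∈ T × A ⊆ T
        from A∪e⊆T = A∪e⊆T (x∈p∪q⁺ (inj₂ (x∈⁅x⁆ e))) , λ f∈A → A∪e⊆T (x∈p∪q⁺ (inj₁ f∈A))

    -- A new set T strictly between A and S contributes only if it has size |A| + p + 1.
    step-between : ∀ p (c′ : ℕ → Gaps) T → A ⊏ T → T ⊏ S → F p (cons (∣ T ∣ ∸ suc ∣ A ∣) 0 (c′ ∣ T ∣)) ≡ step A S p (when (does (p <? j)) (F 0 (c′ (suc (∣ A ∣ ℕ.+ p))))) T
    step-between p c′ T A⊏T T⊏S with ∣ T ∣ ℕ.≟ ∣ A ∣ ℕ.+ suc p
    ... | yes ∣T∣≡ = begin
      F p (cons (∣ T ∣ ∸ suc ∣ A ∣) 0 (c′ ∣ T ∣))  ≡⟨ cong₂ (λ i a → F p (cons i 0 (c′ a))) i≡p ∣T∣≡′ ⟩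
      F p (cons p 0 (c′ (suc (∣ A ∣ ℕ.+ p))))      ≡⟨ F-single p (c′ (suc (∣ A ∣ ℕ.+ p))) ⟩
      F 0 (c′ (suc (∣ A ∣ ℕ.+ p)))                 ≡⟨ when-yes (p <? j) p<j ⟨
      _                                            ≡⟨ when-yes (∣ T ∣ ℕ.≟ ∣ A ∣ ℕ.+ suc p) ∣T∣≡ ⟨
      _                                            ≡⟨ when-yes (T ⊆? S) (proj₁ T⊏S) ⟨
      _                                            ≡⟨ when-yes (A ⊆? T) (proj₁ A⊏T) ⟨
      step A S p (when (does (p <? j)) (F 0 (c′ (suc (∣ A ∣ ℕ.+ p))))) T ∎
      where
      ∣T∣≡′ = trans ∣T∣≡ (ℕ.+-suc ∣ A ∣ p)
      i≡p = trans (cong (_∸ suc ∣ A ∣) ∣T∣≡′) (ℕ.m+n∸m≡n (suc ∣ A ∣) p)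
      p<j : p ℕ.< j
      p<j = ℕ.≤-trans (ℕ.≤-reflexive (sym (trans (cong (_∸ suc ∣ A ∣) (trans (cong suc ∣T∣≡′) (cong suc (sym (ℕ.+-suc ∣ A ∣ p))))) (ℕ.m+n∸m≡n ∣ A ∣ (suc p)))))
                      (ℕ.∸-monoˡ-≤ (suc ∣ A ∣) (⊆∧⊉⇒∣∣< (proj₁ T⊏S) (proj₂ T⊏S)))
    ... | no ∣T∣≢ = begin
      F p (cons (∣ T ∣ ∸ suc ∣ A ∣) 0 (c′ ∣ T ∣)) ≡⟨ F-single-zero (c′ ∣ T ∣) (λ i≡p → ∣T∣≢ (trans (⊏⇒∣∣ A⊏T) (cong (λ i → ∣ A ∣ ℕ.+ suc i) i≡p))) ⟩
      0ℤ                                          ≡⟨ when-zero? (A ⊆? T) (λ _ → when-zero? (T ⊆? S) (λ _ → when-no (∣ T ∣ ℕ.≟ ∣ A ∣ ℕ.+ suc p) ∣T∣≢)) ⟨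
      step A S p (when (does (p <? j)) (F 0 (c′ (suc (∣ A ∣ ℕ.+ p))))) T ∎

  Inside : ∀ {n} → Subset n → Chain n → Subset n → Set
  Inside A c T = A ⊏ T × Compatible T c

  inside? : ∀ {n} (A : Subset n) c T → Dec (Inside A c T)
  inside? A c T = (A ⊏? T) ×-dec compatible? T c

  ⊏-trans : ∀ {n} {A S T : Subset n} → A ⊏ S → S ⊏ T → A ⊏ T
  ⊏-trans (A⊆S , S⊈A) (S⊆T , T⊈S) = (λ {e} → ⊆-trans A⊆S S⊆T {e}) , λ T⊆A → T⊈S (λ {e} → ⊆-trans T⊆A A⊆S {e})

  private
    +-zeros : ∀ {a b c d : ℤ} → a ≡ d → b ≡ 0ℤ → c ≡ 0ℤ → a ℤ.+ (b ℤ.+ c) ≡ d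
    +-zeros refl refl refl = ℤ.+-identityʳ _

    zero-+ : ∀ {a b d : ℤ} → a ≡ 0ℤ → b ≡ d → a ℤ.+ b ≡ d
    zero-+ refl refl = ℤ.+-identityˡ _

    zeros-+ : ∀ {a b c d : ℤ} → a ≡ 0ℤ → b ≡ d → c ≡ 0ℤ → a ℤ.+ (b ℤ.+ c) ≡ d
    zeros-+ refl refl refl = trans (ℤ.+-identityˡ _) (ℤ.+-identityʳ _)

    zeros-zeros : ∀ {a b c d : ℤ} → a ≡ 0ℤ → b ≡ 0ℤ → c ≡ d → a ℤ.+ (b ℤ.+ c) ≡ d
    zeros-zeros refl refl refl = trans (ℤ.+-identityˡ _) (ℤ.+-identityˡ _)

    bigger : ∀ {n} {A T : Subset n} {p} → A ⊆ T → ∣ T ∣ ≡ ∣ A ∣ ℕ.+ suc p → A ⊏ T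
    bigger {A = A} A⊆T ∣T∣≡ = A⊆T , λ T⊆A → ℕ.m+1+n≰m ∣ A ∣ (ℕ.≤-trans (ℕ.≤-reflexive (sym ∣T∣≡)) (p⊆q⇒∣p∣≤∣q∣ T⊆A))

    too-long : ∀ {n} {A S : Subset n} {p} → A ⊏ S → ∣ S ∣ ≡ ∣ A ∣ ℕ.+ suc p → ¬ (p ℕ.< ∣ S ∣ ∸ suc ∣ A ∣)
    too-long {A = A} A⊏S ∣S∣≡ p<j = ℕ.<⇒≢ p<j (ℕ.suc-injective (ℕ.+-cancelˡ-≡ ∣ A ∣ _ _ (trans (sym ∣S∣≡) (⊏⇒∣∣ A⊏S))))

  module _ {n} {A : Subset n} where
    step-end : A ⊏ ⊤ → ∀ p r T → when (does (inside? A (end r) T)) (F p (gaps ∣ A ∣ (insert T 0 (end r)))) ≡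
      step A ⊤ p (when (does (p <? ∣ ⊤ {n} ∣ ∸ suc ∣ A ∣)) (F 0 (gaps (suc (∣ A ∣ ℕ.+ p)) (end {n} r)))) T
      ℤ.+ when (does (T ≟ˢ ⊤)) (F p (gaps ∣ A ∣ (end {n} (suc r))))
    step-end A⊏⊤ p r T = go (A ⊏? T) (T ≟ˢ ⊤)
      where
      v = when (does (p <? ∣ ⊤ {n} ∣ ∸ suc ∣ A ∣)) (F 0 (gaps (suc (∣ A ∣ ℕ.+ p)) (end {n} r)))
      go : Dec (A ⊏ T) → (d : Dec (T ≡ ⊤)) → when (does (inside? A (end r) T)) (F p (gaps ∣ A ∣ (insertEnd d 0 r))) ≡
        step A ⊤ p v T ℤ.+ when (does d) (F p (gaps ∣ A ∣ (end {n} (suc r))))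
      go (no ¬A⊏T) d = trans (when-no (inside? A (end r) T) (λ (A⊏T , _) → ¬A⊏T A⊏T)) (sym (cong₂ ℤ._+_
        (when-zero? (A ⊆? T) (λ A⊆T → when-zero? (T ⊆? ⊤) (λ _ → when-zero? (∣ T ∣ ℕ.≟ _) (λ ∣T∣≡ → contradiction (bigger A⊆T ∣T∣≡) ¬A⊏T))))
        (when-zero? d (λ { refl → contradiction A⊏⊤ ¬A⊏T }))))
      go (yes A⊏T) (yes refl) = trans (when-yes (inside? A (end r) T) (A⊏T , tt)) (sym (zero-+
        (when-zero? (A ⊆? ⊤) (λ _ → when-zero? (⊤ {n} ⊆? ⊤) (λ _ → when-zero? (∣ ⊤ {n} ∣ ℕ.≟ _) (λ ∣T∣≡ → when-no (p <? _) (too-long A⊏⊤ ∣T∣≡)))))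
        refl))
      go (yes A⊏T) (no T≢⊤) = trans (when-yes (inside? A (end r) T) (A⊏T , tt)) (trans
        (step-between A⊏⊤ p (λ a → gaps a (end {n} r)) T A⊏T (⊆-max T , λ ⊤⊆T → T≢⊤ (⊆-antisym (⊆-max T) ⊤⊆T)))
        (sym (ℤ.+-identityʳ _)))

    -- A set above A that is compatible with the chain lies below S, equals S or lies above S. The
    -- three summands are these cases; in the last one only the rest of the chain changes.
    step-cons : ∀ {S} → A ⊏ S → ∀ p m c → Valid S c → ∀ T →
      when (does (inside? A (cons S m c) T)) (F p (gaps ∣ A ∣ (insert T 0 (cons S m c)))) ≡
      step A S p (when (does (p <? ∣ S ∣ ∸ suc ∣ A ∣)) (F 0 (gaps (suc (∣ A ∣ ℕ.+ p)) (cons S m c)))) T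
      ℤ.+ (when (does (T ≟ˢ S)) (F p (gaps ∣ A ∣ (cons S (suc m) c)))
      ℤ.+ when (does (inside? S c T)) (F p (gaps ∣ A ∣ (cons S m (insert T 0 c)))))
    step-cons {S} A⊏S p m c valid T = go (A ⊏? T) (T ≟ˢ S) (T ⊆? S) (S ⊏? T)
      where
      v = when (does (p <? ∣ S ∣ ∸ suc ∣ A ∣)) (F 0 (gaps (suc (∣ A ∣ ℕ.+ p)) (cons S m c)))
      go : Dec (A ⊏ T) → (d : Dec (T ≡ S)) (d′ : Dec (T ⊆ S)) → Dec (S ⊏ T) →
        when (does (inside? A (cons S m c) T)) (F p (gaps ∣ A ∣ (insertCons d d′ 0 m c (insert T 0 c)))) ≡
        step A S p v T ℤ.+ (when (does d) (F p (gaps ∣ A ∣ (cons S (suc m) c)))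
        ℤ.+ when (does (inside? S c T)) (F p (gaps ∣ A ∣ (cons S m (insert T 0 c)))))
      go (no ¬A⊏T) d d′ _ = trans (when-no (inside? A (cons S m c) T) (λ (A⊏T , _) → ¬A⊏T A⊏T)) (sym (zeros-+
        (when-zero? (A ⊆? T) (λ A⊆T → when-zero? (T ⊆? S) (λ _ → when-zero? (∣ T ∣ ℕ.≟ _) (λ ∣T∣≡ → contradiction (bigger A⊆T ∣T∣≡) ¬A⊏T))))
        (when-zero? d (λ { refl → contradiction A⊏S ¬A⊏T }))
        (when-no (inside? S c T) (λ (S⊏T , _) → ¬A⊏T (⊏-trans A⊏S S⊏T)))))
      go (yes A⊏T) (yes refl) d′ _ = trans (when-yes (inside? A (cons S m c) T) (A⊏T , inj₁ (λ e∈ → e∈) , ⊆⇒compatible c valid (λ e∈ → e∈))) (sym (zeros-+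
        (when-zero? (A ⊆? S) (λ _ → when-zero? (S ⊆? S) (λ _ → when-zero? (∣ S ∣ ℕ.≟ _) (λ ∣T∣≡ → when-no (p <? _) (too-long A⊏S ∣T∣≡)))))
        refl
        (when-no (inside? S c S) (λ ((_ , S⊈S) , _) → S⊈S (λ e∈ → e∈)))))
      go (yes A⊏T) (no T≢S) (yes T⊆S) _ = trans (when-yes (inside? A (cons S m c) T) (A⊏T , inj₁ T⊆S , ⊆⇒compatible c valid T⊆S)) (sym (+-zeros
        (sym (step-between A⊏S p (λ a → gaps a (cons S m c)) T A⊏T (T⊆S , λ S⊆T → T≢S (⊆-antisym T⊆S S⊆T))))
        refl
        (when-no (inside? S c T) (λ ((_ , T⊈S) , _) → T⊈S T⊆S))))
      go (yes A⊏T) (no T≢S) (no T⊈S) (yes S⊏T) = sym (zeros-zeros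
        (when-zero? (A ⊆? T) (λ _ → when-no (T ⊆? S) T⊈S))
        refl
        (cong (λ b → when b (F p (gaps ∣ A ∣ (cons S m (insert T 0 c))))) (does-⇔ (mk⇔ to from) (inside? S c T) (inside? A (cons S m c) T))))
        where
        to : Inside S c T → Inside A (cons S m c) T
        to ((S⊆T , _) , compat) = A⊏T , inj₂ S⊆T , compat
        from : Inside A (cons S m c) T → Inside S c T
        from (_ , _ , compat) = S⊏T , compat
      go (yes A⊏T) (no T≢S) (no T⊈S) (no ¬S⊏T) = trans
        (when-no (inside? A (cons S m c) T) (λ { (_ , inj₁ T⊆S , _) → T⊈S T⊆S ; (_ , inj₂ S⊆T , _) → ¬S⊏T (S⊆T , T⊈S) }))
        (sym (zeros-+ (when-zero? (A ⊆? T) (λ _ → when-no (T ⊆? S) T⊈S)) refl (when-no (inside? S c T) (λ (S⊏T , _) → ¬S⊏T S⊏T))))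

  private
    shorten : ∀ s a p → s ∸ suc (suc (a ℕ.+ p)) ≡ s ∸ suc a ∸ suc p
    shorten s a p = sym (trans (ℕ.∸-+-assoc s (suc a) (suc p)) (cong (λ v → s ∸ suc v) (ℕ.+-suc a p)))

    first-end : ∀ n a p r → F 0 (gaps (suc (a ℕ.+ p)) (end {n} r)) ≡ F 0 (end (n ∸ suc a ∸ suc p) r)
    first-end n a p r = cong (λ j → F 0 (end j r)) (shorten n a p)

    first-cons : ∀ {n} (S : Subset n) a p m c → F 0 (gaps (suc (a ℕ.+ p)) (cons S m c)) ≡ F 0 (cons (∣ S ∣ ∸ suc a ∸ suc p) m (gaps ∣ S ∣ c))
    first-cons S a p m c = cong (λ j → F 0 (cons j m (gaps ∣ S ∣ c))) (shorten ∣ S ∣ a p)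

    ∑-scale : ∀ {n} (q : Subset n → Bool) a b d (f : Subset n → ℤ) → ∑ (subsets n) (λ T → when (q T) (a ℤ.* (b ℤ.* (d ℤ.* f T)))) ≡
      a ℤ.* (b ℤ.* (d ℤ.* ∑ (subsets n) (λ T → when (q T) (f T))))
    ∑-scale {n} q a b d f = trans (∑-when-*ˡ a (subsets n) q (λ T → b ℤ.* (d ℤ.* f T))) (cong (ℤ._*_ a)
      (trans (∑-when-*ˡ b (subsets n) q (λ T → d ℤ.* f T)) (cong (ℤ._*_ b) (∑-when-*ˡ d (subsets n) q f))))

  insertion : ∀ {n} → ℕ → Subset n → Chain n → Subset n → ℤ
  insertion p A c T = when (does (inside? A c T)) (F p (gaps ∣ A ∣ (insert T 0 c)))

  first-end-value : ∀ {n} → Subset n → ℕ → ℕ → ℤ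
  first-end-value {n} A p r = when (does (p <? ∣ ⊤ {n} ∣ ∸ suc ∣ A ∣)) (F 0 (gaps (suc (∣ A ∣ ℕ.+ p)) (end {n} r)))

  first-cons-value : ∀ {n} → Subset n → Subset n → ℕ → ℕ → Chain n → ℤ
  first-cons-value A S p m c = when (does (p <? ∣ S ∣ ∸ suc ∣ A ∣)) (F 0 (gaps (suc (∣ A ∣ ℕ.+ p)) (cons S m c)))

  -- For the factors above A, multiplication by the sum of all x_T with T strictly above A acts like
  -- raising the excess at A by one. A factor x_T above S changes only the rest of the chain, where
  -- the induction hypothesis raises the excess at S; `gap-cons` adds up the three cases.
  ∑-insertion : ∀ {n} (A : Subset n) c → Valid A c → ∀ p → ∑ (subsets n) (insertion p A c) ≡ F (suc p) (gaps ∣ A ∣ c)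
  ∑-insertion {n} A (end r) A⊏⊤ p = begin
    ∑ (subsets n) (insertion p A (end r))
      ≡⟨ ∑-split₂ (subsets n) (step A ⊤ p v) (λ T → when (does (T ≟ˢ ⊤)) (F p (end j (suc r)))) (step-end A⊏⊤ p r)
           (∑-step A⊏⊤ p v) (∑-pick (⊤ {n}) (λ _ → F p (end j (suc r)))) ⟩
    B (suc (∣ ⊤ {n} ∣ ∸ suc ∣ A ∣)) (suc p) ℤ.* v ℤ.+ F p (end j (suc r))
      ≡⟨ cong₂ (λ s v → B (suc (s ∸ suc ∣ A ∣)) (suc p) ℤ.* when (does (p <? s ∸ suc ∣ A ∣)) v ℤ.+ F p (end j (suc r)))
           (∣⊤∣≡n n) (first-end n ∣ A ∣ p r) ⟩
    B (suc j) (suc p) ℤ.* when (does (p <? j)) (F 0 (end (j ∸ suc p) r)) ℤ.+ F p (end j (suc r))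
      ≡⟨ gap-end p j r ⟩
    F (suc p) (end j r) ∎
    where
    j = n ∸ suc ∣ A ∣
    v = first-end-value A p r
  ∑-insertion {n} A (cons S m c) (A⊏S , valid) p = begin
    ∑ (subsets n) (insertion p A (cons S m c))
      ≡⟨ ∑-split₃ (subsets n) (step A S p v) (λ T → when (does (T ≟ˢ S)) u) (λ T → when (does (inside? S c T)) (scale (f T)))
           (step-cons A⊏S p m c valid)
           (trans (∑-step A⊏S p v) (cong (λ v → B (suc j) (suc p) ℤ.* when (does (p <? j)) v) (first-cons S ∣ A ∣ p m c)))
           (∑-pick S (λ _ → u))
           (trans (∑-scale (λ T → does (inside? S c T)) (B j p) (sgn m) (B m (j ∸ p)) f) (cong scale (∑-insertion S c valid p′))) ⟩
    B (suc j) (suc p) ℤ.* when (does (p <? j)) (F 0 (cons (j ∸ suc p) m c′)) ℤ.+ (u ℤ.+ tail p j m c′)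
      ≡⟨ gap-cons p j m c′ ⟩
    F (suc p) (cons j m c′) ∎
    where
    j = ∣ S ∣ ∸ suc ∣ A ∣
    c′ = gaps ∣ S ∣ c
    p′ = m ∸ (j ∸ p)
    v = first-cons-value A S p m c
    u = F p (cons j (suc m) c′)
    f : Subset n → ℤ
    f T = F p′ (gaps ∣ S ∣ (insert T 0 c))
    scale : ℤ → ℤ
    scale v = B j p ℤ.* (sgn m ℤ.* (B m (j ∸ p) ℤ.* v))

  -- This is the vanishing of the degree on x^d Σ_{T ∋ e} x_T, by the first gap of the chain containing e.
  ∑-insertion-∈ : ∀ {n} e (A : Subset n) c → e ∉ A → Valid A c → ∀ p →
    ∑ (subsets n) (λ T → when (does (e ∈? T)) (insertion p A c T)) ≡ 0ℤ
  ∑-insertion-∈ {n} e A (end r) e∉A A⊏⊤ p = begin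
    ∑ (subsets n) (λ T → when (does (e ∈? T)) (insertion p A (end r) T))
      ≡⟨ ∑-split₂ (subsets n) (λ T → when (does (e ∈? T)) (step A ⊤ p v T)) (λ T → when (does (e ∈? T)) (when (does (T ≟ˢ ⊤)) u))
           (λ T → trans (cong (when (does (e ∈? T))) (step-end A⊏⊤ p r T)) (when-+ (does (e ∈? T)) (step A ⊤ p v T) (when (does (T ≟ˢ ⊤)) u)))
           (∑-step-∈ A⊏⊤ ∈⊤ e∉A p v)
           (trans (∑-cong (subsets n) (λ T → when-swap (does (e ∈? T)) (does (T ≟ˢ ⊤)) u))
             (trans (∑-pick ⊤ (λ T → when (does (e ∈? T)) u)) (when-yes (e ∈? ⊤) ∈⊤))) ⟩
    B (∣ ⊤ {n} ∣ ∸ suc ∣ A ∣) p ℤ.* v ℤ.+ u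
      ≡⟨ cong₂ (λ s v → B (s ∸ suc ∣ A ∣) p ℤ.* when (does (p <? s ∸ suc ∣ A ∣)) v ℤ.+ u) (∣⊤∣≡n n) (first-end n ∣ A ∣ p r) ⟩
    B j p ℤ.* when (does (p <? j)) (F 0 (end (j ∸ suc p) r)) ℤ.+ u
      ≡⟨ gap-end′ p j r ⟩
    0ℤ ∎
    where
    j = n ∸ suc ∣ A ∣
    v = first-end-value A p r
    u = F p (end j (suc r))
  ∑-insertion-∈ {n} e A (cons S m c) e∉A (A⊏S , valid) p = trans
    (∑-split₃ (subsets n) (λ T → when (does (e ∈? T)) (step A S p v T)) (λ T → when (does (e ∈? T)) (when (does (T ≟ˢ S)) u))
      (λ T → when (does (e ∈? T)) (when (does (inside? S c T)) (scale (f T))))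
      (λ T → trans (cong (when (does (e ∈? T))) (step-cons A⊏S p m c valid T))
        (trans (when-+ (does (e ∈? T)) (step A S p v T) (when (does (T ≟ˢ S)) u ℤ.+ when (does (inside? S c T)) (scale (f T))))
               (cong (ℤ._+_ (when (does (e ∈? T)) (step A S p v T)))
                 (when-+ (does (e ∈? T)) (when (does (T ≟ˢ S)) u) (when (does (inside? S c T)) (scale (f T)))))))
      refl
      (trans (∑-cong (subsets n) (λ T → when-swap (does (e ∈? T)) (does (T ≟ˢ S)) u)) (∑-pick S (λ T → when (does (e ∈? T)) u)))
      third)
    (by-cases (e ∈? S))
    where
    j = ∣ S ∣ ∸ suc ∣ A ∣
    c′ = gaps ∣ S ∣ c
    p′ = m ∸ (j ∸ p)
    v = first-cons-value A S p m c
    u = F p (cons j (suc m) c′)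
    f : Subset n → ℤ
    f T = F p′ (gaps ∣ S ∣ (insert T 0 c))
    scale : ℤ → ℤ
    scale v = B j p ℤ.* (sgn m ℤ.* (B m (j ∸ p) ℤ.* v))

    scale-0 : scale 0ℤ ≡ 0ℤ
    scale-0 = lemma (B j p) (sgn m) (B m (j ∸ p))
      where
      lemma : ∀ a b d → a ℤ.* (b ℤ.* (d ℤ.* 0ℤ)) ≡ 0ℤ
      lemma = solve-∀

    third : ∑ (subsets n) (λ T → when (does (e ∈? T)) (when (does (inside? S c T)) (scale (f T)))) ≡
      scale (∑ (subsets n) (λ T → when (does (e ∈? T)) (insertion p′ S c T)))
    third = begin
      ∑ (subsets n) (λ T → when (does (e ∈? T)) (when (does (inside? S c T)) (scale (f T))))
        ≡⟨ ∑-cong (subsets n) (λ T → when-∧ (does (e ∈? T)) (does (inside? S c T)) (scale (f T))) ⟩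
      ∑ (subsets n) (λ T → when (does (e ∈? T) ∧ does (inside? S c T)) (scale (f T)))
        ≡⟨ ∑-scale (λ T → does (e ∈? T) ∧ does (inside? S c T)) (B j p) (sgn m) (B m (j ∸ p)) f ⟩
      scale (∑ (subsets n) (λ T → when (does (e ∈? T) ∧ does (inside? S c T)) (f T)))
        ≡⟨ cong scale (∑-cong (subsets n) (λ T → when-∧ (does (e ∈? T)) (does (inside? S c T)) (f T))) ⟨
      scale (∑ (subsets n) (λ T → when (does (e ∈? T)) (insertion p′ S c T))) ∎

    by-cases : (d : Dec (e ∈ S)) → ∑ (subsets n) (λ T → when (does (e ∈? T)) (step A S p v T)) ℤ.+
      (when (does d) u ℤ.+ scale (∑ (subsets n) (λ T → when (does (e ∈? T)) (insertion p′ S c T)))) ≡ 0ℤ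
    -- No set below S contains e, so only the sets above S contribute, and the induction continues
    -- there.
    by-cases (no e∉S) = zeros-+
      (∑-zero (subsets n) (λ T → when-zero? (e ∈? T) (λ e∈T → when-zero? (A ⊆? T) (λ _ → when-no (T ⊆? S) (λ T⊆S → e∉S (T⊆S e∈T))))))
      refl (trans (cong scale (∑-insertion-∈ e S c e∉S valid p′)) scale-0)
    -- Every set above S contains e already, so the sum there is unrestricted and equal to
    -- `∑-insertion`; the condition affects only the count within the first gap.
    by-cases (yes e∈S) = trans
      (cong₂ (λ a b → a ℤ.+ (u ℤ.+ scale b))
        (trans (∑-step-∈ A⊏S e∈S e∉A p v) (cong (λ v → B j p ℤ.* when (does (p <? j)) v) (first-cons S ∣ A ∣ p m c)))
        (trans (∑-cong (subsets n) redundant) (∑-insertion S c valid p′)))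
      (gap-cons′ p j m c′)
      where
      redundant : ∀ T → when (does (e ∈? T)) (insertion p′ S c T) ≡ insertion p′ S c T
      redundant T = trans (when-swap (does (e ∈? T)) (does (inside? S c T)) (f T))
        (when-cong? (inside? S c T) (λ ((S⊆T , _) , _) → when-yes (e ∈? T) (S⊆T e∈S)))

-- The volume as a function of the exponents by size.

module ℕSums = Sums ℕ.+-*-commutativeSemiring

-- F in terms of the vector of all exponents, for the sizes that follow; j is the number of sizes passed since the
-- last chain element.
G : ∀ k → ℕ → ℕ → Mon (suc k) → ℤ
G-head : ∀ k → ℕ → ℕ → ℕ → Mon (suc k) → ℤ

G zero    j p t = B j p ℤ.* (sgn (t Fin.zero) ℤ.* ℤSums.when (does (t Fin.zero ℕ.≟ j ∸ p)) 1ℤ)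
G (suc k) j p t = G-head k j p (t Fin.zero) (t ∘ Fin.suc)

G-head k j p zero    t = G k (suc j) p t
G-head k j p (suc m) t = B j p ℤ.* (sgn m ℤ.* (B m (j ∸ p) ℤ.* G k 0 (m ∸ (j ∸ p)) t))

G-cong : ∀ k j p {t t′} → t ≐ t′ → G k j p t ≡ G k j p t′
G-cong zero    j p e = cong (λ v → B j p ℤ.* (sgn v ℤ.* ℤSums.when (does (v ℕ.≟ j ∸ p)) 1ℤ)) (e Fin.zero)
G-cong (suc k) j p {t} {t′} e = trans (cong (λ v → G-head k j p v (t ∘ Fin.suc)) (e Fin.zero)) (head (t′ Fin.zero))
  where
  head : ∀ v → G-head k j p v (t ∘ Fin.suc) ≡ G-head k j p v (t′ ∘ Fin.suc)
  head zero    = G-cong k (suc j) p (e ∘ Fin.suc)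
  head (suc m) = cong (λ v → B j p ℤ.* (sgn m ℤ.* (B m (j ∸ p) ℤ.* v))) (G-cong k 0 (m ∸ (j ∸ p)) (e ∘ Fin.suc))

-- The degree of a monomial supported on a chain, which depends only on the exponent at each size.
-- For n = 0 there are no variables, and 1 has degree 1.
vol : ∀ n → Mon n → ℤ
vol zero    t = 1ℤ
vol (suc k) t = G k 0 0 t

vol-cong : ∀ n {t t′ : Mon n} → t ≐ t′ → vol n t ≡ vol n t′
vol-cong zero    e = refl
vol-cong (suc k) e = G-cong k 0 0 e

G-skip : ∀ q k i p (τ : ℕ → ℕ) → (∀ l → l ℕ.< q → τ l ≡ 0) →
  G (q ℕ.+ k) i p (τ ∘ Fin.toℕ) ≡ G k (q ℕ.+ i) p (λ f → τ (q ℕ.+ Fin.toℕ f))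
G-skip zero    k i p τ τ≡0 = refl
G-skip (suc q) k i p τ τ≡0 = trans (cong (λ v → G-head (q ℕ.+ k) i p v (τ ∘ suc ∘ Fin.toℕ)) (τ≡0 0 (s≤s z≤n)))
  (trans (G-skip q k (suc i) p (τ ∘ suc) (λ l l<q → τ≡0 (suc l) (s≤s l<q)))
         (cong (λ j → G k j p (λ f → τ (suc q ℕ.+ Fin.toℕ f))) (ℕ.+-suc q i)))

exponentOf : ∀ {n} → Chain n → Subset n → ℕ
exponentOf (end r)      S = ℕSums.when (does (S ≟ˢ ⊤)) r
exponentOf (cons T m c) S = ℕSums.when (does (S ≟ˢ T)) (suc m) ℕ.+ exponentOf c S

exponentAt : ∀ {n} → Chain n → ℕ → ℕ
exponentAt {n} (end r)      l = ℕSums.when (does (n ℕ.≟ l)) r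
exponentAt     (cons T m c) l = ℕSums.when (does (∣ T ∣ ℕ.≟ l)) (suc m) ℕ.+ exponentAt c l

⊏⇒< : ∀ {n} {S T : Subset n} → S ⊏ T → ∣ S ∣ ℕ.< ∣ T ∣
⊏⇒< (S⊆T , T⊈S) = ⊆∧⊉⇒∣∣< S⊆T T⊈S

⊏⊤⇒< : ∀ {n} {S : Subset n} → S ⊏ ⊤ → ∣ S ∣ ℕ.< n
⊏⊤⇒< {n} S⊏⊤ = ℕ.≤-trans (⊏⇒< S⊏⊤) (ℕ.≤-reflexive (∣⊤∣≡n n))

exponentAt-low : ∀ {n} (A : Subset n) c → Valid A c → ∀ l → l ℕ.≤ ∣ A ∣ → exponentAt c l ≡ 0
exponentAt-low {n} A (end r)      A⊏⊤           l l≤ = ℕSums.when-no (n ℕ.≟ l) (ℕ.>⇒≢ (ℕ.≤-trans (s≤s l≤) (⊏⊤⇒< A⊏⊤)))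
exponentAt-low     A (cons T m c) (A⊏T , valid) l l≤ = cong₂ ℕ._+_
  (ℕSums.when-no (∣ T ∣ ℕ.≟ l) (ℕ.>⇒≢ (ℕ.≤-trans (s≤s l≤) (⊏⇒< A⊏T))))
  (exponentAt-low T c valid l (ℕ.<⇒≤ (ℕ.≤-trans (s≤s l≤) (⊏⇒< A⊏T))))

valid⇒< : ∀ {n} (A : Subset n) c → Valid A c → ∣ A ∣ ℕ.< n
valid⇒< A (end r)      A⊏⊤           = ⊏⊤⇒< A⊏⊤
valid⇒< A (cons T m c) (A⊏T , valid) = ℕ.<-trans (⊏⇒< A⊏T) (valid⇒< T c valid)

-- The sizes strictly inside a gap carry exponent 0 and only lengthen the gap, so reading the vector
-- of exponents size by size meets the chain elements in order.
G-chain : ∀ {n} (A : Subset n) c → Valid A c → ∀ k → suc (∣ A ∣ ℕ.+ k) ≡ n → ∀ p →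
  G k 0 p (λ f → exponentAt c (suc ∣ A ∣ ℕ.+ Fin.toℕ f)) ≡ F p (gaps ∣ A ∣ c)
G-chain {n} A (end r) A⊏⊤ k eq p = begin
  G k 0 p (τ ∘ Fin.toℕ)                             ≡⟨ cong (λ v → G v 0 p (τ ∘ Fin.toℕ)) (sym (ℕ.+-identityʳ k)) ⟩
  G (k ℕ.+ 0) 0 p (τ ∘ Fin.toℕ)                     ≡⟨ G-skip k 0 0 p τ (λ l l<k → ℕSums.when-no (n ℕ.≟ _) (λ n≡ →
                                                         ℕ.<⇒≢ (ℕ.+-monoʳ-< (suc ∣ A ∣) l<k) (trans (sym n≡) (sym eq)))) ⟩
  G 0 (k ℕ.+ 0) p (λ f → τ (k ℕ.+ Fin.toℕ f))       ≡⟨ cong₂ (λ j v → F p (end j v)) k+0≡ (ℕSums.when-yes (n ℕ.≟ _) (trans (sym eq) (cong (suc ∘ (∣ A ∣ ℕ.+_)) (sym (ℕ.+-identityʳ k))))) ⟩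
  F p (end (n ∸ suc ∣ A ∣) r)                       ∎
  where
  open ≡.≡-Reasoning
  τ : ℕ → ℕ
  τ l = exponentAt (end {n} r) (suc ∣ A ∣ ℕ.+ l)
  k+0≡ : k ℕ.+ 0 ≡ n ∸ suc ∣ A ∣
  k+0≡ = trans (ℕ.+-identityʳ k) (sym (trans (cong (_∸ suc ∣ A ∣) (sym eq)) (ℕ.m+n∸m≡n (suc ∣ A ∣) k)))
G-chain {n} A (cons T m c) (A⊏T , valid) k eq p = begin
  G k 0 p (τ ∘ Fin.toℕ)
    ≡⟨ cong (λ v → G v 0 p (τ ∘ Fin.toℕ)) k≡ ⟩
  G (j ℕ.+ suc k′) 0 p (τ ∘ Fin.toℕ)
    ≡⟨ G-skip j (suc k′) 0 p τ (λ l l<j → cong₂ ℕ._+_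
         (ℕSums.when-no (∣ T ∣ ℕ.≟ _) (ℕ.>⇒≢ (ℕ.≤-trans (ℕ.+-monoʳ-< (suc ∣ A ∣) l<j) (ℕ.≤-reflexive (sym ∣T∣≡)))))
         (exponentAt-low T c valid _ (ℕ.≤-trans (ℕ.<⇒≤ (ℕ.+-monoʳ-< (suc ∣ A ∣) l<j)) (ℕ.≤-reflexive (sym ∣T∣≡))))) ⟩
  G-head k′ (j ℕ.+ 0) p (τ (j ℕ.+ 0)) (λ f → τ (j ℕ.+ suc (Fin.toℕ f)))
    ≡⟨ cong₂ (λ i v → G-head k′ i p v (λ f → τ (j ℕ.+ suc (Fin.toℕ f)))) (ℕ.+-identityʳ j)
         (trans (cong₂ ℕ._+_ (ℕSums.when-yes (∣ T ∣ ℕ.≟ _) ∣T∣≡′) (exponentAt-low T c valid _ (ℕ.≤-reflexive (sym ∣T∣≡′)))) (ℕ.+-identityʳ _)) ⟩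
  G-head k′ j p (suc m) (λ f → τ (j ℕ.+ suc (Fin.toℕ f)))
    ≡⟨ cong (λ v → B j p ℤ.* (sgn m ℤ.* (B m (j ∸ p) ℤ.* v))) (trans (G-cong k′ 0 (m ∸ (j ∸ p)) later) (G-chain T c valid k′ k′≡ (m ∸ (j ∸ p)))) ⟩
  F p (gaps ∣ A ∣ (cons T m c)) ∎
  where
  open ≡.≡-Reasoning
  τ : ℕ → ℕ
  τ l = exponentAt (cons T m c) (suc ∣ A ∣ ℕ.+ l)
  j = ∣ T ∣ ∸ suc ∣ A ∣
  k′ = n ∸ suc ∣ T ∣
  k′≡ : suc (∣ T ∣ ℕ.+ k′) ≡ n
  k′≡ = ℕ.m+[n∸m]≡n (valid⇒< T c valid)
  ∣T∣≡ : ∣ T ∣ ≡ suc ∣ A ∣ ℕ.+ j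
  ∣T∣≡ = trans (⊏⇒∣∣ A⊏T) (ℕ.+-suc ∣ A ∣ j)
  ∣T∣≡′ : ∣ T ∣ ≡ suc ∣ A ∣ ℕ.+ (j ℕ.+ 0)
  ∣T∣≡′ = trans ∣T∣≡ (cong (suc ∣ A ∣ ℕ.+_) (sym (ℕ.+-identityʳ j)))
  k≡ : k ≡ j ℕ.+ suc k′
  k≡ = ℕ.+-cancelˡ-≡ (suc ∣ A ∣) _ _ (trans eq (trans (sym k′≡) (trans (cong (λ v → suc (v ℕ.+ k′)) ∣T∣≡)
    (sym (trans (sym (ℕ.+-assoc (suc ∣ A ∣) j (suc k′))) (ℕ.+-suc (suc ∣ A ∣ ℕ.+ j) k′))))))
  later : (λ f → τ (j ℕ.+ suc (Fin.toℕ f))) ≐ (λ f → exponentAt c (suc ∣ T ∣ ℕ.+ Fin.toℕ f))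
  later f = trans (cong (ℕ._+ exponentAt c (suc ∣ A ∣ ℕ.+ (j ℕ.+ suc (Fin.toℕ f)))) (ℕSums.when-no (∣ T ∣ ℕ.≟ suc ∣ A ∣ ℕ.+ (j ℕ.+ suc (Fin.toℕ f))) (λ ∣T∣≡ → ℕ.m≢1+m+n ∣ T ∣ (trans ∣T∣≡ index≡))))
                  (cong (exponentAt c) index≡)
    where
    index≡ : suc ∣ A ∣ ℕ.+ (j ℕ.+ suc (Fin.toℕ f)) ≡ suc ∣ T ∣ ℕ.+ Fin.toℕ f
    index≡ = trans (sym (ℕ.+-assoc (suc ∣ A ∣) j _)) (trans (ℕ.+-suc _ (Fin.toℕ f)) (cong (λ v → suc (v ℕ.+ Fin.toℕ f)) (sym ∣T∣≡)))

-- The degree functional and its vanishing on the relations.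

module _ (n : ℕ) where
  open ℕSums
  open SubsetSums ℕ.+-*-commutativeSemiring
  open SetSums ℕ.+-*-commutativeSemiring
  open ≡.≡-Reasoning

  type : Mon (N n) → Mon n
  type d i = ∑ (List.allFin (N n)) (λ s → when (does (∣ setOf n s ∣ ℕ.≟ suc (Fin.toℕ i))) (d s))

  Represents : Chain n → Mon (N n) → Set
  Represents c d = ∀ s → d s ≡ exponentOf c (setOf n s)

  ∑-exponentOf : ∀ c l → ∑ (subsets n) (λ S → when (does (∣ S ∣ ℕ.≟ l)) (exponentOf c S)) ≡ exponentAt c l
  ∑-exponentOf (end r)      l = begin
    ∑ (subsets n) (λ S → when (does (∣ S ∣ ℕ.≟ l)) (when (does (S ≟ˢ ⊤)) r))
      ≡⟨ ∑-cong (subsets n) (λ S → when-swap (does (∣ S ∣ ℕ.≟ l)) (does (S ≟ˢ ⊤)) r) ⟩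
    ∑ (subsets n) (λ S → when (does (S ≟ˢ ⊤)) (when (does (∣ S ∣ ℕ.≟ l)) r))
      ≡⟨ ∑-pick (⊤ {n}) (λ S → when (does (∣ S ∣ ℕ.≟ l)) r) ⟩
    when (does (∣ ⊤ {n} ∣ ℕ.≟ l)) r
      ≡⟨ cong (λ s → when (does (s ℕ.≟ l)) r) (∣⊤∣≡n n) ⟩
    when (does (n ℕ.≟ l)) r ∎
  ∑-exponentOf (cons T m c) l = ∑-split₂ (subsets n) (λ S → when (does (∣ S ∣ ℕ.≟ l)) (when (does (S ≟ˢ T)) (suc m)))
    (λ S → when (does (∣ S ∣ ℕ.≟ l)) (exponentOf c S))
    (λ S → when-+ (does (∣ S ∣ ℕ.≟ l)) (when (does (S ≟ˢ T)) (suc m)) (exponentOf c S))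
    (trans (∑-cong (subsets n) (λ S → when-swap (does (∣ S ∣ ℕ.≟ l)) (does (S ≟ˢ T)) (suc m)))
           (∑-pick T (λ S → when (does (∣ S ∣ ℕ.≟ l)) (suc m))))
    (∑-exponentOf c l)

  type-represented : ∀ c {d} → Represents c d → type d ≐ (λ i → exponentAt c (suc (Fin.toℕ i)))
  type-represented c {d} rep i = begin
    type d i
      ≡⟨ ∑-cong (List.allFin (N n)) (λ s → cong (when (does (∣ setOf n s ∣ ℕ.≟ suc (Fin.toℕ i)))) (rep s)) ⟩
    ∑ (List.allFin (N n)) (λ s → when (does (∣ setOf n s ∣ ℕ.≟ suc (Fin.toℕ i))) (exponentOf c (setOf n s)))
      ≡⟨ ∑-setOf-when n (λ S → ∣ S ∣ ℕ.≟ suc (Fin.toℕ i)) ∣∣>0⇒nonempty (exponentOf c) ⟩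
    ∑ (subsets n) (λ S → when (does (∣ S ∣ ℕ.≟ suc (Fin.toℕ i))) (exponentOf c S))
      ≡⟨ ∑-exponentOf c (suc (Fin.toℕ i)) ⟩
    exponentAt c (suc (Fin.toℕ i)) ∎

  type-cong : ∀ {d d′} → d ≐ d′ → type d ≐ type d′
  type-cong e i = ∑-cong (List.allFin (N n)) (λ s → cong (when (does (∣ setOf n s ∣ ℕ.≟ suc (Fin.toℕ i)))) (e s))

  type-⊕ : ∀ d d′ → type (d ⊕ d′) ≐ (type d ⊕ type d′)
  type-⊕ d d′ i = trans (∑-cong (List.allFin (N n)) (λ s → when-+ (does (∣ setOf n s ∣ ℕ.≟ suc (Fin.toℕ i))) (d s) (d′ s)))
                        (∑-+ (List.allFin (N n)) _ _)

  ChainSupported : Mon (N n) → Set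
  ChainSupported d = ∀ s t → d s ≢ 0 → d t ≢ 0 → Comparable (setOf n s) (setOf n t)

  chainSupported? : ∀ d → Dec (ChainSupported d)
  chainSupported? d = Fin.all? λ s → Fin.all? λ t → ¬? (d s ℕ.≟ 0) →-dec ¬? (d t ℕ.≟ 0) →-dec comparable? (setOf n s) (setOf n t)

  -- Defined without choosing a chain, from the support and the type alone, so that it visibly
  -- respects `≐`; `represent` provides a chain where the recursive formula is wanted.
  degree : Mon (N n) → ℤ
  degree d = ℤSums.when (does (chainSupported? d)) (vol n (type d))

  degree-resp : ℤLin.Resp degree
  degree-resp {d} {d′} e = cong₂ ℤSums.when
    (does-⇔ (mk⇔ (λ p s t ds dt → p s t (ds ∘ trans (sym (e s))) (dt ∘ trans (sym (e t))))
                  (λ p s t ds dt → p s t (ds ∘ trans (e s)) (dt ∘ trans (e t)))) (chainSupported? d) (chainSupported? d′))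
    (vol-cong n (type-cong e))

  exponentOf≢0⇒⊏ : ∀ (A : Subset n) c → Valid A c → ∀ S → exponentOf c S ≢ 0 → A ⊏ S
  exponentOf≢0⇒⊏ A (end r) A⊏⊤ S ≢0 with S ≟ˢ ⊤
  ... | yes refl = A⊏⊤
  ... | no  S≢⊤  = contradiction refl ≢0
  exponentOf≢0⇒⊏ A (cons T m c) (A⊏T , valid) S ≢0 with S ≟ˢ T
  ... | yes refl = A⊏T
  ... | no  S≢T  = ⊏-trans A⊏T (exponentOf≢0⇒⊏ T c valid S ≢0)

  exponentOf≢0⇒comparable : ∀ (A : Subset n) c → Valid A c → ∀ S T → exponentOf c S ≢ 0 → exponentOf c T ≢ 0 → Comparable S T
  exponentOf≢0⇒comparable A (end r) _ S T S≢0 T≢0 with T ≟ˢ ⊤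
  ... | yes refl = inj₁ (⊆-max S)
  ... | no  T≢⊤  = contradiction refl T≢0
  exponentOf≢0⇒comparable A (cons U m c) (A⊏U , valid) S T S≢0 T≢0 with S ≟ˢ U | T ≟ˢ U
  ... | yes refl | yes refl = inj₁ (λ e → e)
  ... | yes refl | no  T≢U  = inj₁ (proj₁ (exponentOf≢0⇒⊏ S c valid T T≢0))
  ... | no  S≢U  | yes refl = inj₂ (proj₁ (exponentOf≢0⇒⊏ T c valid S S≢0))
  ... | no  S≢U  | no  T≢U  = exponentOf≢0⇒comparable U c valid S T S≢0 T≢0

  represented⇒chainSupported : ∀ (A : Subset n) c {d} → Valid A c → Represents c d → ChainSupported d
  represented⇒chainSupported A c valid rep s t s≢0 t≢0 =
    exponentOf≢0⇒comparable A c valid (setOf n s) (setOf n t) (s≢0 ∘ trans (rep s)) (t≢0 ∘ trans (rep t))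

  insert-valid : ∀ (A : Subset n) T k c → Valid A c → A ⊏ T → Compatible T c → Valid A (insert T k c)
  insert-valid A T k (end r) A⊏⊤ A⊏T _ with T ≟ˢ ⊤
  ... | yes _  = A⊏⊤
  ... | no T≢⊤ = A⊏T , ⊆-max T , λ ⊤⊆T → T≢⊤ (⊆-antisym (⊆-max T) ⊤⊆T)
  insert-valid A T k (cons S m c) (A⊏S , valid) A⊏T (comp , compat) with T ≟ˢ S | T ⊆? S
  ... | yes _  | _       = A⊏S , valid
  ... | no T≢S | yes T⊆S = A⊏T , (T⊆S , λ S⊆T → T≢S (⊆-antisym T⊆S S⊆T)) , valid
  ... | no T≢S | no T⊈S  = A⊏S , insert-valid S T k c valid (S⊆T comp , T⊈S) compat
    where
    S⊆T : Comparable T S → S ⊆ T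
    S⊆T (inj₁ T⊆S) = contradiction (λ {e} → T⊆S {e}) T⊈S
    S⊆T (inj₂ S⊆T) = S⊆T

  insert-exponentOf : ∀ (T : Subset n) k c S → exponentOf (insert T k c) S ≡ when (does (S ≟ˢ T)) (suc k) ℕ.+ exponentOf c S
  insert-exponentOf T k (end r) S with T ≟ˢ ⊤
  ... | yes refl = when-+ (does (S ≟ˢ ⊤)) (suc k) r
  ... | no _     = refl
  insert-exponentOf T k (cons U m c) S with T ≟ˢ U | T ⊆? U
  ... | no _     | yes _ = refl
  ... | yes refl | _     = begin
    when (does (S ≟ˢ T)) (suc (suc (k ℕ.+ m))) ℕ.+ exponentOf c S
      ≡⟨ cong (λ v → when (does (S ≟ˢ T)) v ℕ.+ exponentOf c S) (cong suc (sym (ℕ.+-suc k m))) ⟩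
    when (does (S ≟ˢ T)) (suc k ℕ.+ suc m) ℕ.+ exponentOf c S
      ≡⟨ cong (ℕ._+ exponentOf c S) (when-+ (does (S ≟ˢ T)) (suc k) (suc m)) ⟩
    when (does (S ≟ˢ T)) (suc k) ℕ.+ when (does (S ≟ˢ T)) (suc m) ℕ.+ exponentOf c S
      ≡⟨ ℕ.+-assoc (when (does (S ≟ˢ T)) (suc k)) _ _ ⟩
    when (does (S ≟ˢ T)) (suc k) ℕ.+ (when (does (S ≟ˢ T)) (suc m) ℕ.+ exponentOf c S) ∎
  ... | no _     | no _  = trans (cong (when (does (S ≟ˢ U)) (suc m) ℕ.+_) (insert-exponentOf T k c S))
    (+-left-comm (when (does (S ≟ˢ U)) (suc m)) (when (does (S ≟ˢ T)) (suc k)) (exponentOf c S))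
    where
    +-left-comm : ∀ a b c → a ℕ.+ (b ℕ.+ c) ≡ b ℕ.+ (a ℕ.+ c)
    +-left-comm a b c = trans (sym (ℕ.+-assoc a b c)) (trans (cong (ℕ._+ c) (ℕ.+-comm a b)) (ℕ.+-assoc b a c))

  insert-compatible : ∀ (U : Subset n) T k c → Compatible U c → Comparable U T → Compatible U (insert T k c)
  insert-compatible U T k (end r) _ comp with T ≟ˢ ⊤
  ... | yes _ = tt
  ... | no _  = comp , tt
  insert-compatible U T k (cons S m c) (compS , compat) comp with T ≟ˢ S | T ⊆? S
  ... | yes _ | _     = compS , compat
  ... | no _  | yes _ = comp , compS , compat
  ... | no _  | no _  = compS , insert-compatible U T k c compat comp

nonempty⇒⊥⊏ : ∀ {n} {S : Subset n} → Nonempty S → ⊥ ⊏ S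
nonempty⇒⊥⊏ {S = S} (e , e∈S) = ⊆-min S , λ S⊆⊥ → ∉⊥ (S⊆⊥ e∈S)

module _ {n : ℕ} where
  open ℕSums
  open SubsetSums ℕ.+-*-commutativeSemiring
  open SetSums ℕ.+-*-commutativeSemiring

  -- The variables are inserted one by one. The last component keeps each insertion legitimate, and
  -- later tells which further sets extend the chain.
  represent : ⊥ {n} ⊏ ⊤ → ∀ d → ChainSupported n d → ∃ λ c → Valid ⊥ c × Represents n c d ×
    (∀ U → (∀ s → d s ≢ 0 → Comparable U (setOf n s)) → Compatible U c)
  represent ⊥⊏⊤ d chain = let c , valid , exp , compat = build (List.allFin (N n)) in
    c , valid , (λ t → trans (sym (at t)) (sym (exp (setOf n t)))) , compat
    where
    build : ∀ l → ∃ λ c → Valid ⊥ c × (∀ S → exponentOf c S ≡ ∑ l (λ s → when (does (S ≟ˢ setOf n s)) (d s))) ×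
      (∀ U → (∀ s → d s ≢ 0 → Comparable U (setOf n s)) → Compatible U c)
    build []      = end 0 , ⊥⊏⊤ , (λ S → when-zero (does (S ≟ˢ ⊤)) refl) , λ _ _ → tt
    build (s ∷ l) with build l | d s in eq
    ... | c , valid , exp , compat | zero  = c , valid , (λ S → trans (exp S) (sym (cong (ℕ._+ _) (when-zero (does (S ≟ˢ setOf n s)) refl)))) , compat
    ... | c , valid , exp , compat | suc k = insert (setOf n s) k c ,
      insert-valid n ⊥ (setOf n s) k c valid (nonempty⇒⊥⊏ (setOf-nonempty n s)) (compat (setOf n s) (λ t → chain s t ds≢0)) ,
      (λ S → trans (insert-exponentOf n (setOf n s) k c S) (cong (when (does (S ≟ˢ setOf n s)) (suc k) ℕ.+_) (exp S))) ,
      λ U comp → insert-compatible n U (setOf n s) k c (compat U comp) (comp s ds≢0)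
      where
      ds≢0 : d s ≢ 0
      ds≢0 e = contradiction (trans (sym eq) e) λ ()

    at : ∀ t → ∑ (List.allFin (N n)) (λ s → when (does (setOf n t ≟ˢ setOf n s)) (d s)) ≡ d t
    at t = trans (∑-cong (List.allFin (N n)) (λ s → trans
        (when-cong? (setOf n t ≟ˢ setOf n s) (λ e → cong d (sym (setOf-injective e))))
        (cong (λ b → when b (d t)) (does-⇔ (mk⇔ sym sym) (setOf n t ≟ˢ setOf n s) (setOf n s ≟ˢ setOf n t)))))
      (trans (∑-setOf-when n (_≟ˢ setOf n t) (λ { refl → setOf-nonempty n t }) (λ _ → d t)) (∑-pick (setOf n t) (λ _ → d t)))

module _ where
  open ℤSums

  degree-represented : ∀ {n} (c : Chain n) (d : Mon (N n)) → Valid ⊥ c → Represents n c d → degree n d ≡ F 0 (gaps 0 c)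
  degree-represented {zero}  c d valid rep = contradiction (valid⇒< ⊥ c valid) λ ()
  degree-represented {n@(suc k)} c d valid rep = begin
    degree n d                                                    ≡⟨ when-yes (chainSupported? n d) (represented⇒chainSupported n ⊥ c valid rep) ⟩
    G k 0 0 (type n d)                                            ≡⟨ G-cong k 0 0 (λ i → trans (type-represented n c rep i)
                                                                     (cong (λ a → exponentAt c (suc (a ℕ.+ Fin.toℕ i))) (sym (∣⊥∣≡0 (suc k))))) ⟩
    G k 0 0 (λ f → exponentAt c (suc ∣ ⊥ {suc k} ∣ ℕ.+ Fin.toℕ f))  ≡⟨ G-chain ⊥ c valid k (cong (λ a → suc (a ℕ.+ k)) (∣⊥∣≡0 (suc k))) 0 ⟩
    F 0 (gaps ∣ ⊥ {suc k} ∣ c)                                  ≡⟨ cong (λ a → F 0 (gaps a c)) (∣⊥∣≡0 (suc k)) ⟩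
    F 0 (gaps 0 c)                                              ∎
    where open ≡.≡-Reasoning

  unitMon-refl : ∀ {k} (i : Fin k) → unitMon i i ≡ 1
  unitMon-refl i = cong (if_then 1 else 0) (dec-true (i Fin.≟ i) refl)

  unitMon-≢ : ∀ {k} {i j : Fin k} → i ≢ j → unitMon i j ≡ 0
  unitMon-≢ {i = i} {j} i≢j = cong (if_then 1 else 0) (dec-false (i Fin.≟ j) i≢j)

  unitMon≡when : ∀ {n} (s t : Fin (N n)) → unitMon s t ≡ ℕSums.when (does (setOf n t ≟ˢ setOf n s)) 1
  unitMon≡when {n} s t = trans (if≡when _) (cong (λ b → ℕSums.when b 1) (does-⇔ (mk⇔ (λ { refl → refl }) (sym ∘ setOf-injective)) (s Fin.≟ t) (setOf n t ≟ˢ setOf n s)))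
    where
    if≡when : ∀ b → (if b then 1 else 0) ≡ ℕSums.when b 1
    if≡when true  = refl
    if≡when false = refl

  degree-incomparable : ∀ {n} (d : Mon (N n)) s t → d s ≢ 0 → d t ≢ 0 → ¬ Comparable (setOf n s) (setOf n t) → degree n d ≡ 0ℤ
  degree-incomparable {n} d s t s≢0 t≢0 ¬comp = when-no (chainSupported? n d) (λ chain → ¬comp (chain s t s≢0 t≢0))

  -- If the support of u is no chain, neither is that of any multiple. Otherwise multiplication by a
  -- variable is insertion into the chain of u, and the sum is that of `∑-insertion-∈` at the empty
  -- set with excess 0.
  ∑-degree : ∀ {n} e (u : Mon (N n)) → ∑ (List.allFin (N n)) (λ s → when (does (e ∈? setOf n s)) (degree n (u ⊕ unitMon s))) ≡ 0ℤ
  ∑-degree {n} e u = by-cases (chainSupported? n u)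
    where
    open SetSums (CommutativeRing.commutativeSemiring ℤ.+-*-commutativeRing)
    ⊥⊏⊤ : ⊥ {n} ⊏ ⊤
    ⊥⊏⊤ = nonempty⇒⊥⊏ (e , ∈⊤)

    grow : ∀ {s t} → u t ≢ 0 → (u ⊕ unitMon s) t ≢ 0
    grow {s} {t} ≢0 e = ≢0 (ℕ.m+n≡0⇒m≡0 (u t) e)

    new : ∀ s → (u ⊕ unitMon s) s ≢ 0
    new s e = contradiction (trans (sym (unitMon-refl s)) (ℕ.m+n≡0⇒n≡0 (u s) e)) λ ()

    by-cases : Dec (ChainSupported n u) → ∑ (List.allFin (N n)) (λ s → when (does (e ∈? setOf n s)) (degree n (u ⊕ unitMon s))) ≡ 0ℤ
    by-cases (no ¬chain) = ∑-zero (List.allFin (N n)) (λ s → when-zero (does (e ∈? setOf n s))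
      (when-no (chainSupported? n (u ⊕ unitMon s)) (λ chain → ¬chain (λ t t′ t≢0 t′≢0 → chain t t′ (grow {s} t≢0) (grow {s} t′≢0)))))
    by-cases (yes chain) with represent ⊥⊏⊤ u chain
    ... | c , valid , rep , compat = trans
      (∑-cong (List.allFin (N n)) (λ s → cong (when (does (e ∈? setOf n s))) (insert-degree s)))
      (trans (∑-setOf-when n (e ∈?_) (λ e∈S → e , e∈S) (insertion 0 ⊥ c)) (∑-insertion-∈ e ⊥ c ∉⊥ valid 0))
      where
      insert-degree : ∀ s → degree n (u ⊕ unitMon s) ≡ insertion 0 ⊥ c (setOf n s)
      insert-degree s = go (compatible? (setOf n s) c)
        where
        go : Dec (Compatible (setOf n s) c) → degree n (u ⊕ unitMon s) ≡ insertion 0 ⊥ c (setOf n s)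
        go (yes comp) = trans
          (degree-represented (insert (setOf n s) 0 c) (u ⊕ unitMon s)
            (insert-valid n ⊥ (setOf n s) 0 c valid (nonempty⇒⊥⊏ (setOf-nonempty n s)) comp)
            (λ t → trans (ℕ.+-comm (u t) (unitMon s t)) (sym (trans (insert-exponentOf n (setOf n s) 0 c (setOf n t))
              (cong₂ ℕ._+_ (sym (unitMon≡when {n} s t)) (sym (rep t)))))))
          (trans (cong (λ a → F 0 (gaps a (insert (setOf n s) 0 c))) (sym (∣⊥∣≡0 n)))
                 (sym (when-yes (inside? ⊥ c (setOf n s)) (nonempty⇒⊥⊏ (setOf-nonempty n s) , comp))))
        go (no ¬comp) = trans
          (when-no (chainSupported? n (u ⊕ unitMon s)) (λ chain′ → ¬comp (compat (setOf n s) (λ t t≢0 → chain′ s t (new s) (grow {s} t≢0)))))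
          (sym (when-no (inside? ⊥ c (setOf n s)) (λ (_ , comp) → ¬comp comp)))

  open ℤLin

  -- By linearity only products of a generator with one monomial need checking: an incomparable pair
  -- destroys the chain, and `∑-degree` handles the linear relations.
  degree-ideal : ∀ {n} {f : Poly (N n)} → f ∈⟨ GenJ n ⟩ → lin (degree n) f ≡ 0ℤ
  degree-ideal {n} {f} = ∈-ind (GenJ n) (λ f → lin (degree n) f ≡ 0ℤ) refl
    (λ {f} {g} e e′ → trans (lin-++ (degree n) f g) (cong₂ ℤ._+_ e e′))
    (λ {f} {g} (mk≋ f≈g) e → trans (sym (lin-cong (degree n) (degree-resp n) {f} {g} f≈g)) e)
    (λ h {g} gen → trans (lin-* (degree n) h g) (∑-zero h (λ (a , u) → trans (cong (ℤ._*_ a) (killed u gen)) (ℤ.*-zeroʳ a))))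
    {f}
    where
    lin-var : ∀ (w : Mon (N n) → ℤ) s → lin w (var s) ≡ w (unitMon s)
    lin-var w s = trans (ℤ.+-identityʳ _) (ℤ.*-identityˡ _)

    killed : ∀ u {g} → GenJ n g → lin (λ v → degree n (u ⊕ v)) g ≡ 0ℤ
    killed u (incomparable s t s⊈t t⊈s) = trans (ℤ.+-identityʳ _) (trans (ℤ.*-identityˡ _)
      (degree-incomparable {n} (u ⊕ (unitMon s ⊕ unitMon t)) s t
        (λ e → contradiction (trans (sym (unitMon-refl s)) (ℕ.m+n≡0⇒m≡0 _ (ℕ.m+n≡0⇒n≡0 (u s) e))) λ ())
        (λ e → contradiction (trans (sym (unitMon-refl t)) (ℕ.m+n≡0⇒n≡0 (unitMon s t) (ℕ.m+n≡0⇒n≡0 (u t) e))) λ ())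
        (λ { (inj₁ s⊆t) → s⊈t s⊆t ; (inj₂ t⊆s) → t⊈s t⊆s })))
    killed u (linear e) = trans (lin-Σ (λ v → degree n (u ⊕ v)) (filter (λ s → e ∈? setOf n s) (List.allFin (N n))) var)
      (trans (∑-filter (λ s → e ∈? setOf n s) (List.allFin (N n)) (λ s → lin (λ v → degree n (u ⊕ v)) (var s)))
      (trans (∑-cong (List.allFin (N n)) (λ s → cong (when (does (e ∈? setOf n s))) (lin-var (λ v → degree n (u ⊕ v)) s))) (∑-degree e u)))

-- Standard monomials, their duals and triangularity.

total : ∀ {k} → Mon k → ℕ
total {zero}  m = 0
total {suc k} m = m Fin.zero ℕ.+ total (m ∘ Fin.suc)

-- This is Σ l · (exponent of Z_l). It is written as the sum of all tail totals because
-- triangularity compares two monomials tail by tail.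
weightOf : ∀ {k} → Mon k → ℕ
weightOf {zero}  m = 0
weightOf {suc k} m = total m ℕ.+ weightOf (m ∘ Fin.suc)

total-cong : ∀ {k} {m u : Mon k} → m ≐ u → total m ≡ total u
total-cong {zero}  e = refl
total-cong {suc k} e = cong₂ ℕ._+_ (e Fin.zero) (total-cong (e ∘ Fin.suc))

total-⊕ : ∀ {k} (m u : Mon k) → total (m ⊕ u) ≡ total m ℕ.+ total u
total-⊕ {zero}  m u = refl
total-⊕ {suc k} m u = trans (cong (ℕ._+_ (m Fin.zero ℕ.+ u Fin.zero)) (total-⊕ (m ∘ Fin.suc) (u ∘ Fin.suc)))
  (Sums.+-interchange ℕ.+-*-commutativeSemiring (m Fin.zero) (u Fin.zero) (total (m ∘ Fin.suc)) (total (u ∘ Fin.suc)))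

-- r is the demand of the later blocks. If it is positive, the current size serves one unit of it;
-- if it is 0, the block of the current exponent m begins.
reach-step : ℕ → ℕ → ℕ
reach-step m zero    = m
reach-step m (suc r) = r

-- Give Z_l^e the block of sizes l − e, …, l − 1; reach is the number of sizes that the blocks need before the first one.
reach : ∀ k → Mon (suc k) → ℕ
reach zero    m = m Fin.zero
reach (suc k) m = reach-step (m Fin.zero) (reach k (m ∘ Fin.suc))

indicator-zero : ℕ → ℕ
indicator-zero zero    = 1
indicator-zero (suc _) = 0

-- The squarefree monomial of the sizes < n outside of all blocks.
dual : ∀ k → Mon (suc k) → Mon (suc k)
dual zero    m _           = 0
dual (suc k) m Fin.zero    = indicator-zero (reach k (m ∘ Fin.suc))
dual (suc k) m (Fin.suc i) = dual k (m ∘ Fin.suc) i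

-- A size inside a later block has exponent 0. Since a lies in the block of Z_b^e exactly when b - a
-- ≤ e for a < b, this excludes the divisors Z_a Z_b^(b-a) with a > 0.
Disjoint : ∀ k → Mon (suc k) → Set
Disjoint zero    m = Unit
Disjoint (suc k) m = (reach k (m ∘ Fin.suc) ≢ 0 → m Fin.zero ≡ 0) × Disjoint k (m ∘ Fin.suc)

*-nonzero : ∀ {a b} → a ≢ 0ℤ → b ≢ 0ℤ → a ℤ.* b ≢ 0ℤ
*-nonzero {a} a≢0 b≢0 e = [ a≢0 , b≢0 ]′ (ℤ.i*j≡0⇒i≡0∨j≡0 a e)

*-nonzeroˡ : ∀ a b → a ℤ.* b ≢ 0ℤ → a ≢ 0ℤ
*-nonzeroˡ a b ≢0 refl = ≢0 refl

*-nonzeroʳ : ∀ a b → a ℤ.* b ≢ 0ℤ → b ≢ 0ℤ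
*-nonzeroʳ a b ≢0 refl = ≢0 (ℤ.*-zeroʳ a)

sgn-nonzero : ∀ m → sgn m ≢ 0ℤ
sgn-nonzero zero    ()
sgn-nonzero (suc m) e = sgn-nonzero m (trans (sym (ℤ.neg-involutive (sgn m))) (cong ℤ.-_ e))

B-nonzero : ∀ {j p} → B j p ≢ 0ℤ → p ℕ.≤ j
B-nonzero {j} {p} ≢0 with p ℕ.≤? j
... | yes p≤j = p≤j
... | no  p≰j = contradiction (B-> (ℕ.≰⇒> p≰j)) ≢0

-- After multiplication by the dual, every size below n outside the blocks is a chain element. It
-- has exponent m₀ + 1 and is preceded by exactly m₀ empty sizes, those of its block. So the excess
-- stays 0, all binomial coefficients are 1, and only signs remain.
G-dual : ∀ k m → Disjoint k m → G k (reach k m) 0 (m ⊕ dual k m) ≢ 0ℤ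
G-dual zero m _ = *-nonzero {1ℤ} (λ ()) (*-nonzero (sgn-nonzero (m Fin.zero ℕ.+ 0))
  (λ e → contradiction (trans (sym e) (ℤSums.when-yes (m Fin.zero ℕ.+ 0 ℕ.≟ m Fin.zero) (ℕ.+-identityʳ _))) λ ()))
G-dual (suc k) m (free , disj) = go (reach k (m ∘ Fin.suc)) refl
  where
  t = (m ∘ Fin.suc) ⊕ dual k (m ∘ Fin.suc)
  go : ∀ r → reach k (m ∘ Fin.suc) ≡ r →
    G-head k (reach-step (m Fin.zero) r) 0 (m Fin.zero ℕ.+ indicator-zero r) t ≢ 0ℤ
  go (suc r) eq e = G-dual k (m ∘ Fin.suc) disj (trans (cong (λ v → G k v 0 t) eq)
    (trans (cong (λ v → G-head k r 0 v t) (sym (trans (ℕ.+-identityʳ _) (free (λ e → contradiction (trans (sym eq) e) λ ()))))) e))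
  go zero    eq e = *-nonzero {B m₀ 0} (λ ()) (*-nonzero (sgn-nonzero m₀) (*-nonzero {B m₀ m₀}
    (λ e → contradiction (trans (sym e) (B-diag m₀)) λ ())
    (λ e → G-dual k (m ∘ Fin.suc) disj (trans (cong₂ (λ v u → G k v u t) eq (sym (ℕ.n∸n≡0 m₀))) e))))
    (trans (cong (λ v → G-head k m₀ 0 v t) (ℕ.+-comm 1 m₀)) e)
    where m₀ = m Fin.zero

-- The volume is homogeneous: where the binomial factors are nonzero, the truncated subtractions are
-- exact and the excess balances the exponents against the sizes. For j = p = 0 the total is k = n -
-- 1.
G-total : ∀ k j p t → G k j p t ≢ 0ℤ → total t ℕ.+ p ≡ j ℕ.+ k
G-head-total : ∀ k j p v t → G-head k j p v t ≢ 0ℤ → v ℕ.+ total t ℕ.+ p ≡ j ℕ.+ suc k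

G-total zero j p t ≢0 = trans (cong (ℕ._+ p) (trans (ℕ.+-identityʳ _) t≡)) (trans (ℕ.m∸n+n≡m p≤j) (sym (ℕ.+-identityʳ j)))
  where
  p≤j : p ℕ.≤ j
  p≤j = B-nonzero (*-nonzeroˡ (B j p) _ ≢0)
  t≡ : t Fin.zero ≡ j ∸ p
  t≡ with t Fin.zero ℕ.≟ j ∸ p
  ... | yes e = e
  ... | no ≢j = contradiction (ℤSums.when-no (t Fin.zero ℕ.≟ j ∸ p) ≢j) (*-nonzeroʳ (sgn (t Fin.zero)) _ (*-nonzeroʳ (B j p) _ ≢0))
G-total (suc k) j p t ≢0 = G-head-total k j p (t Fin.zero) (t ∘ Fin.suc) ≢0

G-head-total k j p zero    t ≢0 = trans (G-total k (suc j) p t ≢0) (sym (ℕ.+-suc j k))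
G-head-total k j p (suc m) t ≢0 = begin
  suc (m ℕ.+ total t ℕ.+ p)                       ≡⟨ cong (λ v → suc (v ℕ.+ total t ℕ.+ p)) (sym (ℕ.m+[n∸m]≡n q≤m)) ⟩
  suc (q ℕ.+ p′ ℕ.+ total t ℕ.+ p)                ≡⟨ rearrange q p′ (total t) p ⟩
  suc (q ℕ.+ p ℕ.+ (total t ℕ.+ p′))              ≡⟨ cong₂ (λ a b → suc (a ℕ.+ b)) (ℕ.m∸n+n≡m p≤j) (G-total k 0 p′ t G≢0) ⟩
  suc (j ℕ.+ k)                                   ≡⟨ ℕ.+-suc j k ⟨
  j ℕ.+ suc k                                     ∎
  where
  open ≡.≡-Reasoning

  q = j ∸ p
  p′ = m ∸ q
  rest≢0 = *-nonzeroʳ (sgn m) _ (*-nonzeroʳ (B j p) _ ≢0)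
  G≢0 : G k 0 p′ t ≢ 0ℤ
  G≢0 = *-nonzeroʳ (B m q) _ rest≢0
  p≤j : p ℕ.≤ j
  p≤j = B-nonzero (*-nonzeroˡ (B j p) _ ≢0)
  q≤m : q ℕ.≤ m
  q≤m = B-nonzero (*-nonzeroˡ (B m q) (G k 0 p′ t) rest≢0)
  rearrange : ∀ q p′ t p → suc (q ℕ.+ p′ ℕ.+ t ℕ.+ p) ≡ suc (q ℕ.+ p ℕ.+ (t ℕ.+ p′))
  rearrange = ℕ-RingSolver.solve-∀

G-head-tail : ∀ k j p v t → G-head k j p v t ≢ 0ℤ → ∃₂ λ j′ p′ → G k j′ p′ t ≢ 0ℤ × (v ≢ 0 → j′ ≡ 0)
G-head-tail k j p zero    t ≢0 = suc j , p , ≢0 , λ 0≢0 → contradiction refl 0≢0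
G-head-tail k j p (suc m) t ≢0 = 0 , m ∸ (j ∸ p) ,
  *-nonzeroʳ (B m (j ∸ p)) _ (*-nonzeroʳ (sgn m) _ (*-nonzeroʳ (B j p) _ ≢0)) , λ _ → refl

-- Each tail total of m is bounded by that of m′. At a size outside the blocks of m′ the dual puts a
-- chain element, after which the volume restarts with gap 0, and homogeneity bounds the rest. At a
-- size inside a block m′ has exponent 0, so the bound is inherited from the larger tail. If all
-- bounds are equalities then m and m′ agree; otherwise the weight drops.
triangular : ∀ k (m m′ : Mon (suc k)) → Disjoint k m′ → ∀ j p → G k j p (m ⊕ dual k m′) ≢ 0ℤ →
  total m ℕ.≤ total m′ → weightOf m ℕ.< weightOf m′ ⊎ m ≐ m′
triangular zero m m′ _ j p ≢0 le with m Fin.zero ℕ.<? m′ Fin.zero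
... | yes m<m′ = inj₁ (ℕ.+-monoˡ-< 0 (ℕ.+-monoˡ-< 0 m<m′))
... | no  m≮m′ = inj₂ λ { Fin.zero → ℕ.≤-antisym (ℕ.+-cancelʳ-≤ 0 _ _ le) (ℕ.≮⇒≥ m≮m′) }
triangular (suc k) m m′ (free , disj) j p ≢0 le with G-head-tail k j p (m Fin.zero ℕ.+ dual (suc k) m′ Fin.zero) ((m ∘ Fin.suc) ⊕ dual k (m′ ∘ Fin.suc)) ≢0
... | j′ , p′ , G≢0 , v≢0⇒ = conclude (triangular k (m ∘ Fin.suc) (m′ ∘ Fin.suc) disj j′ p′ G≢0 (tails (reach k (m′ ∘ Fin.suc)) refl))
  where
  D = dual k (m′ ∘ Fin.suc)
  E = total D
  tails : ∀ r → reach k (m′ ∘ Fin.suc) ≡ r → total (m ∘ Fin.suc) ℕ.≤ total (m′ ∘ Fin.suc)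
  tails (suc r) eq = ℕ.≤-trans (ℕ.m≤n+m (total (m ∘ Fin.suc)) (m Fin.zero)) (ℕ.≤-trans le
    (ℕ.≤-reflexive (cong (ℕ._+ total (m′ ∘ Fin.suc)) (free (λ e → contradiction (trans (sym eq) e) λ ())))))
  tails zero eq = ℕ.+-cancelʳ-≤ E _ _ (ℕ.≤-trans (ℕ.m≤m+n (total (m ∘ Fin.suc) ℕ.+ E) p′) (ℕ.≤-reflexive (trans
    (trans (cong (ℕ._+ p′) (sym (total-⊕ (m ∘ Fin.suc) D))) (trans (G-total k j′ p′ ((m ∘ Fin.suc) ⊕ D) G≢0) (cong (ℕ._+ k) (v≢0⇒ v≢0))))
    (trans (sym (trans (G-total k (reach k (m′ ∘ Fin.suc)) 0 ((m′ ∘ Fin.suc) ⊕ D) (G-dual k (m′ ∘ Fin.suc) disj)) (cong (ℕ._+ k) eq)))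
           (trans (ℕ.+-identityʳ _) (total-⊕ (m′ ∘ Fin.suc) D))))))
    where
    v≢0 : m Fin.zero ℕ.+ dual (suc k) m′ Fin.zero ≢ 0
    v≢0 e = contradiction (trans (sym (ℕ.m+n≡0⇒n≡0 (m Fin.zero) e)) (cong indicator-zero eq)) λ ()

  conclude : weightOf (m ∘ Fin.suc) ℕ.< weightOf (m′ ∘ Fin.suc) ⊎ (m ∘ Fin.suc) ≐ (m′ ∘ Fin.suc) → weightOf m ℕ.< weightOf m′ ⊎ m ≐ m′
  conclude (inj₁ lt) = inj₁ (ℕ.+-mono-≤-< le lt)
  conclude (inj₂ e) with m Fin.zero ℕ.≟ m′ Fin.zero
  ... | yes e₀ = inj₂ λ { Fin.zero → e₀ ; (Fin.suc i) → e i }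
  ... | no ≢₀ = inj₁ (ℕ.+-mono-<-≤ (ℕ.≤∧≢⇒< le (λ eq → ≢₀ (ℕ.+-cancelʳ-≡ _ _ _ (trans eq (cong (ℕ._+_ (m′ Fin.zero)) (sym (total-cong e)))))))
                                   (ℕ.≤-reflexive (weightOf-cong e)))
    where
    weightOf-cong : ∀ {k} {m u : Mon k} → m ≐ u → weightOf m ≡ weightOf u
    weightOf-cong {zero}  e = refl
    weightOf-cong {suc k} e = cong₂ ℕ._+_ (total-cong e) (weightOf-cong (e ∘ Fin.suc))

-- Reach 0 says that no block contains the size 0, which excludes the divisors Z_b^b and is the case
-- a = 0 of the condition in `Disjoint`.
Standard : ∀ n → Mon n → Set
Standard zero    m = Unit
Standard (suc k) m = Disjoint k m × reach k m ≡ 0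

reach-cong : ∀ k {m u} → m ≐ u → reach k m ≡ reach k u
reach-cong zero    e = e Fin.zero
reach-cong (suc k) e = cong₂ reach-step (e Fin.zero) (reach-cong k (e ∘ Fin.suc))

disjoint-resp : ∀ k {m u} → m ≐ u → Disjoint k m → Disjoint k u
disjoint-resp zero    e _             = tt
disjoint-resp (suc k) e (free , disj) =
  (λ ≢0 → trans (sym (e Fin.zero)) (free (λ ≡0 → ≢0 (trans (sym (reach-cong k (e ∘ Fin.suc))) ≡0)))) , disjoint-resp k (e ∘ Fin.suc) disj

standard-resp : ∀ n {m u} → m ≐ u → Standard n m → Standard n u
standard-resp zero    e _            = tt
standard-resp (suc k) e (disj , r≡0) = disjoint-resp k e disj , trans (sym (reach-cong k e)) r≡0

dualOf : ∀ n → Mon n → Mon n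
dualOf zero    m = m
dualOf (suc k) m = dual k m

vol-dual : ∀ n m → Standard n m → vol n (m ⊕ dualOf n m) ≢ 0ℤ
vol-dual zero    m _            = λ ()
vol-dual (suc k) m (disj , r≡0) = λ e → G-dual k m disj (trans (cong (λ v → G k v 0 (m ⊕ dual k m)) r≡0) e)

-- Multiplied by the same dual, both m and m′ have nonzero volume, hence total n - 1 by homogeneity.
-- This gives the equality of totals from which `triangular` starts.
vol-triangular : ∀ n m m′ → Standard n m′ → vol n (m ⊕ dualOf n m′) ≢ 0ℤ → weightOf m ℕ.< weightOf m′ ⊎ m ≐ m′
vol-triangular zero    m m′ _            _  = inj₂ λ ()
vol-triangular (suc k) m m′ (disj , r≡0) ≢0 = triangular k m m′ disj 0 0 ≢0
  (ℕ.≤-reflexive (ℕ.+-cancelʳ-≡ (total (dual k m′)) _ _ (trans (sym (total-⊕ m (dual k m′))) (trans (sym (ℕ.+-identityʳ _))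
    (trans (G-total k 0 0 (m ⊕ dual k m′) ≢0) (trans (sym (trans (G-total k (reach k m′) 0 (m′ ⊕ dual k m′) (G-dual k m′ disj)) (cong (ℕ._+ k) r≡0)))
      (trans (ℕ.+-identityʳ _) (total-⊕ m′ (dual k m′)))))))))

-- The exponent vectors divisible by some Z_a Z_b^{b−a}; the two cases are a = 0 and a > 0.
Reducible : ∀ n → Mon n → Set
Reducible n m = (∃ λ i → suc (Fin.toℕ i) ℕ.≤ m i) ⊎ (∃₂ λ h i → h Fin.< i × m h ≢ 0 × Fin.toℕ i ∸ Fin.toℕ h ℕ.≤ m i)

-- A positive reach is caused by a single exponent, that of the block extending below the first
-- size.
reach-witness : ∀ k m {r} → reach k m ≡ suc r → ∃ λ i → m i ≡ Fin.toℕ i ℕ.+ suc r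
reach-witness zero    m eq = Fin.zero , eq
reach-witness (suc k) m eq with reach k (m ∘ Fin.suc) in eq′
... | zero  = Fin.zero , eq
... | suc r′ with reach-witness k (m ∘ Fin.suc) eq′
...   | i , mi≡ = Fin.suc i , trans mi≡ (trans (cong (λ v → Fin.toℕ i ℕ.+ suc v) eq) (ℕ.+-suc (Fin.toℕ i) _))

disjoint-or-reducible : ∀ k m → (∃₂ λ h i → h Fin.< i × m h ≢ 0 × Fin.toℕ i ∸ Fin.toℕ h ℕ.≤ m i) ⊎ Disjoint k m
disjoint-or-reducible zero    m = inj₂ tt
disjoint-or-reducible (suc k) m with disjoint-or-reducible k (m ∘ Fin.suc)
... | inj₁ (h , i , h<i , mh≢0 , le) = inj₁ (Fin.suc h , Fin.suc i , s≤s h<i , mh≢0 , le)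
... | inj₂ disj with reach k (m ∘ Fin.suc) in eq | m Fin.zero ℕ.≟ 0
...   | zero  | _        = inj₂ ((λ ≢0 → contradiction refl ≢0) , disj)
...   | suc r | yes m₀≡0 = inj₂ ((λ _ → m₀≡0) , disj)
...   | suc r | no  m₀≢0 with reach-witness k (m ∘ Fin.suc) eq
...     | i , mi≡ = inj₁ (Fin.zero , Fin.suc i , s≤s z≤n , m₀≢0 ,
          ℕ.≤-trans (ℕ.≤-trans (s≤s (ℕ.m≤m+n (Fin.toℕ i) r)) (ℕ.≤-reflexive (sym (ℕ.+-suc (Fin.toℕ i) r)))) (ℕ.≤-reflexive (sym mi≡)))

standard-or-reducible : ∀ n m → Standard n m ⊎ Reducible n m
standard-or-reducible zero    m = inj₁ tt
standard-or-reducible (suc k) m with disjoint-or-reducible k m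
... | inj₁ red = inj₂ (inj₂ red)
... | inj₂ disj with reach k m in eq
...   | zero = inj₁ (disj , refl)
...   | suc r with reach-witness k m eq
...     | i , mi≡ = inj₂ (inj₁ (i , ℕ.≤-trans (ℕ.≤-trans (s≤s (ℕ.m≤m+n (Fin.toℕ i) r)) (ℕ.≤-reflexive (sym (ℕ.+-suc (Fin.toℕ i) r)))) (ℕ.≤-reflexive (sym mi≡))))

-- Wherever m has a factor, the dual supplies the flag variable that absorbs it. The exception is
-- size n, where the level sum is a single variable anyway.
dual-covers : ∀ k m → Disjoint k m → ∀ i → m i ≡ 0 ⊎ (dual k m i ≡ 1 ⊎ Fin.toℕ i ≡ k)
dual-covers zero    m _             Fin.zero    = inj₂ (inj₂ refl)
dual-covers (suc k) m (free , disj) Fin.zero    with reach k (m ∘ Fin.suc)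
... | zero  = inj₂ (inj₁ refl)
... | suc r = inj₁ (free λ ())
dual-covers (suc k) m (free , disj) (Fin.suc i) with dual-covers k (m ∘ Fin.suc) disj i
... | inj₁ m≡0        = inj₁ m≡0
... | inj₂ (inj₁ d≡1) = inj₂ (inj₁ d≡1)
... | inj₂ (inj₂ i≡k) = inj₂ (inj₂ (cong suc i≡k))

dualOf-covers : ∀ n m → Standard n m → ∀ i → m i ≡ 0 ⊎ (dualOf n m i ≡ 1 ⊎ suc (Fin.toℕ i) ≡ n)
dualOf-covers (suc k) m (disj , _) i with dual-covers k m disj i
... | inj₁ m≡0        = inj₁ m≡0
... | inj₂ (inj₁ d≡1) = inj₂ (inj₁ d≡1)
... | inj₂ (inj₂ i≡k) = inj₂ (inj₂ (cong suc i≡k))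

-- Linear independence of the standard monomials by pairing.

powMon : ∀ {k} → Mon k → ℕ → Mon k
powMon u zero    = oneMon
powMon u (suc e) = u ⊕ powMon u e

prodMon : ∀ {k} {I : Set} → (I → Mon k) → List I → Mon k
prodMon u []      = oneMon
prodMon u (i ∷ l) = u i ⊕ prodMon u l

powMon-* : ∀ {k} (u : Mon k) e i → powMon u e i ≡ e ℕ.* u i
powMon-* u zero    i = refl
powMon-* u (suc e) i = cong (ℕ._+_ (u i)) (powMon-* u e i)

powMon-cong : ∀ {k} {u v : Mon k} e → u ≐ v → powMon u e ≐ powMon v e
powMon-cong zero    p i = refl
powMon-cong (suc e) p i = cong₂ ℕ._+_ (p i) (powMon-cong e p i)

prodMon-∑ : ∀ {k} {I : Set} (u : I → Mon k) l i → prodMon u l i ≡ ℕSums.∑ l (λ j → u j i)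
prodMon-∑ u []      i = refl
prodMon-∑ u (j ∷ l) i = cong (ℕ._+_ (u j i)) (prodMon-∑ u l i)

prodMon-cong : ∀ {k} {I : Set} {u v : I → Mon k} l → (∀ j → u j ≐ v j) → prodMon u l ≐ prodMon v l
prodMon-cong []      p i = refl
prodMon-cong (j ∷ l) p i = cong₂ ℕ._+_ (p j i) (prodMon-cong l p i)

∑-unitMon : ∀ {k} (t : Fin k → ℕ) i → ℕSums.∑ (List.allFin k) (λ j → t j ℕ.* unitMon j i) ≡ t i
∑-unitMon {suc k} t i = trans (cong (λ l → t Fin.zero ℕ.* unitMon Fin.zero i ℕ.+ ℕSums.∑ l (λ j → t j ℕ.* unitMon j i)) (sym (map-tabulate (λ j → j) Fin.suc)))
  (trans (cong (ℕ._+_ (t Fin.zero ℕ.* unitMon Fin.zero i)) (ℕSums.∑-map Fin.suc (List.allFin k) (λ j → t j ℕ.* unitMon j i))) (split i))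
  where
  split : ∀ i → t Fin.zero ℕ.* unitMon Fin.zero i ℕ.+ ℕSums.∑ (List.allFin k) (λ j → t (Fin.suc j) ℕ.* unitMon (Fin.suc j) i) ≡ t i
  split Fin.zero    = trans (cong₂ ℕ._+_ (ℕ.*-identityʳ (t Fin.zero)) (ℕSums.∑-zero (List.allFin k) (λ j → ℕ.*-zeroʳ (t (Fin.suc j))))) (ℕ.+-identityʳ _)
  split (Fin.suc i) = trans (cong (ℕ._+ ℕSums.∑ (List.allFin k) (λ j → t (Fin.suc j) ℕ.* unitMon j i)) (ℕ.*-zeroʳ (t Fin.zero))) (∑-unitMon (t ∘ Fin.suc) i)

prodMon-unit : ∀ {k} (t : Mon k) → prodMon (λ j → powMon (unitMon j) (t j)) (List.allFin k) ≐ t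
prodMon-unit {k} t i = trans (prodMon-∑ (λ j → powMon (unitMon j) (t j)) (List.allFin k) i) (trans (ℕSums.∑-cong (List.allFin k) (λ j → powMon-* (unitMon j) (t j) i)) (∑-unitMon t i))

-- The pairing argument, for a functional L on a ring generated by elements sᵢ of multidegree unitMon i (the relation Q);
-- the yᵢ play the role of the x_S for S in a complete flag.
module Pairing (R : CommutativeRing 0ℓ 0ℓ) {ι : ℤ → CommutativeRing.Carrier R} (isScalar : IsScalar R ι)
  {n} (s y : Fin n → CommutativeRing.Carrier R) (L : CommutativeRing.Carrier R → ℤ) (Q : Mon n → CommutativeRing.Carrier R → Set) where
  open Sums (CommutativeRing.commutativeSemiring R)

  record Functional : Set where
    field
      L-resp : ∀ {a b} → a ≃ b → L a ≡ L b
      L-0    : L 0# ≡ 0ℤ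
      L-+    : ∀ a b → L (a + b) ≡ L a ℤ.+ L b
      L-ι    : ∀ c a → L (ι c * a) ≡ c ℤ.* L a
      L-flag : ∀ t → L (∏ (List.allFin n) (λ i → pow (y i) (t i))) ≡ vol n t
      L-Q    : ∀ {m a} → Q m a → vol n m ≡ 0ℤ → L a ≡ 0ℤ
      absorb : ∀ i → s i * y i ≃ y i * y i
      top    : ∀ i → suc (Fin.toℕ i) ≡ n → s i ≃ y i
      Q-≐    : ∀ {m u a} → m ≐ u → Q m a → Q u a
      Q-1    : Q oneMon 1#
      Q-*    : ∀ {m u a b} → Q m a → Q u b → Q (m ⊕ u) (a * b)
      Q-s    : ∀ i → Q (unitMon i) (s i)
      Q-y    : ∀ i → Q (unitMon i) (y i)

    open Eval R isScalar s
    open ℤLin using (lin; lin-vanish; lin-remove) renaming (Resp to ℤResp)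
    private module R = CommutativeRing R

    pairing : Carrier → Mon n → ℤ
    pairing t m = L (monomial m * t)

    pairing-resp : ∀ t → ℤResp (pairing t)
    pairing-resp t e = L-resp (R.*-congʳ (monomial-resp e))

    pairing-eval : ∀ t f → L (eval f * t) ≡ lin (pairing t) f
    pairing-eval t f = trans (L-resp (R.trans (∑-*ʳ t f _) (∑-cong f (λ _ → R.*-assoc _ _ _))))
      (∑-ind (λ f a → L a ≡ lin (pairing t) f) L-0
        (λ (c , m) {_} {a} ih → trans (L-+ (ι c * (monomial m * t)) a) (cong₂ ℤ._+_ (L-ι c (monomial m * t)) ih)) f)

    pairing-kernel : ∀ t f → eval f ≃ 0# → lin (pairing t) f ≡ 0ℤ
    pairing-kernel t f e = trans (sym (pairing-eval t f)) (trans (L-resp (R.trans (R.*-congʳ e) (R.zeroˡ t))) L-0)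

    Q-∏ : ∀ {r : Fin n → Carrier} → (∀ i → Q (unitMon i) (r i)) → ∀ t → Q t (∏ (List.allFin n) (λ i → pow (r i) (t i)))
    Q-∏ Q-r t = Q-≐ (prodMon-unit t) (∏-ind (λ l → Q (prodMon (λ i → powMon (unitMon i) (t i)) l)) Q-1
      (λ i → Q-* (pow-ind (λ e → Q (powMon (unitMon i) e)) Q-1 (Q-* (Q-r i)) (t i))) (List.allFin n))

    flag : Mon n → Carrier
    flag t = ∏ (List.allFin n) (λ i → pow (y i) (t i))

    -- All factors have known multidegrees, so `L-Q` applies to the product without expanding it.
    pairing-zero : ∀ t m → vol n (m ⊕ t) ≡ 0ℤ → pairing (flag t) m ≡ 0ℤ
    pairing-zero t m = L-Q (Q-* (Q-∏ Q-s m) (Q-∏ Q-y t))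

    -- The three cases of `dualOf-covers`: nothing to absorb, one flag variable to absorb into, or
    -- the top size, where `s i` and `y i` coincide.
    factor-flag : ∀ i e d → e ≡ 0 ⊎ (d ≡ 1 ⊎ suc (Fin.toℕ i) ≡ n) → pow (s i) e * pow (y i) d ≃ pow (y i) (e ℕ.+ d)
    factor-flag i e d (inj₁ refl)        = R.*-identityˡ _
    factor-flag i e d (inj₂ (inj₁ refl)) = pow-absorb (absorb i) e 0
    factor-flag i e d (inj₂ (inj₂ eq))   = R.trans (R.*-congʳ (pow-cong e (top i eq))) (R.sym (pow-+ (y i) e d))

    -- Multiplied by the flag of its dual, a standard monomial becomes a monomial in the yᵢ.
    pairing-dual : ∀ m → Standard n m → pairing (flag (dualOf n m)) m ≡ vol n (m ⊕ dualOf n m)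
    pairing-dual m std = trans (L-resp (R.trans (R.sym (∏-* (List.allFin n) _ _))
      (∏-cong (List.allFin n) (λ i → factor-flag i (m i) (dualOf n m i) (dualOf-covers n m std i))))) (L-flag (m ⊕ dualOf n m))

    -- Induction on the weight of m. In the pairing with the dual of m, a monomial of smaller weight
    -- has coefficient 0 by induction and every other monomial except m pairs to 0. What is left is
    -- the coefficient of m times a nonzero integer.
    standard-independent : ∀ f → (∀ m → coeff f m ≢ 0ℤ → Standard n m) → eval f ≃ 0# → f ≈ 0ₚ
    standard-independent f std f≃0 m = go m (<-wellFounded (weightOf m))
      where
      go : ∀ m → Acc ℕ._<_ (weightOf m) → coeff f m ≡ 0ℤ
      go m (acc smaller) with coeff f m ℤ.≟ 0ℤ
      ... | yes e = e
      ... | no ≢0 = contradiction (trans (sym split) (pairing-kernel t f f≃0))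
                      (*-nonzero ≢0 (λ e → vol-dual n m std-m (trans (sym (pairing-dual m std-m)) e)))
        where
        std-m = std m ≢0
        t = flag (dualOf n m)

        others : ∀ u → coeff (remove m f) u ≡ 0ℤ ⊎ pairing t u ≡ 0ℤ
        others u with u ≐? m
        ... | yes u≐m = inj₁ (coeff-remove-≐ f u≐m)
        ... | no  u≭m with vol n (u ⊕ dualOf n m) ℤ.≟ 0ℤ
        ...   | yes vol≡0 = inj₂ (pairing-zero (dualOf n m) u vol≡0)
        ...   | no  vol≢0 with vol-triangular n u m std-m vol≢0
        ...     | inj₁ lt  = inj₁ (trans (coeff-remove-≭ f u≭m) (go u (smaller lt)))
        ...     | inj₂ u≐m = contradiction u≐m u≭m

        split : lin (pairing t) f ≡ coeff f m ℤ.* pairing t m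
        split = trans (lin-remove (pairing t) (pairing-resp t) m f) (trans (cong (ℤ._+_ (coeff f m ℤ.* pairing t m))
          (lin-vanish (pairing t) (pairing-resp t) (remove m f) others)) (ℤ.+-identityʳ _))

-- The flag of initial segments, and the pairing in A^*.

module _ where
  open ChowRing

  initial : ∀ {n} → Fin n → Subset n
  initial Fin.zero    = inside ∷ ⊥
  initial (Fin.suc i) = inside ∷ initial i

  ∣initial∣ : ∀ {n} (i : Fin n) → ∣ initial i ∣ ≡ suc (Fin.toℕ i)
  ∣initial∣ {suc n} Fin.zero    = cong suc (∣⊥∣≡0 n)
  ∣initial∣         (Fin.suc i) = cong suc (∣initial∣ i)

  initial-nonempty : ∀ {n} (i : Fin n) → Nonempty (initial i)
  initial-nonempty Fin.zero    = Fin.zero , here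
  initial-nonempty (Fin.suc i) = Fin.zero , here

  initial-comparable : ∀ {n} (i j : Fin n) → Comparable (initial i) (initial j)
  initial-comparable Fin.zero    Fin.zero    = inj₁ (λ e → e)
  initial-comparable Fin.zero    (Fin.suc j) = inj₁ (in⊆in (⊆-min (initial j)))
  initial-comparable (Fin.suc i) Fin.zero    = inj₂ (in⊆in (⊆-min (initial i)))
  initial-comparable (Fin.suc i) (Fin.suc j) with initial-comparable i j
  ... | inj₁ i⊆j = inj₁ (in⊆in i⊆j)
  ... | inj₂ j⊆i = inj₂ (in⊆in j⊆i)

  module _ (n : ℕ) where
    open ℕSums hiding (pow; ∏; pow-unique; ∏-unique; pow-ind; ∏-ind)
    open SetSums ℕ.+-*-commutativeSemiring
    open SubsetSums ℕ.+-*-commutativeSemiring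

    type-one : type n oneMon ≐ oneMon
    type-one i = ∑-zero (List.allFin (N n)) (λ s → when-zero (does (∣ setOf n s ∣ ℕ.≟ suc (Fin.toℕ i))) refl)

    type-pow : ∀ u e → type n (powMon u e) ≐ powMon (type n u) e
    type-pow u zero    i = type-one i
    type-pow u (suc e) i = trans (type-⊕ n u (powMon u e) i) (cong (ℕ._+_ (type n u i)) (type-pow u e i))

    type-prod : ∀ {I : Set} (u : I → Mon (N n)) l → type n (prodMon u l) ≐ prodMon (λ j → type n (u j)) l
    type-prod u []      i = type-one i
    type-prod u (j ∷ l) i = trans (type-⊕ n (u j) (prodMon u l) i) (cong (ℕ._+_ (type n (u j) i)) (type-prod u l i))

    type-unit : ∀ s i → ∣ setOf n s ∣ ≡ suc (Fin.toℕ i) → type n (unitMon s) ≐ unitMon i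
    type-unit s i ∣s∣≡ j = trans
      (∑-cong (List.allFin (N n)) (λ t → trans (cong (when (does (∣ setOf n t ∣ ℕ.≟ suc (Fin.toℕ j)))) (unitMon≡when {n} s t))
        (when-swap (does (∣ setOf n t ∣ ℕ.≟ suc (Fin.toℕ j))) (does (setOf n t ≟ˢ setOf n s)) 1)))
      (trans (∑-setOf-when n (_≟ˢ setOf n s) (λ { refl → setOf-nonempty n s }) (λ T → when (does (∣ T ∣ ℕ.≟ suc (Fin.toℕ j))) 1))
      (trans (∑-pick (setOf n s) (λ T → when (does (∣ T ∣ ℕ.≟ suc (Fin.toℕ j))) 1))
      (trans (cong (λ b → when b 1) (does-⇔ (mk⇔ (λ e → Fin.toℕ-injective (ℕ.suc-injective (trans (sym ∣s∣≡) e))) (λ { refl → ∣s∣≡ }))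
        (∣ setOf n s ∣ ℕ.≟ suc (Fin.toℕ j)) (i Fin.≟ j)))
        (when≡if (does (i Fin.≟ j))))))
      where
      when≡if : ∀ b → when b 1 ≡ (if b then 1 else 0)
      when≡if true  = refl
      when≡if false = refl

    -- A condition on each listed term, hence on representatives and not on classes in the quotient.
    -- It passes to products, and the degree of each term is then `vol n m` or 0.
    Homogeneous : Mon n → Poly (N n) → Set
    Homogeneous m = All (λ t → type n (proj₂ t) ≐ m)

    homogeneous-≐ : ∀ {m u f} → m ≐ u → Homogeneous m f → Homogeneous u f
    homogeneous-≐ e = All.map (λ p → ≐-trans p e)

    homogeneous-* : ∀ {m u f g} → Homogeneous m f → Homogeneous u g → Homogeneous (m ⊕ u) (f *ₚ g)
    homogeneous-* hf hg = All.concat⁺ (All.map⁺ (All.map (λ {t} p → All.map⁺ (All.map (λ {s} q i →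
      trans (type-⊕ n (proj₂ t) (proj₂ s) i) (cong₂ ℕ._+_ (p i) (q i))) hg)) hf))

    homogeneous-z : ∀ i → Homogeneous (unitMon i) (z n (suc (Fin.toℕ i)))
    homogeneous-z i = All.concat⁺ (All.map⁺ (All.map (λ {s} e → type-unit s i e ∷ []) (All.all-filter (λ s → ∣ setOf n s ∣ ℕ.≟ suc (Fin.toℕ i)) (List.allFin (N n)))))

    open Sums (CommutativeRing.commutativeSemiring (quotientRing (GenJ n))) using (pow; ∏; pow-unique; ∏-unique; pow-ind; ∏-ind)

    term : Mon (N n) → Poly (N n)
    term u = (1ℤ , u) ∷ []

    flagIndex : ∀ i → ∃ λ s → setOf n s ≡ initial i × X n (initial i) ≡ var s
    flagIndex i = X-index n (initial i) (initial-nonempty i)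

    flag : Fin n → Fin (N n)
    flag i = proj₁ (flagIndex i)

    setOf-flag : ∀ i → setOf n (flag i) ≡ initial i
    setOf-flag i = proj₁ (proj₂ (flagIndex i))

    ∣flag∣ : ∀ i → ∣ setOf n (flag i) ∣ ≡ suc (Fin.toℕ i)
    ∣flag∣ i = trans (cong ∣_∣ (setOf-flag i)) (∣initial∣ i)

    flagMon : Mon n → Mon (N n)
    flagMon t = prodMon (λ i → powMon (unitMon (flag i)) (t i)) (List.allFin n)

    -- The product of two one-term lists computes to a one-term list. So a product of flag variables
    -- is literally a single term, whose degree is read off directly.
    term-* : ∀ {u v f g} → term u ≡ f → term v ≡ g → term (u ⊕ v) ≡ f *ₚ g
    term-* refl refl = refl

    term-pow : ∀ s e → term (powMon (unitMon s) e) ≡ pow (var s) e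
    term-pow s = pow-ind (λ e f → term (powMon (unitMon s) e) ≡ f) refl
      (λ {e} {f} → term-* {unitMon s} {powMon (unitMon s) e} {var s} {f} refl)

    term-flagMon : ∀ t → term (flagMon t) ≡ ∏ (List.allFin n) (λ i → pow (var (flag i)) (t i))
    term-flagMon t = ∏-ind (λ l f → term (prodMon u l) ≡ f) refl
      (λ i {l} {f} → term-* {u i} {prodMon u l} {pow (var (flag i)) (t i)} {f} (term-pow (flag i) (t i))) (List.allFin n)
      where
      u : Fin n → Mon (N n)
      u i = powMon (unitMon (flag i)) (t i)

    type-flagMon : ∀ t → type n (flagMon t) ≐ t
    type-flagMon t = ≐-trans (type-prod (λ i → powMon (unitMon (flag i)) (t i)) (List.allFin n))
      (≐-trans (prodMon-cong (List.allFin n) (λ i → ≐-trans (type-pow (unitMon (flag i)) (t i)) (powMon-cong (t i) (type-unit (flag i) i (∣flag∣ i)))))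
               (prodMon-unit t))

    flagMon-support : ∀ t s → flagMon t s ≢ 0 → ∃ λ i → setOf n s ≡ initial i
    flagMon-support t s = support (List.allFin n)
      where
      support : ∀ l → prodMon (λ i → powMon (unitMon (flag i)) (t i)) l s ≢ 0 → ∃ λ i → setOf n s ≡ initial i
      support []      ≢0 = contradiction refl ≢0
      support (i ∷ l) ≢0 with flag i Fin.≟ s
      ... | yes refl = i , setOf-flag i
      ... | no  f≢s  = support l (λ e → ≢0 (trans (cong (ℕ._+ prodMon (λ i → powMon (unitMon (flag i)) (t i)) l s) (trans (powMon-* (unitMon (flag i)) (t i) s)
                         (trans (cong (t i ℕ.*_) (unitMon-≢ f≢s)) (ℕ.*-zeroʳ (t i))))) e))

    degree-flagMon : ∀ t → degree n (flagMon t) ≡ vol n t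
    degree-flagMon t = trans (ℤSums.when-yes (chainSupported? n (flagMon t)) chain) (vol-cong n (type-flagMon t))
      where
      chain : ChainSupported n (flagMon t)
      chain s s′ s≢0 s′≢0 with flagMon-support t s s≢0 | flagMon-support t s′ s′≢0
      ... | i , eq | j , eq′ rewrite eq | eq′ = initial-comparable i j

module _ where
  open ChowRing
  open import Algebra.Properties.Group (CommutativeRing.+-group ℤ.+-*-commutativeRing) using (∙-cancelʳ)
  open ℤLin

  lin-All : ∀ {k} (w : Mon k → ℤ) {f : Poly k} → All (λ t → w (proj₂ t) ≡ 0ℤ) f → lin w f ≡ 0ℤ
  lin-All w []                            = refl
  lin-All w (_∷_ {x = c , m} w≡0 rest) = cong₂ ℤ._+_ (trans (cong (ℤ._*_ c) w≡0) (ℤ.*-zeroʳ c)) (lin-All w rest)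

  lin-scale : ∀ {k} (w : Mon k → ℤ) c f → lin w (constₚ c *ₚ f) ≡ c ℤ.* lin w f
  lin-scale w c f = trans (lin-* w (constₚ c) f) (ℤ.+-identityʳ _)

  module _ (n : ℕ) where
    private module A = CommutativeRing (quotientRing (GenJ n))
    open Sums (CommutativeRing.commutativeSemiring (quotientRing (GenJ n)))

    lin-degree-~ : ∀ {f g} → f ≃ g → lin (degree n) f ≡ lin (degree n) g
    lin-degree-~ {f} {g} f~g = ∙-cancelʳ (lin (degree n) (negₚ g)) _ _
      (trans (trans (sym (lin-++ (degree n) f (negₚ g))) (degree-ideal {n} {f ++ negₚ g} (Mod.un~ f~g))) (sym (lin-neg (degree n) g)))

    L : Poly (N n) → ℤ
    L = lin (degree n)

    L-+ : ∀ a b → L (a + b) ≡ L a ℤ.+ L b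
    L-+ = lin-++ (degree n)

    L-ι : ∀ c a → L (constₚ c * a) ≡ c ℤ.* L a
    L-ι = lin-scale (degree n)

    private
      y : Fin n → Poly (N n)
      y i = var (flag n i)

    z-absorb : ∀ i → z n (suc (Fin.toℕ i)) * y i ≃ y i * y i
    z-absorb i = go (proj₂ (proj₂ (flagIndex n i)))
      where
      go : X n (initial i) ≡ y i → z n (suc (Fin.toℕ i)) * y i ≃ y i * y i
      go e = A.trans (A.*-congʳ {y i} (A.sym (level≃z n (Fin.toℕ i)))) (≡.subst (λ f → level n (suc (Fin.toℕ i)) * f ≃ f * f) e
        (level-absorb n (initial i) (∣initial∣ i)))

    z-top : ∀ i → suc (Fin.toℕ i) ≡ n → z n (suc (Fin.toℕ i)) ≃ y i
    z-top i top = A.trans (A.sym (level≃z n (Fin.toℕ i))) (A.trans (level-top n (initial i) top (∣initial∣ i))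
      (A.reflexive (proj₂ (proj₂ (flagIndex n i)))))
    L-flag : ∀ t → L (∏ (List.allFin n) (λ i → pow (y i) (t i))) ≡ vol n t
    L-flag t = trans (cong L (sym (term-flagMon n t))) (trans (ℤ.+-identityʳ _) (trans (ℤ.*-identityˡ _) (degree-flagMon n t)))

    L-homogeneous : ∀ {m f} → Homogeneous n m f → vol n m ≡ 0ℤ → L f ≡ 0ℤ
    L-homogeneous {m} hf vol≡0 = lin-All (degree n) (All.map (λ {s} → vanish {s}) hf)
      where
      vanish : ∀ {s : ℤ × Mon (N n)} → type n (proj₂ s) ≐ m → degree n (proj₂ s) ≡ 0ℤ
      vanish {s} e = ℤSums.when-zero (does (chainSupported? n (proj₂ s))) (trans (vol-cong n e) vol≡0)

    module P = Pairing (quotientRing (GenJ n)) (quotient-isScalar (GenJ n)) (zAt n) y L (Homogeneous n)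

    functional : P.Functional
    functional = record
      { L-resp = lin-degree-~
      ; L-0    = refl
      ; L-+    = L-+
      ; L-ι    = L-ι
      ; L-flag = L-flag
      ; L-Q    = λ {m} {a} → L-homogeneous {m} {a}
      ; absorb = z-absorb
      ; top    = z-top
      ; Q-≐    = λ {m} {u} {a} → homogeneous-≐ n {m} {u} {a}
      ; Q-1    = type-one n ∷ []
      ; Q-*    = λ {m} {u} {a} {b} → homogeneous-* n {m} {u} {a} {b}
      ; Q-s    = homogeneous-z n
      ; Q-y    = λ i → type-unit n (flag n i) i (∣flag∣ n i) ∷ [] }

    standard-injective : ∀ f → (∀ m → coeff f m ≢ 0ℤ → Standard n m) → φ n f ∈⟨ GenJ n ⟩ → f ≈ 0ₚ
    standard-injective f std φf∈J = P.Functional.standard-independent functional f std (A.trans (A.sym (φ≃eval n f)) (Mod.∈⇒~0 (GenJ n) φf∈J))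

-- Leading monomials.

coeff-absent : ∀ {k} {m : Mon k} {f} → All (λ t → ¬ (proj₂ t ≐ m)) f → coeff f m ≡ 0ℤ
coeff-absent []                                = refl
coeff-absent (_∷_ {x = c , u} {xs = f} ¬p all) = trans (coeff-no c f ¬p) (coeff-absent all)

coeff≢0⇒∈ : ∀ {k} {m : Mon k} f → coeff f m ≢ 0ℤ → Any (λ t → proj₂ t ≐ m) f
coeff≢0⇒∈ []            ≢0 = contradiction refl ≢0
coeff≢0⇒∈ {m = m} ((c , u) ∷ f) ≢0 with u ≐? m
... | yes p = here p
... | no ¬p = there (coeff≢0⇒∈ f (λ e → ≢0 (trans (coeff-no c f ¬p) e)))

single-cong : ∀ {k} {c d} {m u : Mon k} → c ≡ d → m ≐ u → ((c , m) ∷ []) ≈ ((d , u) ∷ [])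
single-cong {c = c} {m = m} {u} refl m≐u v with m ≐? v
... | yes p = trans (coeff-yes c [] p) (sym (coeff-yes c [] (≐-trans (≐-sym m≐u) p)))
... | no ¬p = trans (coeff-no c [] ¬p) (sym (coeff-no c [] (λ q → ¬p (≐-trans m≐u q))))

extract : ∀ {k} (m : Mon k) f → f ≈ ((coeff f m , m) ∷ remove m f)
extract m f u with m ≐? u
... | yes p = trans (coeff-cong f (≐-sym p)) (sym (trans (coeff-yes (coeff f m) (remove m f) p)
                (trans (cong (ℤ._+_ (coeff f m)) (coeff-remove-≐ f (≐-sym p))) (ℤ.+-identityʳ _))))
... | no ¬p = sym (trans (coeff-no (coeff f m) (remove m f) ¬p) (coeff-remove-≭ f (λ q → ¬p (≐-sym q))))

unitMon-self≢ : ∀ {k} {i j : Fin k} → i ≢ j → ¬ (unitMon i ≐ unitMon j)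
unitMon-self≢ {i = i} {j} i≢j e = contradiction (trans (sym (unitMon-refl i)) (trans (e i) (unitMon-≢ (i≢j ∘ sym)))) λ ()

module Leading {k} {_≺_ : Mon k → Mon k → Set}
  (resp : ∀ {m m′ u u′} → m ≐ m′ → u ≐ u′ → m ≺ u → m′ ≺ u′) (irrefl : ∀ {m} → ¬ (m ≺ m))
  (≺-trans : ∀ {m u w} → m ≺ u → u ≺ w → m ≺ w) (mult : ∀ {m u} w → m ≺ u → (m ⊕ w) ≺ (u ⊕ w)) where

  _≼_ : Mon k → Mon k → Set
  m ≼ u = m ≺ u ⊎ m ≐ u

  ≼-respʳ : ∀ {m u u′} → u ≐ u′ → m ≼ u → m ≼ u′
  ≼-respʳ e (inj₁ lt) = inj₁ (resp ≐-refl e lt)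
  ≼-respʳ e (inj₂ eq) = inj₂ (≐-trans eq e)

  ≼-≺-trans : ∀ {m u w} → m ≼ u → u ≺ w → m ≺ w
  ≼-≺-trans (inj₁ lt) lt′ = ≺-trans lt lt′
  ≼-≺-trans (inj₂ eq) lt′ = resp (≐-sym eq) ≐-refl lt′

  ≺-≼-⊕ : ∀ {m m′ u u′} → m ≺ m′ → u ≼ u′ → (m ⊕ u) ≺ (m′ ⊕ u′)
  ≺-≼-⊕ {m} {m′} {u} {u′} lt (inj₂ eq) = resp ≐-refl (⊕-cong ≐-refl eq) (mult u lt)
  ≺-≼-⊕ {m} {m′} {u} {u′} lt (inj₁ lt′) = ≺-trans (mult u lt) (resp (⊕-comm u m′) (⊕-comm u′ m′) (mult m′ lt′))

  ≼-⊕ : ∀ {m m′ u u′} → m ≼ m′ → u ≼ u′ → (m ⊕ u) ≼ (m′ ⊕ u′)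
  ≼-⊕ (inj₁ lt) le = inj₁ (≺-≼-⊕ lt le)
  ≼-⊕ {m} {m′} {u} {u′} (inj₂ eq) (inj₁ lt) = inj₁ (resp (⊕-comm u m) (⊕-comm u′ m′) (≺-≼-⊕ lt (inj₂ eq)))
  ≼-⊕ (inj₂ eq) (inj₂ eq′) = inj₂ (⊕-cong eq eq′)

  ≺⇒≭ : ∀ {m u} → m ≺ u → ¬ (m ≐ u)
  ≺⇒≭ lt eq = irrefl (resp eq ≐-refl lt)

  -- c may be 0: then m is only a bound for the monomials of f.
  record Leads (f : Poly k) (m : Mon k) (c : ℤ) : Set where
    constructor leads
    field
      below : All (λ t → proj₂ t ≼ m) f
      coeff≡ : coeff f m ≡ c
  open Leads public

  leads-resp : ∀ {f m u c d} → m ≐ u → c ≡ d → Leads f m c → Leads f u d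
  leads-resp {f} e refl (leads b c) = leads (All.map (≼-respʳ e) b) (trans (sym (coeff-cong f e)) c)

  leads-0 : ∀ {m} → Leads 0ₚ m 0ℤ
  leads-0 = leads [] refl

  leads-single : ∀ c m → Leads ((c , m) ∷ []) m c
  leads-single c m = leads (inj₂ ≐-refl ∷ []) (trans (coeff-yes c {m} {m} [] ≐-refl) (ℤ.+-identityʳ c))

  leads-+ : ∀ {f g m c d} → Leads f m c → Leads g m d → Leads (f +ₚ g) m (c ℤ.+ d)
  leads-+ {f} {g} {m} (leads b e) (leads b′ e′) = leads (All.++⁺ b b′) (trans (coeff-++ f g m) (cong₂ ℤ._+_ e e′))

  -- If one factor of a product of terms lies strictly below its bound, so does the product. Thus
  -- the coefficient at m ⊕ u comes only from the terms at m and u, also when these coefficients are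
  -- 0.
  leads-* : ∀ {f g m u c d} → Leads f m c → Leads g u d → Leads (f *ₚ g) (m ⊕ u) (c ℤ.* d)
  leads-* {f} {g} {m} {u} (leads b e) (leads b′ e′) = leads
    (All.concat⁺ (All.map⁺ (All.map (λ p → All.map⁺ (All.map (λ q → ≼-⊕ p q) b′)) b)))
    (trans (coeff-* f b) (cong₂ ℤ._*_ e e′))
    where
    scaled : Poly k → ℤ → Mon k → Poly k
    scaled g a w = map (λ s → a ℤ.* proj₁ s , w ⊕ proj₂ s) g

    coeff-scaled-≐ : ∀ a {w} → w ≐ m → ∀ g → All (λ t → proj₂ t ≼ u) g → coeff (scaled g a w) (m ⊕ u) ≡ a ℤ.* coeff g u
    coeff-scaled-≐ a w≐m []            _        = sym (ℤ.*-zeroʳ a)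
    coeff-scaled-≐ a {w} w≐m ((d , v) ∷ g) (le ∷ b) = go le
      where
      go : v ≼ u → coeff (scaled ((d , v) ∷ g) a w) (m ⊕ u) ≡ a ℤ.* coeff ((d , v) ∷ g) u
      go (inj₂ v≐u) = trans (coeff-yes (a ℤ.* d) (scaled g a w) (⊕-cong w≐m v≐u)) (trans (cong (ℤ._+_ (a ℤ.* d)) (coeff-scaled-≐ a w≐m g b))
        (trans (sym (ℤ.*-distribˡ-+ a d _)) (cong (ℤ._*_ a) (sym (coeff-yes d g v≐u)))))
      go (inj₁ v≺u) = trans (coeff-no (a ℤ.* d) (scaled g a w) (≺⇒≭ (resp (⊕-comm v w) (⊕-comm u m) (≺-≼-⊕ v≺u (inj₂ w≐m)))))
        (trans (coeff-scaled-≐ a w≐m g b) (cong (ℤ._*_ a) (sym (coeff-no d g (≺⇒≭ v≺u)))))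

    coeff-* : ∀ f → All (λ t → proj₂ t ≼ m) f → coeff (f *ₚ g) (m ⊕ u) ≡ coeff f m ℤ.* coeff g u
    coeff-* []            _        = refl
    coeff-* ((a , w) ∷ f) (le ∷ b) = trans (coeff-++ (scaled g a w) (f *ₚ g) (m ⊕ u)) (go le)
      where
      go : w ≼ m → coeff (scaled g a w) (m ⊕ u) ℤ.+ coeff (f *ₚ g) (m ⊕ u) ≡ coeff ((a , w) ∷ f) m ℤ.* coeff g u
      go (inj₂ w≐m) = trans (cong₂ ℤ._+_ (coeff-scaled-≐ a w≐m g b′) (coeff-* f b))
        (trans (sym (ℤ.*-distribʳ-+ (coeff g u) a (coeff f m))) (cong (ℤ._* coeff g u) (sym (coeff-yes a f w≐m))))
      go (inj₁ w≺m) = trans (cong₂ ℤ._+_ (coeff-absent (All.map⁺ (All.map (λ v≼u → ≺⇒≭ (≺-≼-⊕ w≺m v≼u)) b′))) (coeff-* f b))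
        (trans (ℤ.+-identityˡ _) (cong (ℤ._* coeff g u) (sym (coeff-no a f (≺⇒≭ w≺m)))))

  leads-^ : ∀ {f m c} e → Leads f m c → Leads (f ^ₚ e) (powMon m e) (c ℤ.^ e)
  leads-^     zero    l = leads-single 1ℤ oneMon
  leads-^ {f} (suc e) l = leads-* l (leads-^ e l)

  leads-Σ-0 : ∀ {I : Set} {F : I → Poly k} {m l} → All (λ i → Leads (F i) m 0ℤ) l → Leads (Σₚ (map F l)) m 0ℤ
  leads-Σ-0 []       = leads-0
  leads-Σ-0 (l ∷ ls) = leads-+ l (leads-Σ-0 ls)

  leads-range : ∀ {b e F m c} → b ℕ.≤ e → Leads (F b) m c → (∀ i → b ℕ.< i → Leads (F i) m 0ℤ) → Leads (ΣRange b e F) m c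
  leads-range {b} {e} {F} {m} {c} b≤e l ls = ≡.subst (λ r → Leads (Σₚ (map (λ j → F (b ℕ.+ j)) (upTo r))) m c) (sym (ℕ.+-∸-assoc 1 b≤e))
    (leads-resp ≐-refl (ℤ.+-identityʳ c) (leads-+ (≡.subst (λ i → Leads (F i) m c) (sym (ℕ.+-identityʳ b)) l)
      (leads-Σ-0 (All.applyUpTo⁺₂ suc (e ∸ b) (λ j → ls (b ℕ.+ suc j) (ℕ.m<m+n b (s≤s z≤n)))))))

  leads-range-0 : ∀ {b e F m} → (∀ i → b ℕ.≤ i → Leads (F i) m 0ℤ) → Leads (ΣRange b e F) m 0ℤ
  leads-range-0 {b} {e} ls = leads-Σ-0 (All.applyUpTo⁺₂ (λ j → j) (suc e ∸ b) (λ j → ls (b ℕ.+ j) (ℕ.m≤m+n b j)))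

  leads⇒leadMon : ∀ {f m} → Leads f m 1ℤ → LeadMon _≺_ f m
  leads⇒leadMon {f} (leads b e) = (λ e′ → contradiction (trans (sym e) e′) λ ()) , λ u ≢0 → bound (coeff≢0⇒∈ f ≢0) b
    where
    bound : ∀ {u m g} → Any (λ t → proj₂ t ≐ u) g → All (λ t → proj₂ t ≼ m) g → u ≺ m ⊎ u ≐ m
    bound (here e)  (inj₁ lt ∷ _) = inj₁ (resp e ≐-refl lt)
    bound (here e)  (inj₂ eq ∷ _) = inj₂ (≐-trans (≐-sym e) eq)
    bound (there p) (_ ∷ all)     = bound p all

-- Division by the generators, the kernel and the Gröbner property.

module Reduction {n} {_≺_ : Mon n → Mon n → Set}
  (resp : ∀ {m m′ u u′} → m ≐ m′ → u ≐ u′ → m ≺ u → m′ ≺ u′) (irrefl : ∀ {m} → ¬ (m ≺ m))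
  (≺-trans : ∀ {m u w} → m ≺ u → u ≺ w → m ≺ w) (mult : ∀ {m u} w → m ≺ u → (m ⊕ w) ≺ (u ⊕ w))
  (wellFounded : WellFounded _≺_) (decreasing : ∀ i j → i Fin.< j → unitMon j ≺ unitMon i) where

  open Leading resp irrefl ≺-trans mult

  Z-leads-0 : ∀ i l → suc (Fin.toℕ i) ℕ.< l → Leads (Z n l) (unitMon i) 0ℤ
  Z-leads-0 i (suc l) (s≤s i<l) with ChowRing.Z-cases n l
  ... | inj₁ (j , refl , eq) rewrite eq = leads (inj₁ (decreasing i j i<l) ∷ [])
          (coeff-no 1ℤ [] (unitMon-self≢ {i = j} {i} (λ { refl → ℕ.<-irrefl refl i<l })))
  ... | inj₂ (_ , eq) rewrite eq = leads-0

  Z-leads-1 : ∀ i → Leads (Z n (suc (Fin.toℕ i))) (unitMon i) 1ℤ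
  Z-leads-1 i with ChowRing.Z-cases n (Fin.toℕ i)
  ... | inj₁ (j , j≡i , eq) rewrite eq | Fin.toℕ-injective j≡i = leads-single 1ℤ (unitMon i)
  ... | inj₂ (n≤i , _) = contradiction (Fin.toℕ<n i) (ℕ.≤⇒≯ n≤i)

  ΣZ-leads-0 : ∀ i l → suc (Fin.toℕ i) ℕ.< l → Leads (ΣRange l n (Z n)) (unitMon i) 0ℤ
  ΣZ-leads-0 i l i<l = leads-range-0 {l} {n} {Z n} (λ l′ l≤l′ → Z-leads-0 i l′ (ℕ.≤-trans i<l l≤l′))

  ΣZ-leads-1 : ∀ i → Leads (ΣRange (suc (Fin.toℕ i)) n (Z n)) (unitMon i) 1ℤ
  ΣZ-leads-1 i = leads-range {suc (Fin.toℕ i)} {n} {Z n} (Fin.toℕ<n i) (Z-leads-1 i) (Z-leads-0 i)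

  leads-const-* : ∀ c {f m d} → Leads f m d → Leads (constₚ c *ₚ f) m (c ℤ.* d)
  leads-const-* c l = leads-resp ≐-refl refl (leads-* (leads-single c oneMon) l)

  -- The summand l = b has coefficient binom(b-a-1, b-a-1) = 1 and leading monomial Z_b^(b-a). For l
  -- > b the bracket starts with Z_l, below Z_b, and as b - a > 0 its power has coefficient 0 at
  -- Z_b^(b-a).
  sum-leads : ∀ a i → a ℕ.< suc (Fin.toℕ i) → let b = suc (Fin.toℕ i) in
    Leads (ΣRange b n (λ l → constₚ (ℤ.+ ((l ∸ a ∸ 1) C (b ∸ a ∸ 1))) *ₚ (ΣRange l n (Z n) ^ₚ (b ∸ a)))) (powMon (unitMon i) (b ∸ a)) 1ℤ
  sum-leads a i a<b = leads-range {b} {n} (Fin.toℕ<n i)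
    (leads-resp ≐-refl (trans (cong (λ c → ℤ.+ c ℤ.* (1ℤ ℤ.^ (b ∸ a))) (nCn≡1 (b ∸ a ∸ 1))) (trans (ℤ.*-identityˡ _) (ℤ.^-zeroˡ (b ∸ a))))
      (leads-const-* (ℤ.+ ((b ∸ a ∸ 1) C (b ∸ a ∸ 1))) (leads-^ (b ∸ a) (ΣZ-leads-1 i))))
    (λ l b<l → leads-resp ≐-refl (trans (cong (ℤ._*_ (ℤ.+ ((l ∸ a ∸ 1) C (b ∸ a ∸ 1)))) (zero-^ (ℕ.m<n⇒0<n∸m a<b))) (ℤ.*-zeroʳ (ℤ.+ ((l ∸ a ∸ 1) C (b ∸ a ∸ 1)))))
      (leads-const-* (ℤ.+ ((l ∸ a ∸ 1) C (b ∸ a ∸ 1))) (leads-^ (b ∸ a) (ΣZ-leads-0 i l b<l))))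
    where
    b = suc (Fin.toℕ i)
    zero-^ : ∀ {e} → 0 ℕ.< e → 0ℤ ℤ.^ e ≡ 0ℤ
    zero-^ {suc e} _ = refl

  LeadDivisor : Mon n → Set
  LeadDivisor m = ∃₂ λ a b → a ℕ.< b × b ℕ.≤ n × ∃₂ λ w u → Leads (gen n a b) u 1ℤ × m ≐ (w ⊕ u)

  divides : ∀ {m u : Mon n} → (∀ j → u j ℕ.≤ m j) → ∃ λ w → m ≐ (w ⊕ u)
  divides {m} {u} u≤m = (λ j → m j ∸ u j) , λ j → sym (ℕ.m∸n+n≡m (u≤m j))

  powMon-unit-≤ : ∀ {m : Mon n} i e → e ℕ.≤ m i → ∀ j → powMon (unitMon i) e j ℕ.≤ m j
  powMon-unit-≤ {m} i e e≤mi j with i Fin.≟ j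
  ... | yes refl = ℕ.≤-trans (ℕ.≤-reflexive (trans (powMon-* (unitMon i) e i) (trans (cong (e ℕ.*_) (unitMon-refl i)) (ℕ.*-identityʳ e)))) e≤mi
  ... | no i≢j = ℕ.≤-trans (ℕ.≤-reflexive (trans (powMon-* (unitMon i) e j) (trans (cong (e ℕ.*_) (unitMon-≢ i≢j)) (ℕ.*-zeroʳ e)))) z≤n

  unit-powMon-≤ : ∀ {m : Mon n} h i e → h ≢ i → m h ≢ 0 → e ℕ.≤ m i → ∀ j → unitMon h j ℕ.+ powMon (unitMon i) e j ℕ.≤ m j
  unit-powMon-≤ {m} h i e h≢i mh≢0 e≤mi j with h Fin.≟ j
  ... | no h≢j  = powMon-unit-≤ {m} i e e≤mi j
  ... | yes refl = ℕ.≤-trans (ℕ.≤-reflexive (cong suc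
      (trans (powMon-* (unitMon i) e h) (trans (cong (e ℕ.*_) (unitMon-≢ (h≢i ∘ sym))) (ℕ.*-zeroʳ e))))) (ℕ.n≢0⇒n>0 mh≢0)

  -- The two forms of reducibility are divisibility by the leading monomials of the generators, with
  -- a = 0 and with a > 0.
  reducible⇒leadDivisor : ∀ m → Reducible n m → LeadDivisor m
  reducible⇒leadDivisor m (inj₁ (i , le)) with divides (powMon-unit-≤ {m} i (suc (Fin.toℕ i)) le)
  ... | w , m≐ = 0 , suc (Fin.toℕ i) , s≤s z≤n , Fin.toℕ<n i , w , powMon (unitMon i) (suc (Fin.toℕ i)) ,
    leads-resp ≐-refl refl (leads-* (leads-single 1ℤ oneMon) (sum-leads 0 i (s≤s z≤n))) , m≐
  reducible⇒leadDivisor m (inj₂ (h , i , h<i , mh≢0 , le))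
    with divides {u = unitMon h ⊕ powMon (unitMon i) (Fin.toℕ i ∸ Fin.toℕ h)} (unit-powMon-≤ {m} h i (Fin.toℕ i ∸ Fin.toℕ h) (λ { refl → ℕ.<-irrefl refl h<i }) mh≢0 le)
  ... | w , m≐ = suc (Fin.toℕ h) , suc (Fin.toℕ i) , s≤s h<i , Fin.toℕ<n i , w , unitMon h ⊕ powMon (unitMon i) (Fin.toℕ i ∸ Fin.toℕ h) ,
    leads-* (Z-leads-1 h) (sum-leads (suc (Fin.toℕ h)) i (s≤s h<i)) , m≐

  private
    module I = Mod (GenI n)
    module I-ring = CommutativeRing (quotientRing (GenI n))

  -- P bounds the monomials of the normal form: the Gröbner argument has to know that reducing the
  -- terms below m never reaches m.
  record NormalForm (P : Mon n → Set) (f : Poly n) : Set where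
    field
      form     : Poly n
      reduces  : f I.~ form
      standard : All (λ t → Standard n (proj₂ t)) form
      bounded  : All (λ t → P (proj₂ t)) form
  open NormalForm public

  weaken : ∀ {P Q : Mon n → Set} {f} → (∀ {m} → P m → Q m) → NormalForm P f → NormalForm Q f
  weaken P⇒Q nf = record { NormalForm nf ; bounded = All.map P⇒Q (bounded nf) }

  normalForm-+ : ∀ {P} {f g} → NormalForm P f → NormalForm P g → NormalForm P (f +ₚ g)
  normalForm-+ nf nf′ = record
    { form     = form nf +ₚ form nf′
    ; reduces  = I-ring.+-cong (reduces nf) (reduces nf′)
    ; standard = All.++⁺ (standard nf) (standard nf′)
    ; bounded  = All.++⁺ (bounded nf) (bounded nf′) }

  normalForm-scale : ∀ {P} c m → NormalForm P ((1ℤ , m) ∷ []) → NormalForm P ((c , m) ∷ [])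
  normalForm-scale c m nf = record
    { form     = constₚ c *ₚ form nf
    ; reduces  = I-ring.trans (I.≈⇒~ (mk≋ (single-cong {c = c} {c ℤ.* 1ℤ} {m} {m} (sym (ℤ.*-identityʳ c)) ≐-refl))) (I-ring.*-congˡ {constₚ c} {(1ℤ , m) ∷ []} {form nf} (reduces nf))
    ; standard = All.++⁺ (All.map⁺ (standard nf)) []
    ; bounded  = All.++⁺ (All.map⁺ (bounded nf)) [] }

  normalForm-list : ∀ {P} f → All (λ t → NormalForm P ((1ℤ , proj₂ t) ∷ [])) f → NormalForm P f
  normalForm-list []            []         = record { form = [] ; reduces = I-ring.refl {[]} ; standard = [] ; bounded = [] }
  normalForm-list ((c , m) ∷ f) (nf ∷ nfs) = normalForm-+ (normalForm-scale c m nf) (normalForm-list f nfs)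

  remove-≺ : ∀ {m} f → All (λ t → proj₂ t ≼ m) f → All (λ t → proj₂ t ≺ m) (remove m f)
  remove-≺ {m} f below = All.map (λ {t} → strict {t}) (All.zip (All.filter⁺ (_≉? m) below , All.all-filter (_≉? m) f))
    where
    strict : ∀ {t : ℤ × Mon n} → proj₂ t ≼ m × ¬ (proj₂ t ≐ m) → proj₂ t ≺ m
    strict (inj₁ lt , _)  = lt
    strict (inj₂ eq , ≭) = contradiction eq ≭

  -- A reducible m is the leading monomial, with coefficient 1, of a multiple of a generator. Modulo
  -- the ideal it is minus the rest of this multiple, whose terms are smaller and have normal forms
  -- by induction.
  normalForm-term : ∀ m → Acc _≺_ m → NormalForm (_≼ m) ((1ℤ , m) ∷ [])
  normalForm-term m (acc smaller) = go (standard-or-reducible n m)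
    where
    go : Standard n m ⊎ Reducible n m → NormalForm (_≼ m) ((1ℤ , m) ∷ [])
    go (inj₁ std) = record { form = (1ℤ , m) ∷ [] ; reduces = I-ring.refl ; standard = std ∷ [] ; bounded = inj₂ ≐-refl ∷ [] }
    go (inj₂ red) = reduce (reducible⇒leadDivisor m red)
      where
      reduce : LeadDivisor m → NormalForm (_≼ m) ((1ℤ , m) ∷ [])
      reduce (a , b , a<b , b≤n , w , u , lead , m≐) = record
        { form     = negₚ (form nf)
        ; reduces  = I.~-neg {(1ℤ , m) ∷ []} {rest} {form nf} (∈-resp (GenI n) {multiple} {(1ℤ , m) ∷ rest} (mk≋ split) (∈-* (GenI n) ((1ℤ , w) ∷ []) {gen n a b} (∈-gen (GenI n) (gen-ab a b a<b b≤n)))) (reduces nf)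
        ; standard = All.map⁺ (standard nf)
        ; bounded  = All.map⁺ (All.map inj₁ (bounded nf)) }
        where
        multiple = ((1ℤ , w) ∷ []) *ₚ gen n a b
        lead-multiple : Leads multiple m 1ℤ
        lead-multiple = leads-resp (≐-sym m≐) refl (leads-* (leads-single 1ℤ w) lead)
        rest = remove m multiple
        split : multiple ≈ ((1ℤ , m) ∷ rest)
        split = ≡.subst (λ c → multiple ≈ ((c , m) ∷ rest)) (coeff≡ lead-multiple) (extract m multiple)
        nf : NormalForm (_≺ m) rest
        nf = normalForm-list rest (All.map (λ lt → weaken (λ le → ≼-≺-trans le lt) (normalForm-term _ (smaller lt))) (remove-≺ {m} multiple (below lead-multiple)))

  normalForm : ∀ {m} f → All (λ t → proj₂ t ≺ m) f → NormalForm (_≺ m) f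
  normalForm f below = normalForm-list f (All.map (λ lt → weaken (λ le → ≼-≺-trans le lt) (normalForm-term _ (wellFounded _))) below)

  normalForm-any : ∀ f → NormalForm (λ _ → Unit) f
  normalForm-any f = normalForm-list f (All.universal (λ t → weaken (λ _ → tt) (normalForm-term (proj₂ t) (wellFounded (proj₂ t)))) f)

  standard-coeff : ∀ {f} → All (λ t → Standard n (proj₂ t)) f → ∀ m → coeff f m ≢ 0ℤ → Standard n m
  standard-coeff {f} std m ≢0 = go (coeff≢0⇒∈ f ≢0) std
    where
    go : ∀ {f} → Any (λ t → proj₂ t ≐ m) f → All (λ t → Standard n (proj₂ t)) f → Standard n m
    go (here e)  (s ∷ _)   = standard-resp n e s
    go (there p) (_ ∷ all) = go p all

  φ-reduces : ∀ {f g} → f I.~ g → φ n f ∈⟨ GenJ n ⟩ → φ n g ∈⟨ GenJ n ⟩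
  φ-reduces {f} {g} f~g φf∈J = Mod.~0⇒∈ (GenJ n) (A.trans (φ≃eval g) (A.trans (A.sym (eval-mod {f} {g} (I.un~ f~g)))
      (A.trans (A.sym (φ≃eval f)) (Mod.∈⇒~0 (GenJ n) φf∈J))))
    where
    open ChowRing n
    module A = CommutativeRing (quotientRing (GenJ n))

  -- Reduction changes f only by the ideal, which φ maps into J. So the normal form also lies in the
  -- kernel, and by independence of the standard monomials it is 0.
  kernel⊆ideal : ∀ f → φ n f ∈⟨ GenJ n ⟩ → f ∈⟨ GenI n ⟩
  kernel⊆ideal f φf∈J = I.~0⇒∈ (I-ring.trans (reduces nf) (I.≈⇒~ (mk≋
      (standard-injective n (form nf) (standard-coeff (standard nf)) (φ-reduces {f} {form nf} (reduces nf) φf∈J)))))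
    where nf = normalForm-any f

  -- A reducible leading monomial is divisible by that of a generator, which has leading coefficient
  -- 1, so the quotient takes over the whole coefficient. A standard one leads to a contradiction
  -- with independence.
  groebner : IsGroebnerBasis _≺_ (GenI n) (λ f → f ∈⟨ GenI n ⟩)
  groebner = (λ g → ∈-gen (GenI n)) , λ f m f∈I lead → leading f m f∈I lead (standard-or-reducible n m)
    where
    IsLeadTerm : Poly n → Set
    IsLeadTerm t = Σ (Poly n) λ g → Σ (Mon n) λ u → GenI n g × LeadMon _≺_ g u × t ≡ leadTerm g u

    leading : ∀ f m → f ∈⟨ GenI n ⟩ → LeadMon _≺_ f m → Standard n m ⊎ Reducible n m → leadTerm f m ∈⟨ IsLeadTerm ⟩
    leading f m f∈I lead (inj₂ red) with reducible⇒leadDivisor m red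
    ... | a , b , a<b , b≤n , w , u , l , m≐ =
      (((coeff f m , w) ∷ []) , leadTerm (gen n a b) u) ∷ [] ,
      (gen n a b , u , gen-ab a b a<b b≤n , leads⇒leadMon l , refl) ∷ [] ,
      single-cong {c = coeff f m} {coeff f m ℤ.* coeff (gen n a b) u} {m} {w ⊕ u} (sym (trans (cong (ℤ._*_ (coeff f m)) (coeff≡ l)) (ℤ.*-identityʳ _))) m≐
    leading f m f∈I (c≢0 , max) (inj₁ std) = contradiction (trans (sym coeff-m) vanishes) c≢0
      where
      Occurs : Mon n → Set
      Occurs u = coeff f u ≢ 0ℤ

      occurs? : ∀ u → Dec (Occurs u)
      occurs? u = ¬? (coeff f u ℤ.≟ 0ℤ)

      occurs-resp : ∀ {u v} → u ≐ v → Occurs u → Occurs v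
      occurs-resp e ≢0 ≡0 = ≢0 (trans (coeff-cong f e) ≡0)

      -- The list f may contain cancelling terms above m, about which `LeadMon` says nothing. They
      -- are dropped before the division, so that every remaining term is bounded by m.
      clean rest : Poly n
      clean = filter (occurs? ∘ proj₂) f
      rest  = remove m clean

      clean-coeff : ∀ u → coeff clean u ≡ coeff f u
      clean-coeff u with occurs? u
      ... | yes o = coeff-filter-yes occurs? occurs-resp f o
      ... | no ¬o = trans (coeff-filter-no occurs? occurs-resp f ¬o) (sym (decidable-stable (coeff f u ℤ.≟ 0ℤ) ¬o))

      split : f ≈ ((coeff f m , m) ∷ rest)
      split u = trans (sym (clean-coeff u)) (≡.subst (λ c → coeff clean u ≡ coeff ((c , m) ∷ rest) u) (clean-coeff m) (extract m clean u))

      nf : NormalForm (_≺ m) rest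
      nf = normalForm rest (remove-≺ clean (All.map (λ {t} → max (proj₂ t)) (All.all-filter (occurs? ∘ proj₂) f)))

      g : Poly n
      g = ((coeff f m , m) ∷ []) +ₚ form nf

      f~g : f I.~ g
      f~g = I-ring.trans (I.≈⇒~ {f} {((coeff f m , m) ∷ []) +ₚ rest} (mk≋ split)) (I-ring.+-congˡ {(coeff f m , m) ∷ []} {rest} {form nf} (reduces nf))

      -- The polynomial g is standard and congruent to f modulo the ideal, so it is 0. But its
      -- coefficient at m is still that of f, because the reduced terms stay strictly below m.
      vanishes : coeff g m ≡ 0ℤ
      vanishes = standard-injective n g (standard-coeff {g} (std ∷ standard nf)) (φ-reduces {f} {g} f~g (ChowRing.φ-ideal n {f} f∈I)) m

      coeff-m : coeff g m ≡ coeff f m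
      coeff-m = trans (coeff-yes (coeff f m) {m} {m} (form nf) ≐-refl) (trans (cong (ℤ._+_ (coeff f m)) (coeff-absent {f = form nf} (All.map ≺⇒≭ (bounded nf)))) (ℤ.+-identityʳ _))

-- The lexicographic order, and the theorem.

_≺ₗ_ : ∀ {k} → Mon k → Mon k → Set
_≺ₗ_ {zero}  m u = Empty
_≺ₗ_ {suc k} m u = m Fin.zero ℕ.< u Fin.zero ⊎ (m Fin.zero ≡ u Fin.zero × (m ∘ Fin.suc) ≺ₗ (u ∘ Fin.suc))

-- The isomorphism mentions no order, but its proof divides by the generators. The lexicographic
-- order with Z_1 largest serves for this.
≺ₗ-resp : ∀ {k} {m m′ u u′ : Mon k} → m ≐ m′ → u ≐ u′ → m ≺ₗ u → m′ ≺ₗ u′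
≺ₗ-resp {suc k} e e′ (inj₁ lt)        = inj₁ (≡.subst₂ ℕ._<_ (e Fin.zero) (e′ Fin.zero) lt)
≺ₗ-resp {suc k} e e′ (inj₂ (eq , lt)) = inj₂ (trans (sym (e Fin.zero)) (trans eq (e′ Fin.zero)) , ≺ₗ-resp (e ∘ Fin.suc) (e′ ∘ Fin.suc) lt)

≺ₗ-irrefl : ∀ {k} {m : Mon k} → ¬ (m ≺ₗ m)
≺ₗ-irrefl {suc k} (inj₁ lt)       = ℕ.<-irrefl refl lt
≺ₗ-irrefl {suc k} (inj₂ (_ , lt)) = ≺ₗ-irrefl {k} lt

≺ₗ-trans : ∀ {k} {m u w : Mon k} → m ≺ₗ u → u ≺ₗ w → m ≺ₗ w
≺ₗ-trans {suc k} (inj₁ lt)        (inj₁ lt′)         = inj₁ (ℕ.<-trans lt lt′)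
≺ₗ-trans {suc k} (inj₁ lt)        (inj₂ (eq , _))    = inj₁ (ℕ.<-≤-trans lt (ℕ.≤-reflexive eq))
≺ₗ-trans {suc k} (inj₂ (eq , _))  (inj₁ lt)          = inj₁ (ℕ.≤-<-trans (ℕ.≤-reflexive eq) lt)
≺ₗ-trans {suc k} (inj₂ (eq , lt)) (inj₂ (eq′ , lt′)) = inj₂ (trans eq eq′ , ≺ₗ-trans {k} lt lt′)

≺ₗ-mult : ∀ {k} {m u : Mon k} w → m ≺ₗ u → (m ⊕ w) ≺ₗ (u ⊕ w)
≺ₗ-mult {suc k} w (inj₁ lt)        = inj₁ (ℕ.+-monoˡ-< (w Fin.zero) lt)
≺ₗ-mult {suc k} w (inj₂ (eq , lt)) = inj₂ (cong (ℕ._+ w Fin.zero) eq , ≺ₗ-mult (w ∘ Fin.suc) lt)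

≺ₗ-wellFounded : ∀ {k} → WellFounded (_≺ₗ_ {k})
≺ₗ-wellFounded {zero}  = λ m → acc λ ()
≺ₗ-wellFounded {suc k} = On.wellFounded (λ m → m Fin.zero , m ∘ Fin.suc) (×-wellFounded <-wellFounded (≺ₗ-wellFounded {k}))

unitMon-≺ₗ : ∀ {k} (i j : Fin k) → i < j → unitMon j ≺ₗ unitMon i
unitMon-≺ₗ Fin.zero    (Fin.suc j) _         = inj₁ (s≤s z≤n)
unitMon-≺ₗ (Fin.suc i) (Fin.suc j) (s≤s i<j) = inj₂ (refl , unitMon-≺ₗ i j i<j)

-- The ring R^*(U_{r,n}) is generated by the z_l and is thus the image of φ in A^*, so the
-- equivalence, which identifies the kernel with the ideal, is the isomorphism with [Z_i]
-- corresponding to z_i.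
theorem3p13 : (n : ℕ) →
    (∀ f → (f ∈⟨ GenI n ⟩) ⇔ (φ n f ∈⟨ GenJ n ⟩)) ×
    (∀ (_≺_ : Mon n → Mon n → Set) → IsMonomialOrder _≺_ →
    (∀ i j → i < j → unitMon j ≺ unitMon i) →
    IsGroebnerBasis _≺_ (GenI n) (λ f → f ∈⟨ GenI n ⟩))
theorem3p13 n =
  (λ f → mk⇔ (ChowRing.φ-ideal n {f})
    (Reduction.kernel⊆ideal {n} {_≺ₗ_} ≺ₗ-resp ≺ₗ-irrefl ≺ₗ-trans ≺ₗ-mult ≺ₗ-wellFounded unitMon-≺ₗ f)) ,
  λ _≺_ order decreasing → let module O = IsMonomialOrder order in
    Reduction.groebner {n} {_≺_} O.resp O.irrefl O.trans O.mult O.wellFounded decreasing
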